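{- Suppose that the following holds (a conjecture, taken here as a hypothesis): the exponent $\alpha(d,4,s)$ satisfies $$\alpha(d,4,s)=\begin{cases}1,& d=2,\ s\in[\tfrac14,\tfrac12],\\ \frac d2,& d\ge4\text{ even},\ s\in[\tfrac14,\tfrac{d+2}{4d}],\\ \frac{d+2}{8s},& d\ge4\text{ even},\ s\in[\tfrac{d+2}{4d},\tfrac12],\\ \frac{d+1}{8s},& d\ge3\text{ odd},\ s\in[\tfrac14,\tfrac12].\end{cases}$$ Let $g$ be a primitive element of $\mathbb{F}_q$. Assume that either ($d=4k-1$ with $k\in\mathbb{N}$ and $q\equiv1\pmod4$) or ($d=4k+1$ with $k\in\mathbb{N}$). Let $E\subset S_g\subset\mathbb{F}_q^d$. (i) If $|E|\gg q^{\frac d2-\frac14}$, then $|\Delta(E)|\gg q$. (ii) If the energy estimate $\Lambda_4(E)\ll \frac{|E|^3}{q}+q^{\frac{d-3}{2}}|E|^2$ holds and $|E|\gg q^{\frac d2-\frac12}$, then $|\Delta(E)|\gg q$.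
   Context: $\mathbb{F}_q$ is a finite field of order $q$, $q$ an odd prime power; $g\in\mathbb{F}_q$ is primitive if it generates the multiplicative group $\mathbb{F}_q^*$. $\mathbb{N}=\{1,2,\dots\}$. For $\mathbf{x}\in\mathbb{F}_q^d$, $\|\mathbf{x}\|=x_1^2+\cdots+x_d^2$; $S_j=\{\mathbf{x}\in\mathbb{F}_q^d:\|\mathbf{x}\|=j\}$; $\Delta(E)=\{\|\mathbf{x}-\mathbf{y}\|:\mathbf{x},\mathbf{y}\in E\}$. The additive energy $\Lambda_4(E)$ is the number of quadruples $(\mathbf{x}_1,\mathbf{x}_2,\mathbf{x}_3,\mathbf{x}_4)\in E^4$ with $\mathbf{x}_1+\mathbf{x}_2=\mathbf{x}_3+\mathbf{x}_4$. Fix a nontrivial additive character $\chi$ of $\mathbb{F}_q$ and put $\widehat{E}(\mathbf{x})=q^{ -d}\sum_{\mathbf{y}\in E}\chi(-\mathbf{x}\cdot\mathbf{y})$ and $\|\widehat{E}\|_4=\big(q^{ -d}\sum_{\mathbf{x}\ne\mathbf{0}}|\widehat{E}(\mathbf{x})|^4\big)^{1/4}$. For $s\in[\tfrac14,\tfrac12]$, $E\subseteq\mathbb{F}_q^d$ is $(4,s)$-Salem if $\|\widehat{E}\|_4\ll q^{ -d}|E|^{1-s}$. The number $\alpha(d,4,s)$ is the smallest exponent $\alpha$ such that every $(4,s)$-Salem set $E\subseteq\mathbb{F}_q^d$ with $|E|\gg q^\alpha$ satisfies $|\Delta(E)|\gg q$. Notation: $A\ll B$ (equivalently $B\gg A$)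 means $A\le CB$ for a constant $C>0$ not depending on $q$ or on the sets involved. Implied constants in conclusions may depend on $d$, $s$ and on the implied constants in the hypotheses. -}

module Defs where

open import Algebra.Bundles using (CommutativeRing; Semiring)
open import Algebra.Structures using (IsCommutativeRing)
import Algebra.Definitions.RawSemiring as RawSemiringDefinitions
open import Data.Bool.Base using (Bool; T)
open import Data.Fin.Base using (Fin)
import Data.Fin.Properties as Fin
open import Data.List.Base using (List; []; _∷_; [_]; length; filter; filterᵇ; foldr; allFin; cartesianProduct; cartesianProductWith; deduplicate)
import Data.List.Base as List
open import Data.Nat.Base using (ℕ; zero; suc)
import Data.Nat.Base as ℕ
open import Data.Nat.Divisibility using (_∣_)
open import Data.Nat.DivMod using (_%_)
open import Data.Nat.Primality using (Prime)
open import Data.Product.Base using (_×_; _,_; ∃)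
open import Data.Sum.Base using (_⊎_)
open import Data.Vec.Base using (Vec; []; _∷_; zipWith; replicate)
import Data.Vec.Base as Vec
import Data.Vec.Properties as Vec
open import Function.Base using (_∘_)
open import Function.Bundles using (_↔_; Inverse)
open import Function.Properties.Inverse using (↔⇒↣)
open import Level using (0ℓ) renaming (suc to lsuc)
open import Relation.Binary.Core using (Rel)
open import Relation.Binary.Definitions using (DecidableEquality)
open import Relation.Binary.PropositionalEquality.Core using (_≡_; _≢_)
open import Relation.Binary.Structures using (IsDecTotalOrder)
import Relation.Binary.Construct.NonStrictToStrict as ToStrict
open import Relation.Nullary.Decidable using (¬?)
open import Relation.Nullary.Negation using (¬_)
open import Relation.Unary using (Pred)

-- The real numbers, given by the axioms of a Dedekind-complete ordered field,
-- which determine them up to unique isomorphism.  `_^_` is the real power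
-- function: on positive bases completeness provides exactly one operation
-- satisfying the laws below.  The values of `_⁻¹` at 0 and of `_^_` at negative
-- bases and at 0 with a non-positive exponent are left unspecified.

record Reals : Set (lsuc 0ℓ) where
  field
    commutativeRing : CommutativeRing 0ℓ 0ℓ

  open CommutativeRing commutativeRing public
    using (_≈_; _≉_; _+_; _*_; -_; _-_; 0#; 1#; semiring)
    renaming (Carrier to ℝ)

  infix  4 _≤_
  infixr 8 _^_
  infix  9 _⁻¹

  field
    _≤_             : Rel ℝ 0ℓ
    isDecTotalOrder : IsDecTotalOrder _≈_ _≤_

  open ToStrict _≈_ _≤_ public using (_<_)

  field
    0≉1       : 0# ≉ 1#
    _⁻¹       : ℝ → ℝ
    ⁻¹-cong   : ∀ {x y} → x ≈ y → x ⁻¹ ≈ y ⁻¹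
    *-inverse : ∀ {x} → x ≉ 0# → x * x ⁻¹ ≈ 1#
    +-monoˡ-≤ : ∀ {x y} z → x ≤ y → x + z ≤ y + z
    *-nonneg  : ∀ {x y} → 0# ≤ x → 0# ≤ y → 0# ≤ x * y
    supremum  : (P : Pred ℝ 0ℓ) → ∃ P → (∃ λ b → ∀ x → P x → x ≤ b) →
                ∃ λ u → (∀ x → P x → x ≤ u) ×
                        (∀ b → (∀ x → P x → x ≤ b) → u ≤ b)

    _^_         : ℝ → ℝ → ℝ
    ^-cong      : ∀ {x y r s} → x ≈ y → r ≈ s → x ^ r ≈ y ^ s
    ^-pos       : ∀ {x} r → 0# < x → 0# < x ^ r
    ^-identityʳ : ∀ {x} → 0# < x → x ^ 1# ≈ x
    ^-distribˡ-+ : ∀ {x} r s → 0# < x → x ^ (r + s) ≈ x ^ r * x ^ s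
    ^-*-assoc   : ∀ {x} r s → 0# < x → (x ^ r) ^ s ≈ x ^ (r * s)
    ^-distribʳ-* : ∀ {x y} r → 0# < x → 0# < y → (x * y) ^ r ≈ x ^ r * y ^ r
    ^-monoʳ-≤   : ∀ {x r s} → 1# ≤ x → r ≤ s → x ^ r ≤ x ^ s
    0^          : ∀ {r} → 0# < r → 0# ^ r ≈ 0#

  open RawSemiringDefinitions (Semiring.rawSemiring semiring) public
    using () renaming (_^_ to _^ⁿ_; _×_ to _·ⁿ_)

  infixl 7 _/_
  _/_ : ℝ → ℝ → ℝ
  x / y = x * y ⁻¹

  ι : ℕ → ℝ
  ι n = n ·ⁿ 1#

  _∈[_,_] : ℝ → ℝ → ℝ → Set
  s ∈[ a , b ] = a ≤ s × s ≤ b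

module Complex (R : Reals) where
  open Reals R

  record ℂ : Set where
    constructor _+i_
    field
      re im : ℝ
  open ℂ public

  infix  4 _≈ᶜ_
  infixl 6 _+ᶜ_
  infixl 7 _*ᶜ_ _•_

  _≈ᶜ_ : Rel ℂ 0ℓ
  z ≈ᶜ w = re z ≈ re w × im z ≈ im w

  0ᶜ 1ᶜ : ℂ
  0ᶜ = 0# +i 0#
  1ᶜ = 1# +i 0#

  _+ᶜ_ _*ᶜ_ : ℂ → ℂ → ℂ
  z +ᶜ w = (re z + re w) +i (im z + im w)
  z *ᶜ w = (re z * re w - im z * im w) +i (re z * im w + im z * re w)

  _•_ : ℝ → ℂ → ℂ
  a • z = (a * re z) +i (a * im z)

  abs : ℂ → ℝ
  abs z = (re z * re z + im z * im z) ^ (ι 1 / ι 2)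

IsOddPrimePower : ℕ → Set
IsOddPrimePower q = ∃ λ p → ∃ λ n → Prime p × p ≢ 2 × 1 ℕ.≤ n × q ≡ p ℕ.^ n

-- Propositional equality on the carrier is no restriction, since a finite
-- field can be transported to Fin q.

record FiniteField : Set (lsuc 0ℓ) where
  infixl 6 _+_
  infixl 7 _*_
  infix  8 -_
  field
    Carrier           : Set
    _+_ _*_           : Carrier → Carrier → Carrier
    -_                : Carrier → Carrier
    0# 1#             : Carrier
    isCommutativeRing : IsCommutativeRing _≡_ _+_ _*_ -_ 0# 1#
    0≢1               : 0# ≢ 1#
    inverse           : ∀ x → x ≢ 0# → ∃ λ y → x * y ≡ 1#
    order             : ℕ
    enumeration       : Carrier ↔ Fin order
    isOddPrimePower   : IsOddPrimePower order

  commutativeRing : CommutativeRing 0ℓ 0ℓ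
  commutativeRing = record { isCommutativeRing = isCommutativeRing }

  open CommutativeRing commutativeRing public using (_-_; semiring)
  open RawSemiringDefinitions (Semiring.rawSemiring semiring) public using (_^_)

  infix 4 _≟_
  _≟_ : DecidableEquality Carrier
  _≟_ = Fin.inj⇒≟ (↔⇒↣ enumeration)

  elements : List Carrier
  elements = List.map (Inverse.from enumeration) (allFin order)

-- Natural exponents suffice because the multiplicative group is finite.

Primitive : (F : FiniteField) → FiniteField.Carrier F → Set
Primitive F g = g ≢ 0# × (∀ x → x ≢ 0# → ∃ λ n → x ≡ g ^ n)
  where open FiniteField F

module Geometry (F : FiniteField) where
  open FiniteField F

  Point : ℕ → Set
  Point d = Vec Carrier d

  infix  4 _≟ᵖ_ _∈_ _⊆_
  infixl 6 _+ᵖ_ _-ᵖ_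
  infixl 7 _·_

  _≟ᵖ_ : ∀ {d} → DecidableEquality (Point d)
  _≟ᵖ_ = Vec.≡-dec _≟_

  0ᵖ : ∀ {d} → Point d
  0ᵖ = replicate _ 0#

  _+ᵖ_ _-ᵖ_ : ∀ {d} → Point d → Point d → Point d
  _+ᵖ_ = zipWith _+_
  _-ᵖ_ = zipWith _-_

  _·_ : ∀ {d} → Point d → Point d → Carrier
  x · y = Vec.foldr _ _+_ 0# (zipWith _*_ x y)

  ∥_∥ : ∀ {d} → Point d → Carrier
  ∥ x ∥ = Vec.foldr _ _+_ 0# (Vec.map (_^ 2) x)

  points : ∀ d → List (Point d)
  points zero    = [ [] ]
  points (suc d) = cartesianProductWith _∷_ elements (points d)

  Subset : ℕ → Set
  Subset d = Point d → Bool

  _∈_ : ∀ {d} → Point d → Subset d → Set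
  x ∈ E = T (E x)

  members : ∀ {d} → Subset d → List (Point d)
  members E = filterᵇ E (points _)

  ∣_∣ : ∀ {d} → Subset d → ℕ
  ∣ E ∣ = length (members E)

  Sphere : ∀ {d} → Carrier → Pred (Point d) 0ℓ
  Sphere j x = ∥ x ∥ ≡ j

  _⊆_ : ∀ {d} → Subset d → Pred (Point d) 0ℓ → Set
  E ⊆ P = ∀ x → x ∈ E → P x

  Δ : ∀ {d} → Subset d → List Carrier
  Δ E = deduplicate _≟_
          (cartesianProductWith (λ x y → ∥ x -ᵖ y ∥) (members E) (members E))

  -- Δ E has no repeated entries, so its length is the number of distances.
  ∣Δ_∣ : ∀ {d} → Subset d → ℕ
  ∣Δ E ∣ = length (Δ E)

  Λ₄ : ∀ {d} → Subset d → ℕ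
  Λ₄ E = length (filter (λ ((x₁ , x₂) , (x₃ , x₄)) → x₁ +ᵖ x₂ ≟ᵖ x₃ +ᵖ x₄)
                        (cartesianProduct pairs pairs))
    where pairs = cartesianProduct (members E) (members E)

record NontrivialAdditiveCharacter (R : Reals) (F : FiniteField) : Set where
  open Reals R using (_≈_)
  open Complex R
  private module F = FiniteField F
  field
    χ          : F.Carrier → ℂ
    χ-unit     : ∀ x → abs (χ x) ≈ Reals.1# R
    χ-0        : χ F.0# ≈ᶜ 1ᶜ
    χ-+        : ∀ x y → χ (x F.+ y) ≈ᶜ χ x *ᶜ χ y
    nontrivial : ∃ λ x → ¬ (χ x ≈ᶜ 1ᶜ)

module Distance (R : Reals) (character : ∀ F → NontrivialAdditiveCharacter R F) where
  open Reals R
  open Complex R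

  module Fourier (F : FiniteField) {d : ℕ} (E : Geometry.Subset F d) where
    open FiniteField F using (order) renaming (-_ to -ᶠ_)
    open Geometry F
    open NontrivialAdditiveCharacter (character F) using (χ)

    q^-d : ℝ
    q^-d = ι order ^ (- ι d)

    Ê : Point d → ℂ
    Ê x = q^-d • foldr _+ᶜ_ 0ᶜ (List.map (λ y → χ (-ᶠ (x · y))) (members E))

    ∥Ê∥₄ : ℝ
    ∥Ê∥₄ = (q^-d * foldr _+_ 0# (List.map (λ x → abs (Ê x) ^ⁿ 4) nonzero)) ^ (ι 1 / ι 4)
      where nonzero = filter (λ x → ¬? (x ≟ᵖ 0ᵖ)) (points d)

    -- E satisfies the (4 , s)-Salem bound with implied constant C.
    Salem : ℝ → ℝ → Set
    Salem s C = ∥Ê∥₄ ≤ C * (q^-d * ι ∣ E ∣ ^ (ι 1 - s))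

  -- Every (4 , s)-Salem set E with |E| ≫ q^α satisfies |Δ(E)| ≫ q, where the
  -- implied constant c′ may depend on d, s, α and on the constants C and c.
  ForcesDistances : ℕ → ℝ → ℝ → Set₁
  ForcesDistances d s α =
    ∀ C c → 0# < C → 0# < c → ∃ λ c′ → 0# < c′ ×
      (∀ F → let open Geometry F; q = ι (FiniteField.order F) in
       (E : Subset d) → Fourier.Salem F E s C →
       c * q ^ α ≤ ι ∣ E ∣ →
       c′ * q ≤ ι ∣Δ E ∣)

  -- a is the smallest exponent with this property, that is, α(d,4,s) = a.
  α⟨_,4,_⟩≈_ : ℕ → ℝ → ℝ → Set₁
  α⟨ d ,4, s ⟩≈ a = ForcesDistances d s a × (∀ b → ForcesDistances d s b → a ≤ b)

  -- The conjectured values of α(d,4,s), in a given dimension d.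
  record Conjecture (d : ℕ) : Set₁ where
    field
      dim2 : d ≡ 2 →
        ∀ s → s ∈[ ι 1 / ι 4 , ι 1 / ι 2 ] → α⟨ d ,4, s ⟩≈ ι 1
      even-small : 4 ℕ.≤ d → 2 ∣ d →
        ∀ s → s ∈[ ι 1 / ι 4 , (ι d + ι 2) / (ι 4 * ι d) ] → α⟨ d ,4, s ⟩≈ (ι d / ι 2)
      even-large : 4 ℕ.≤ d → 2 ∣ d →
        ∀ s → s ∈[ (ι d + ι 2) / (ι 4 * ι d) , ι 1 / ι 2 ] →
        α⟨ d ,4, s ⟩≈ ((ι d + ι 2) / (ι 8 * s))
      odd : 3 ℕ.≤ d → ¬ (2 ∣ d) →
        ∀ s → s ∈[ ι 1 / ι 4 , ι 1 / ι 2 ] → α⟨ d ,4, s ⟩≈ ((ι d + ι 1) / (ι 8 * s))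

AdmissibleDimension : ℕ → ℕ → Set
AdmissibleDimension d q =
  (∃ λ k → 1 ℕ.≤ k × d ≡ 4 ℕ.* k ℕ.∸ 1 × q % 4 ≡ 1) ⊎
  (∃ λ k → 1 ℕ.≤ k × d ≡ 4 ℕ.* k ℕ.+ 1)

{-# OPTIONS --safe #-}

-- Write d = 2m + 1, n = ∣ E ∣ and Z for the number of pairs in E at distance 0.
--
-- A parallelogram inscribed in a sphere is a rectangle, so Λ₄ E is at most the
-- number of (x , y , z) ∈ E³ with (y - x) · (z - x) = 0.  For fixed x these are
-- counted by a second moment (Plancherel for the points t (y - x) with t ≠ 0).  As
-- a line through x meets the sphere in at most one further point unless it is a null
-- line, one obtains
--   q Λ₄ ≤ n³ + q^(d/2) (n² + q Z).
-- The radius g being primitive, ∥ w ∥ - g w₀² is an elliptic form in 2m + 2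
-- variables: its Gauss sums are -q^(m+1).  Hence the expansion of
--   0 ≤ ∑ |∑ χ (s (w · x - g w₀))|²,  summed over ∥ w ∥ = g w₀² and s ≠ 0, x ∈ E,
-- bounds Z from above, by q Z ≤ n² + 2 q^m n.
--
-- The conjecture is applied to a subset E′ of E of size about q^(b/4), where
-- b = 4m + 1 in (i) and b = 4m in (ii), and with s = (m + 1) / b: E′ is (4,s)-Salem
-- by the bound on its energy.  In (ii), where the energy of E is only assumed to be
-- small, E′ is found by deleting points one at a time such that the number of
-- solutions of x + y = z + w decreases at the rate expected for a random subset.

module Submission where

open import Defs
open import Algebra.Bundles using (CommutativeRing)
open import Data.Empty using (⊥-elim)
open import Data.List.Base as List using (List; []; _∷_; _++_; foldr; filter; length; allFin; downFrom; cartesianProduct; cartesianProductWith)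
import Data.List.Membership.Propositional.Properties as ∈
open import Data.List.Relation.Unary.All as All using (All; []; _∷_)
open import Data.List.Relation.Unary.AllPairs using ([]; _∷_)
open import Data.List.Relation.Unary.Any using (here; there)
open import Data.List.Relation.Unary.Unique.Propositional using (Unique)
import Data.List.Relation.Unary.Unique.Propositional.Properties as Unique
open import Data.Nat.Base as ℕ using (ℕ; zero; suc)
open import Data.Nat.DivMod as ℕ using (_%_)
import Data.Nat.Properties as ℕ
open import Data.Product.Base using (_×_; _,_; proj₁; proj₂; ∃)
open import Data.Sum.Base using (_⊎_; inj₁; inj₂)
open import Data.Vec.Base as Vec using (Vec; []; _∷_)
import Data.Vec.Properties as Vec
open import Function.Base using (_∘_; const; id)
open import Level using (Level; 0ℓ)
open import Relation.Binary.Definitions using (DecidableEquality)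
open import Relation.Binary.PropositionalEquality as ≡ using (_≡_; _≢_)
open import Relation.Nullary using (Dec; yes; no; does; ¬_; contradiction)
open import Relation.Nullary.Decidable using (_×-dec_; ¬?)

-- The size of E is only bounded below, whereas the Salem bound follows from Λ₄ ≪ ∣E∣^(4 - 4s), and
-- for s > 1/4 the term ∣E∣³/q outgrows this: hence the passage to a subset of threshold size.
-- Solving (d + 1)/(8s) = b/4 with d + 1 = 2(m + 1) gives s = (m + 1)/b, and at size q^(b/4) the
-- admissible energy is of order q^(b - m - 1). In (i) the energy bound applies to every subset of
-- the sphere, hence to E′ itself; in (ii) it has to be carried from E to E′.
--
-- Null lines are the reason for the conditions on d, q and g. If ∥ w ∥ - g w₀² were hyperbolic, the
-- sphere would contain affine subspaces of dimension m, all of whose differences are null; for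
-- these n = q^m and q Z = q^(2m+1), beyond any bound of order n² + q^m n.

-- Ring normalisation with integer coefficients over any commutative ring.

module IntegerSolver {c ℓ} (R : CommutativeRing c ℓ) where

  open CommutativeRing R
  open import Algebra.Properties.Ring ring
  open import Algebra.Properties.AbelianGroup +-abelianGroup using (⁻¹-∙-comm)
  open import Algebra.Properties.Semiring.Mult semiring renaming (_×_ to infixr 8 _×#_)
  open import Algebra.Solver.Ring.AlmostCommutativeRing using (fromCommutativeRing; _-Raw-AlmostCommutative⟶_)
  open import Data.Integer.Base as ℤ using (ℤ; +_; -[1+_]; _⊖_)
  import Data.Integer.Properties as ℤ
  open import Data.Maybe.Base as Maybe using (Maybe)
  open import Relation.Binary.Definitions using (WeaklyDecidable)
  open import Relation.Binary.Reasoning.Setoid setoid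
  open import Relation.Nullary.Decidable.Core using (dec⇒maybe)

  -- The value at 1 is 1# on the nose, so that the constants 0#, 1# and n ×# 1# of
  -- a goal are all coefficients.
  ⟦_⟧ℤ : ℤ → Carrier
  ⟦ + 1 ⟧ℤ      = 1#
  ⟦ + n ⟧ℤ      = n ×# 1#
  ⟦ -[1+ n ] ⟧ℤ = - (suc n ×# 1#)

  +⟦_⟧ : ∀ n → ⟦ + n ⟧ℤ ≈ n ×# 1#
  +⟦ 0 ⟧           = refl
  +⟦ 1 ⟧           = sym (+-identityʳ 1#)
  +⟦ suc (suc n) ⟧ = refl

  ⊖-homo : ∀ m n → ⟦ m ⊖ n ⟧ℤ ≈ m ×# 1# - n ×# 1#
  ⊖-homo m       zero    = trans +⟦ m ⟧ (sym (trans (+-congˡ -0#≈0#) (+-identityʳ _)))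
  ⊖-homo zero    (suc n) = sym (+-identityˡ _)
  ⊖-homo (suc m) (suc n) = begin
    ⟦ suc m ⊖ suc n ⟧ℤ              ≡⟨ ≡.cong ⟦_⟧ℤ (ℤ.[1+m]⊖[1+n]≡m⊖n m n) ⟩
    ⟦ m ⊖ n ⟧ℤ                      ≈⟨ ⊖-homo m n ⟩
    m ×# 1# - n ×# 1#                 ≈⟨ +-identityˡ _ ⟨
    0# + (m ×# 1# - n ×# 1#)          ≈⟨ +-congʳ (-‿inverseʳ 1#) ⟨
    1# - 1# + (m ×# 1# - n ×# 1#)     ≈⟨ +-assoc _ _ _ ⟩
    1# + (- 1# + (m ×# 1# - n ×# 1#)) ≈⟨ +-congˡ (+-assoc _ _ _) ⟨
    1# + (- 1# + m ×# 1# - n ×# 1#)   ≈⟨ +-congˡ (+-congʳ (+-comm _ _)) ⟩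
    1# + (m ×# 1# - 1# - n ×# 1#)     ≈⟨ +-congˡ (+-assoc _ _ _) ⟩
    1# + (m ×# 1# + (- 1# - n ×# 1#)) ≈⟨ +-assoc _ _ _ ⟨
    suc m ×# 1# + (- 1# - n ×# 1#)    ≈⟨ +-congˡ (⁻¹-∙-comm _ _) ⟩
    suc m ×# 1# - suc n ×# 1#         ∎

  -‿homo : ∀ i → ⟦ ℤ.- i ⟧ℤ ≈ - ⟦ i ⟧ℤ
  -‿homo (+ zero)  = sym -0#≈0#
  -‿homo (+ suc n) = sym (-‿cong +⟦ suc n ⟧)
  -‿homo -[1+ n ]  = trans +⟦ suc n ⟧ (sym (-‿involutive _))

  +-homo : ∀ i j → ⟦ i ℤ.+ j ⟧ℤ ≈ ⟦ i ⟧ℤ + ⟦ j ⟧ℤ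
  +-homo (+ m) (+ n) = begin
    ⟦ + (m ℕ.+ n) ⟧ℤ      ≈⟨ +⟦ m ℕ.+ n ⟧ ⟩
    (m ℕ.+ n) ×# 1#        ≈⟨ ×-homo-+ 1# m n ⟩
    m ×# 1# + n ×# 1#       ≈⟨ +-cong +⟦ m ⟧ +⟦ n ⟧ ⟨
    ⟦ + m ⟧ℤ + ⟦ + n ⟧ℤ   ∎
  +-homo (+ m) -[1+ n ] = trans (⊖-homo m (suc n)) (+-congʳ (sym +⟦ m ⟧))
  +-homo -[1+ m ] (+ n) = trans (⊖-homo n (suc m)) (trans (+-comm _ _) (+-congˡ (sym +⟦ n ⟧)))
  +-homo -[1+ m ] -[1+ n ] = begin
    - (suc (suc (m ℕ.+ n)) ×# 1#)      ≡⟨ ≡.cong (λ k → - (k ×# 1#)) (ℕ.+-suc (suc m) n) ⟨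
    - ((suc m ℕ.+ suc n) ×# 1#)        ≈⟨ -‿cong (×-homo-+ 1# (suc m) (suc n)) ⟩
    - (suc m ×# 1# + suc n ×# 1#)       ≈⟨ ⁻¹-∙-comm _ _ ⟨
    - (suc m ×# 1#) - (suc n ×# 1#)     ∎

  *-homo⁺ : ∀ m n → ⟦ + m ℤ.* + n ⟧ℤ ≈ ⟦ + m ⟧ℤ * ⟦ + n ⟧ℤ
  *-homo⁺ m n = begin
    ⟦ + m ℤ.* + n ⟧ℤ     ≡⟨ ≡.cong ⟦_⟧ℤ (ℤ.pos-* m n) ⟨
    ⟦ + (m ℕ.* n) ⟧ℤ     ≈⟨ +⟦ m ℕ.* n ⟧ ⟩
    (m ℕ.* n) ×# 1#       ≈⟨ ×1-homo-* m n ⟩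
    (m ×# 1#) * (n ×# 1#)  ≈⟨ *-cong +⟦ m ⟧ +⟦ n ⟧ ⟨
    ⟦ + m ⟧ℤ * ⟦ + n ⟧ℤ  ∎

  *-homo : ∀ i j → ⟦ i ℤ.* j ⟧ℤ ≈ ⟦ i ⟧ℤ * ⟦ j ⟧ℤ
  *-homo (+ m) (+ n) = *-homo⁺ m n
  *-homo (+ m) -[1+ n ] = begin
    ⟦ + m ℤ.* -[1+ n ] ⟧ℤ          ≡⟨ ≡.cong ⟦_⟧ℤ (ℤ.neg-distribʳ-* (+ m) (+ suc n)) ⟨
    ⟦ ℤ.- (+ m ℤ.* + suc n) ⟧ℤ     ≈⟨ -‿homo (+ m ℤ.* + suc n) ⟩
    - ⟦ + m ℤ.* + suc n ⟧ℤ         ≈⟨ -‿cong (*-homo⁺ m (suc n)) ⟩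
    - (⟦ + m ⟧ℤ * ⟦ + suc n ⟧ℤ)    ≈⟨ -‿distribʳ-* _ _ ⟩
    ⟦ + m ⟧ℤ * - ⟦ + suc n ⟧ℤ      ≈⟨ *-congˡ (-‿homo (+ suc n)) ⟨
    ⟦ + m ⟧ℤ * ⟦ -[1+ n ] ⟧ℤ       ∎
  *-homo -[1+ m ] (+ n) = begin
    ⟦ -[1+ m ] ℤ.* + n ⟧ℤ          ≡⟨ ≡.cong ⟦_⟧ℤ (ℤ.neg-distribˡ-* (+ suc m) (+ n)) ⟨
    ⟦ ℤ.- (+ suc m ℤ.* + n) ⟧ℤ     ≈⟨ -‿homo (+ suc m ℤ.* + n) ⟩
    - ⟦ + suc m ℤ.* + n ⟧ℤ         ≈⟨ -‿cong (*-homo⁺ (suc m) n) ⟩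
    - (⟦ + suc m ⟧ℤ * ⟦ + n ⟧ℤ)    ≈⟨ -‿distribˡ-* _ _ ⟩
    - ⟦ + suc m ⟧ℤ * ⟦ + n ⟧ℤ      ≈⟨ *-congʳ (-‿homo (+ suc m)) ⟨
    ⟦ -[1+ m ] ⟧ℤ * ⟦ + n ⟧ℤ       ∎
  *-homo -[1+ m ] -[1+ n ] = begin
    ⟦ + suc m ℤ.* + suc n ⟧ℤ       ≈⟨ *-homo⁺ (suc m) (suc n) ⟩
    ⟦ + suc m ⟧ℤ * ⟦ + suc n ⟧ℤ    ≈⟨ [-x][-y]≈xy _ _ ⟨
    - ⟦ + suc m ⟧ℤ * - ⟦ + suc n ⟧ℤ ≈⟨ *-cong (-‿homo (+ suc m)) (-‿homo (+ suc n)) ⟨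
    ⟦ -[1+ m ] ⟧ℤ * ⟦ -[1+ n ] ⟧ℤ  ∎
    where
    [-x][-y]≈xy : ∀ x y → - x * - y ≈ x * y
    [-x][-y]≈xy x y = trans (sym (-‿distribˡ-* x (- y)))
      (trans (-‿cong (sym (-‿distribʳ-* x y))) (-‿involutive _))

  morphism : ℤ.+-*-rawRing -Raw-AlmostCommutative⟶ fromCommutativeRing R
  morphism = record
    { ⟦_⟧    = ⟦_⟧ℤ
    ; +-homo = +-homo
    ; *-homo = *-homo
    ; -‿homo = -‿homo
    ; 0-homo = refl
    ; 1-homo = refl
    }

  -- Compares the integers and not their images. In positive characteristic distinct integers may
  -- have equal images, so the test is sound but incomplete, which is all that a weak decision has
  -- to be.
  coeff≟ : WeaklyDecidable (λ i j → ⟦ i ⟧ℤ ≈ ⟦ j ⟧ℤ)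
  coeff≟ i j = Maybe.map (λ { ≡.refl → refl }) (dec⇒maybe (i ℤ.≟ j))

  open import Algebra.Solver.Ring ℤ.+-*-rawRing (fromCommutativeRing R) morphism coeff≟ public
    using (solve; _:=_; _:+_; _:*_; _:-_; :-_; con; Polynomial)

  :0 :1 :2 :3 :4 :6 :8 : ∀ {n} → Polynomial n
  :0 = con (+ 0)
  :1 = con (+ 1)
  :2 = con (+ 2)
  :3 = con (+ 3)
  :4 = con (+ 4)
  :6 = con (+ 6)
  :8 = con (+ 8)

-- Finite sums over lists and Iverson brackets.

module Sums {c ℓ} (R : CommutativeRing c ℓ) where

  open CommutativeRing R
  open import Algebra.Properties.Semiring.Mult semiring using () renaming (_×_ to infixr 8 _×#_)
  open import Algebra.Properties.CommutativeSemigroup +-commutativeSemigroup using (interchange)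
  open import Data.Bool.Base using (if_then_else_; true; false)
  open import Data.List.Membership.Propositional using (_∈_; _∉_)
  open import Data.List.Relation.Unary.All.Properties using (All¬⇒¬Any)
  open import Relation.Binary.Reasoning.Setoid setoid
  open import Relation.Nullary.Decidable using (dec-true; dec-false)
  open import Relation.Unary using (Pred; Decidable)

  private variable
    a p q : Level
    A B C : Set a
    P : Set p
    Q : Set q

  ∑ : List A → (A → Carrier) → Carrier
  ∑ xs f = foldr _+_ 0# (List.map f xs)

  ∑-cong∈ : ∀ (xs : List A) {f g} → (∀ {x} → x ∈ xs → f x ≈ g x) → ∑ xs f ≈ ∑ xs g
  ∑-cong∈ []       f≈g = refl
  ∑-cong∈ (x ∷ xs) f≈g = +-cong (f≈g (here ≡.refl)) (∑-cong∈ xs (f≈g ∘ there))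

  ∑-cong : ∀ (xs : List A) {f g} → (∀ x → f x ≈ g x) → ∑ xs f ≈ ∑ xs g
  ∑-cong xs f≈g = ∑-cong∈ xs (λ {x} _ → f≈g x)

  ∑-0 : ∀ (xs : List A) → ∑ xs (const 0#) ≈ 0#
  ∑-0 []       = refl
  ∑-0 (x ∷ xs) = trans (+-identityˡ _) (∑-0 xs)

  ∑-+ : ∀ (xs : List A) f g → ∑ xs (λ x → f x + g x) ≈ ∑ xs f + ∑ xs g
  ∑-+ []       f g = sym (+-identityˡ 0#)
  ∑-+ (x ∷ xs) f g = trans (+-congˡ (∑-+ xs f g)) (interchange _ _ _ _)

  *-∑ : ∀ (xs : List A) k f → k * ∑ xs f ≈ ∑ xs (λ x → k * f x)
  *-∑ []       k f = zeroʳ k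
  *-∑ (x ∷ xs) k f = trans (distribˡ _ _ _) (+-congˡ (*-∑ xs k f))

  ∑-* : ∀ (xs : List A) f k → ∑ xs f * k ≈ ∑ xs (λ x → f x * k)
  ∑-* xs f k = begin
    ∑ xs f * k            ≈⟨ *-comm _ _ ⟩
    k * ∑ xs f            ≈⟨ *-∑ xs k f ⟩
    ∑ xs (λ x → k * f x)  ≈⟨ ∑-cong xs (λ x → *-comm _ _) ⟩
    ∑ xs (λ x → f x * k)  ∎

  ∑-neg : ∀ (xs : List A) f → ∑ xs (λ x → - f x) ≈ - ∑ xs f
  ∑-neg xs f = begin
    ∑ xs (λ x → - f x)       ≈⟨ ∑-cong xs (λ x → sym (-1*x≈-x _)) ⟩
    ∑ xs (λ x → - 1# * f x)  ≈⟨ *-∑ xs (- 1#) f ⟨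
    - 1# * ∑ xs f            ≈⟨ -1*x≈-x _ ⟩
    - ∑ xs f                 ∎
    where open import Algebra.Properties.Ring ring using (-1*x≈-x)

  ∑-- : ∀ (xs : List A) f g → ∑ xs (λ x → f x - g x) ≈ ∑ xs f - ∑ xs g
  ∑-- xs f g = trans (∑-+ xs f (-_ ∘ g)) (+-congˡ (∑-neg xs g))

  ∑-const : ∀ (xs : List A) k → ∑ xs (const k) ≈ (length xs ×# 1#) * k
  ∑-const []       k = sym (zeroˡ k)
  ∑-const (x ∷ xs) k = begin
    k + ∑ xs (const k)                ≈⟨ +-cong (sym (*-identityˡ k)) (∑-const xs k) ⟩
    1# * k + (length xs ×# 1#) * k     ≈⟨ distribʳ k _ _ ⟨
    (1# + length xs ×# 1#) * k         ∎

  ∑-length : ∀ (xs : List A) → ∑ xs (const 1#) ≈ length xs ×# 1#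
  ∑-length xs = trans (∑-const xs 1#) (*-identityʳ _)

  ∑-swap : ∀ (xs : List A) (ys : List B) (f : A → B → Carrier) →
           ∑ xs (λ x → ∑ ys (f x)) ≈ ∑ ys (λ y → ∑ xs (λ x → f x y))
  ∑-swap []       ys f = sym (∑-0 ys)
  ∑-swap (x ∷ xs) ys f = trans (+-congˡ (∑-swap xs ys f)) (sym (∑-+ ys (f x) _))

  ∑-*-∑ : ∀ (xs : List A) (ys : List B) f g →
          ∑ xs f * ∑ ys g ≈ ∑ xs (λ x → ∑ ys (λ y → f x * g y))
  ∑-*-∑ xs ys f g = trans (∑-* xs f _) (∑-cong xs (λ x → *-∑ ys (f x) g))

  ∑-map : ∀ (xs : List A) (g : A → B) f → ∑ (List.map g xs) f ≈ ∑ xs (f ∘ g)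
  ∑-map []       g f = refl
  ∑-map (x ∷ xs) g f = +-congˡ (∑-map xs g f)

  ∑-++ : ∀ (xs ys : List A) f → ∑ (xs ++ ys) f ≈ ∑ xs f + ∑ ys f
  ∑-++ []       ys f = sym (+-identityˡ _)
  ∑-++ (x ∷ xs) ys f = trans (+-congˡ (∑-++ xs ys f)) (sym (+-assoc _ _ _))

  ∑-cartesianProductWith : ∀ (_∙_ : A → B → C) xs ys f →
    ∑ (cartesianProductWith _∙_ xs ys) f ≈ ∑ xs (λ x → ∑ ys (λ y → f (x ∙ y)))
  ∑-cartesianProductWith _∙_ []       ys f = refl
  ∑-cartesianProductWith _∙_ (x ∷ xs) ys f = begin
    ∑ (List.map (x ∙_) ys ++ cartesianProductWith _∙_ xs ys) f
      ≈⟨ ∑-++ (List.map (x ∙_) ys) _ f ⟩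
    ∑ (List.map (x ∙_) ys) f + ∑ (cartesianProductWith _∙_ xs ys) f
      ≈⟨ +-cong (∑-map ys (x ∙_) f) (∑-cartesianProductWith _∙_ xs ys f) ⟩
    ∑ ys (λ y → f (x ∙ y)) + ∑ xs (λ x → ∑ ys (λ y → f (x ∙ y))) ∎

  ∑-cartesianProduct : ∀ (xs : List A) (ys : List B) f →
    ∑ (cartesianProduct xs ys) f ≈ ∑ xs (λ x → ∑ ys (λ y → f (x , y)))
  ∑-cartesianProduct = ∑-cartesianProductWith _,_

  ⟦_⟧ : Dec P → Carrier
  ⟦ P? ⟧ = if does P? then 1# else 0#

  ⟦⟧-yes : (P? : Dec P) → P → ⟦ P? ⟧ ≈ 1#
  ⟦⟧-yes P? p rewrite dec-true P? p = refl

  ⟦⟧-no : (P? : Dec P) → ¬ P → ⟦ P? ⟧ ≈ 0#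
  ⟦⟧-no P? ¬p rewrite dec-false P? ¬p = refl

  ⟦⟧-cong : (P? : Dec P) (Q? : Dec Q) → (P → Q) → (Q → P) → ⟦ P? ⟧ ≈ ⟦ Q? ⟧
  ⟦⟧-cong P? (yes q) P→Q Q→P = ⟦⟧-yes P? (Q→P q)
  ⟦⟧-cong P? (no ¬q) P→Q Q→P = ⟦⟧-no P? (¬q ∘ P→Q)

  ⟦⟧-× : (P? : Dec P) (Q? : Dec Q) → ⟦ P? ×-dec Q? ⟧ ≈ ⟦ P? ⟧ * ⟦ Q? ⟧
  ⟦⟧-× (yes _) Q? = sym (*-identityˡ _)
  ⟦⟧-× (no _)  Q? = sym (zeroˡ _)

  ⟦⟧-split : (P? : Dec P) → ∀ x → x ≈ ⟦ P? ⟧ * x + ⟦ ¬? P? ⟧ * x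
  ⟦⟧-split (yes _) x = sym (trans (+-cong (*-identityˡ x) (zeroˡ x)) (+-identityʳ x))
  ⟦⟧-split (no _)  x = sym (trans (+-cong (zeroˡ x) (*-identityˡ x)) (+-identityˡ x))

  ∑-filter : ∀ {P : Pred A p} (P? : Decidable P) xs f →
             ∑ (filter P? xs) f ≈ ∑ xs (λ x → ⟦ P? x ⟧ * f x)
  ∑-filter P? []       f = refl
  ∑-filter P? (x ∷ xs) f with does (P? x)
  ... | true  = +-cong (sym (*-identityˡ _)) (∑-filter P? xs f)
  ... | false = trans (∑-filter P? xs f) (sym (trans (+-congʳ (zeroˡ _)) (+-identityˡ _)))

  module Kronecker (_≟_ : DecidableEquality A) where

    ∑-δ∉ : ∀ {xs : List A} {a} → a ∉ xs → (f : A → Carrier) → ∑ xs (λ x → ⟦ x ≟ a ⟧ * f x) ≈ 0#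
    ∑-δ∉ {xs} a∉ f = trans
      (∑-cong∈ xs λ {x} x∈ → trans (*-congʳ (⟦⟧-no (x ≟ _) λ { ≡.refl → a∉ x∈ })) (zeroˡ _))
      (∑-0 xs)

    ∑-δ : ∀ {xs : List A} {a} → Unique xs → a ∈ xs → (f : A → Carrier) → ∑ xs (λ x → ⟦ x ≟ a ⟧ * f x) ≈ f a
    ∑-δ {x ∷ xs} (x∉xs ∷ _) (here ≡.refl) f = begin
      ⟦ x ≟ x ⟧ * f x + ∑ xs (λ y → ⟦ y ≟ x ⟧ * f y)
        ≈⟨ +-cong (*-congʳ (⟦⟧-yes (x ≟ x) ≡.refl)) (∑-δ∉ (All¬⇒¬Any x∉xs) f) ⟩
      1# * f x + 0#  ≈⟨ +-identityʳ _ ⟩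
      1# * f x       ≈⟨ *-identityˡ _ ⟩
      f x            ∎
    ∑-δ {x ∷ xs} {a} (x∉xs ∷ xs!) (there a∈) f = begin
      ⟦ x ≟ a ⟧ * f x + ∑ xs (λ y → ⟦ y ≟ a ⟧ * f y)
        ≈⟨ +-cong (*-congʳ (⟦⟧-no (x ≟ a) (All.lookup x∉xs a∈))) (∑-δ xs! a∈ f) ⟩
      0# * f x + f a  ≈⟨ +-congʳ (zeroˡ _) ⟩
      0# + f a        ≈⟨ +-identityˡ _ ⟩
      f a             ∎

  module Reindexing (_≟ᴬ_ : DecidableEquality A) (_≟ᴮ_ : DecidableEquality B) where

    open Kronecker

    -- Both sides evaluate the double sum of `⟦ y ≟ᴮ φ x ⟧ * f y`, once along `ys` and once along
    -- `xs`. The maps have to be mutually inverse on the listed elements only, so that inversion on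
    -- `units` and exponentiation on an initial segment are covered.
    ∑-reindex : ∀ {xs : List A} {ys : List B} → Unique xs → Unique ys →
      (φ : A → B) (ψ : B → A) →
      (∀ {x} → x ∈ xs → φ x ∈ ys) → (∀ {y} → y ∈ ys → ψ y ∈ xs) →
      (∀ {x} → x ∈ xs → ψ (φ x) ≡ x) → (∀ {y} → y ∈ ys → φ (ψ y) ≡ y) →
      (f : B → Carrier) → ∑ xs (f ∘ φ) ≈ ∑ ys f
    ∑-reindex {xs} {ys} xs! ys! φ ψ φ∈ ψ∈ ψφ φψ f = begin
      ∑ xs (f ∘ φ)
        ≈⟨ ∑-cong∈ xs (λ x∈ → sym (∑-δ _≟ᴮ_ ys! (φ∈ x∈) f)) ⟩
      ∑ xs (λ x → ∑ ys (λ y → ⟦ y ≟ᴮ φ x ⟧ * f y))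
        ≈⟨ ∑-swap xs ys _ ⟩
      ∑ ys (λ y → ∑ xs (λ x → ⟦ y ≟ᴮ φ x ⟧ * f y))
        ≈⟨ ∑-cong∈ ys (λ {y} y∈ → ∑-cong∈ xs (λ {x} x∈ → *-congʳ
             (⟦⟧-cong (y ≟ᴮ φ x) (x ≟ᴬ ψ y)
               (λ { ≡.refl → ≡.sym (ψφ x∈) }) (λ { ≡.refl → ≡.sym (φψ y∈) })))) ⟩
      ∑ ys (λ y → ∑ xs (λ x → ⟦ x ≟ᴬ ψ y ⟧ * f y))
        ≈⟨ ∑-cong∈ ys (λ {y} y∈ → ∑-δ _≟ᴬ_ xs! (ψ∈ y∈) (const (f y))) ⟩
      ∑ ys f ∎

-- Arithmetic of the finite field.

module FieldProperties (F : FiniteField) where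

  open FiniteField F hiding (_-_)
  open CommutativeRing commutativeRing public
    using (_-_; +-assoc; +-comm; +-identityˡ; +-identityʳ; *-assoc; *-comm; *-identityˡ; *-identityʳ;
           zeroˡ; zeroʳ; distribˡ; -‿inverseʳ; -‿inverseˡ; ring; +-group)
  open import Algebra.Properties.Group +-group public using (x∙y⁻¹≈ε⇒x≈y)
  open import Algebra.Properties.Semiring.Exp semiring using (^-homo-*; ^-assocʳ)
  open import Algebra.Properties.Semiring.Mult semiring using (×-homo-+) renaming (_×_ to infixr 8 _×#_)
  open module F-Sums = Sums commutativeRing using (∑; ∑-+; ∑-length)
  open IntegerSolver commutativeRing
  open import Data.Fin.Base as Fin using (Fin; zero; suc; toℕ; fromℕ<; punchOut)
  import Data.Fin.Properties as Fin
  import Data.List.Properties as List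
  open import Data.List.Membership.Propositional using (_∈_)
  open import Data.Nat.Divisibility as ℕ using (_∣_)
  open import Data.Nat.Primality using (euclidsLemma; prime[2]; prime⇒irreducible)
  open import Function.Bundles using (Inverse)
  open import Relation.Binary.Definitions using (tri<; tri≈; tri>)
  open ≡ using (refl; sym; trans; cong; cong₂; subst)
  open ≡.≡-Reasoning

  open Inverse enumeration using (to; from; strictlyInverseˡ; strictlyInverseʳ)

  private variable
    x y z t : Carrier

  2# : Carrier
  2# = 1# + 1#

  from-injective : ∀ {i j} → from i ≡ from j → i ≡ j
  from-injective {i} {j} eq = trans (sym (strictlyInverseˡ i)) (trans (cong to eq) (strictlyInverseˡ j))

  elements-unique : Unique elements
  elements-unique = Unique.map⁺ from-injective (Unique.allFin⁺ order)

  ∈-elements : ∀ x → x ∈ elements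
  ∈-elements x = subst (_∈ elements) (strictlyInverseʳ x) (∈.∈-map⁺ from (∈.∈-allFin (to x)))

  length-elements : length elements ≡ order
  length-elements = trans (List.length-map from (allFin order)) (List.length-tabulate id)

  units : List Carrier
  units = filter (λ x → ¬? (x ≟ 0#)) elements

  units-unique : Unique units
  units-unique = Unique.filter⁺ (λ x → ¬? (x ≟ 0#)) elements-unique

  ∈-units : x ≢ 0# → x ∈ units
  ∈-units x≢0 = ∈.∈-filter⁺ (λ x → ¬? (x ≟ 0#)) (∈-elements _) x≢0

  units-≢0 : x ∈ units → x ≢ 0#
  units-≢0 x∈ = proj₂ (∈.∈-filter⁻ (λ x → ¬? (x ≟ 0#)) {xs = elements} x∈)

  infix 9 _⁻¹
  -- Total, so that it can be used as a substitution in sums over `units` without carrying proofs of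
  -- nonvanishing.
  _⁻¹ : Carrier → Carrier
  x ⁻¹ with x ≟ 0#
  ... | yes _  = 0#
  ... | no x≢0 = proj₁ (inverse x x≢0)

  ⁻¹-inverseʳ : x ≢ 0# → x * x ⁻¹ ≡ 1#
  ⁻¹-inverseʳ {x} x≢0 with x ≟ 0#
  ... | yes x≡0 = contradiction x≡0 x≢0
  ... | no x≢0′ = proj₂ (inverse x x≢0′)

  ⁻¹-inverseˡ : x ≢ 0# → x ⁻¹ * x ≡ 1#
  ⁻¹-inverseˡ {x} x≢0 = trans (*-comm (x ⁻¹) x) (⁻¹-inverseʳ x≢0)

  x⁻¹[xy]≡y : x ≢ 0# → ∀ y → x ⁻¹ * (x * y) ≡ y
  x⁻¹[xy]≡y {x} x≢0 y = begin
    x ⁻¹ * (x * y)  ≡⟨ *-assoc _ _ _ ⟨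
    x ⁻¹ * x * y    ≡⟨ cong (_* y) (⁻¹-inverseˡ x≢0) ⟩
    1# * y          ≡⟨ *-identityˡ y ⟩
    y               ∎

  x[x⁻¹y]≡y : x ≢ 0# → ∀ y → x * (x ⁻¹ * y) ≡ y
  x[x⁻¹y]≡y {x} x≢0 y = begin
    x * (x ⁻¹ * y)  ≡⟨ *-assoc _ _ _ ⟨
    x * x ⁻¹ * y    ≡⟨ cong (_* y) (⁻¹-inverseʳ x≢0) ⟩
    1# * y          ≡⟨ *-identityˡ y ⟩
    y               ∎

  *-cancelˡ : x ≢ 0# → x * y ≡ x * z → y ≡ z
  *-cancelˡ {x} {y} {z} x≢0 eq = begin
    y               ≡⟨ x⁻¹[xy]≡y x≢0 y ⟨
    x ⁻¹ * (x * y)  ≡⟨ cong (x ⁻¹ *_) eq ⟩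
    x ⁻¹ * (x * z)  ≡⟨ x⁻¹[xy]≡y x≢0 z ⟩
    z               ∎

  *-≢0 : x ≢ 0# → y ≢ 0# → x * y ≢ 0#
  *-≢0 x≢0 y≢0 xy≡0 = y≢0 (*-cancelˡ x≢0 (trans xy≡0 (sym (zeroʳ _))))

  xy≡0⇒y≡0 : x ≢ 0# → x * y ≡ 0# → y ≡ 0#
  xy≡0⇒y≡0 x≢0 xy≡0 = *-cancelˡ x≢0 (trans xy≡0 (sym (zeroʳ _)))

  ⁻¹-≢0 : x ≢ 0# → x ⁻¹ ≢ 0#
  ⁻¹-≢0 {x} x≢0 eq = 0≢1 (trans (sym (trans (cong (x *_) eq) (zeroʳ x))) (⁻¹-inverseʳ x≢0))

  -‿≢0 : x ≢ 0# → - x ≢ 0#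
  -‿≢0 {x} x≢0 -x≡0 = x≢0 (begin
    x          ≡⟨ +-identityʳ x ⟨
    x + 0#     ≡⟨ cong (x +_) -x≡0 ⟨
    x - x      ≡⟨ -‿inverseʳ x ⟩
    0#         ∎)

  ^-≢0 : ∀ n → x ≢ 0# → x ^ n ≢ 0#
  ^-≢0 zero    x≢0 = 0≢1 ∘ sym
  ^-≢0 (suc n) x≢0 = *-≢0 x≢0 (^-≢0 n x≢0)

  1^n≡1 : ∀ n → 1# ^ n ≡ 1#
  1^n≡1 zero    = refl
  1^n≡1 (suc n) = trans (*-identityˡ _) (1^n≡1 n)

  halve : ∀ n → ∃ λ k → n ≡ k ℕ.+ k ⊎ n ≡ suc (k ℕ.+ k)
  halve zero = 0 , inj₁ refl
  halve (suc n) with halve n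
  ... | k , inj₁ n≡ = k , inj₂ (cong suc n≡)
  ... | k , inj₂ n≡ = suc k , inj₁ (trans (cong suc n≡) (cong suc (sym (ℕ.+-suc k k))))

  2∤order : ¬ 2 ∣ order
  2∤order with isOddPrimePower
  ... | p , n , p-prime , p≢2 , _ , order≡pⁿ = λ 2∣order → 2∤pⁿ n (subst (2 ∣_) order≡pⁿ 2∣order)
    where
    2∤pⁿ : ∀ n → ¬ 2 ∣ p ℕ.^ n
    2∤pⁿ zero    2∣1 with () ← ℕ.∣1⇒≡1 2∣1
    2∤pⁿ (suc n) 2∣  with euclidsLemma p (p ℕ.^ n) prime[2] 2∣
    ... | inj₂ 2∣pⁿ = 2∤pⁿ n 2∣pⁿ
    ... | inj₁ 2∣p with prime⇒irreducible p-prime 2∣p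
    ...   | inj₂ 2≡p = p≢2 (sym 2≡p)

  order-odd : ∃ λ k → order ≡ suc (k ℕ.+ k)
  order-odd with halve order
  ... | k , inj₂ eq = k , eq
  ... | k , inj₁ eq = contradiction (ℕ.divides k (trans eq k+k≡k*2)) 2∤order
    where
    k+k≡k*2 : k ℕ.+ k ≡ k ℕ.* 2
    k+k≡k*2 = trans (cong (k ℕ.+_) (sym (ℕ.+-identityʳ k))) (ℕ.*-comm 2 k)

  open F-Sums.Reindexing _≟_ _≟_ using (∑-reindex)

  -- Translation by 1 permutes the field.
  order×1≡0 : order ×# 1# ≡ 0#
  order×1≡0 = begin
    order ×# 1#            ≡⟨ cong (_×# 1#) length-elements ⟨
    length elements ×# 1#  ≡⟨ ∑-length elements ⟨
    ∑ elements (λ _ → 1#) ≡⟨ ∑-cancel ⟩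
    0#                    ∎
    where
    translate : ∑ elements (λ x → x + 1#) ≡ ∑ elements id
    translate = ∑-reindex elements-unique elements-unique (_+ 1#) (_- 1#)
      (λ _ → ∈-elements _) (λ _ → ∈-elements _)
      (λ {x} _ → solve 1 (λ x → x :+ :1 :- :1 := x) refl x)
      (λ {x} _ → solve 1 (λ x → x :- :1 :+ :1 := x) refl x) id
    ∑-cancel : ∑ elements (λ _ → 1#) ≡ 0#
    ∑-cancel = begin
      ∑ elements (λ _ → 1#)
        ≡⟨ solve 2 (λ a b → b := a :+ b :- a) refl (∑ elements id) _ ⟩
      ∑ elements id + ∑ elements (λ _ → 1#) - ∑ elements id
        ≡⟨ cong (_- ∑ elements id) (trans (sym (∑-+ elements id (λ _ → 1#))) translate) ⟩
      ∑ elements id - ∑ elements id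
        ≡⟨ -‿inverseʳ _ ⟩
      0# ∎

  -- The order is odd: were 2 zero, `order ×# 1#` would be 1 instead of 0.
  2≢0 : 2# ≢ 0#
  2≢0 2≡0 = 0≢1 (begin
    0#                    ≡⟨ order×1≡0 ⟨
    order ×# 1#            ≡⟨ cong (_×# 1#) (proj₂ order-odd) ⟩
    1# + (k ℕ.+ k) ×# 1#   ≡⟨ cong (_ +_) (×-homo-+ 1# k k) ⟩
    1# + (k ×# 1# + k ×# 1#) ≡⟨ solve 1 (λ a → :1 :+ (a :+ a) := :1 :+ :2 :* a) refl (k ×# 1#) ⟩
    1# + (1# + (1# + 0#)) * (k ×# 1#)  ≡⟨ cong (λ u → 1# + (1# + u) * (k ×# 1#)) (+-identityʳ 1#) ⟩
    1# + 2# * (k ×# 1#)    ≡⟨ cong (λ u → 1# + u * (k ×# 1#)) 2≡0 ⟩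
    1# + 0# * (k ×# 1#)    ≡⟨ cong (1# +_) (zeroˡ _) ⟩
    1# + 0#               ≡⟨ +-identityʳ 1# ⟩
    1#                    ∎)
    where k = proj₁ order-odd

  cover⇒order≤ : ∀ {n} (f : Fin n → Carrier) → (∀ x → ∃ λ i → f i ≡ x) → order ℕ.≤ n
  cover⇒order≤ f f-onto = Fin.injective⇒≤ {f = λ i → proj₁ (f-onto (from i))} λ {i} {j} eq →
    from-injective (begin
      from i                       ≡⟨ proj₂ (f-onto (from i)) ⟨
      f (proj₁ (f-onto (from i)))  ≡⟨ cong f eq ⟩
      f (proj₁ (f-onto (from j)))  ≡⟨ proj₂ (f-onto (from j)) ⟩
      from j                       ∎)

  order≢0 : order ≢ 0
  order≢0 eq with to 0#
  ... | i = Fin.¬Fin0 (subst Fin eq i)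

  order≢1 : order ≢ 1
  order≢1 eq = 0≢1 (begin
    0#           ≡⟨ order×1≡0 ⟨
    order ×# 1#  ≡⟨ cong (_×# 1#) eq ⟩
    1# + 0#      ≡⟨ +-identityʳ 1# ⟩
    1#           ∎)

  order-1 : ℕ
  order-1 = ℕ.pred order

  1+[order-1] : suc order-1 ≡ order
  1+[order-1] = ℕ.suc-pred order ⦃ ℕ.≢-nonZero order≢0 ⦄

  order-1≢0 : order-1 ≢ 0
  order-1≢0 eq = order≢1 (trans (sym 1+[order-1]) (cong suc eq))

  -- Powers of a primitive element.

  module _ {g : Carrier} (g-primitive : Primitive F g) where

    private
      g≢0 = proj₁ g-primitive
      log = proj₂ g-primitive

    g^-periodic : ∀ {r} .⦃ _ : ℕ.NonZero r ⦄ → g ^ r ≡ 1# → ∀ k → g ^ (k % r) ≡ g ^ k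
    g^-periodic {r} gʳ≡1 k = sym (begin
      g ^ k                              ≡⟨ cong (g ^_) (ℕ.m≡m%n+[m/n]*n k r) ⟩
      g ^ (k % r ℕ.+ (k ℕ./ r) ℕ.* r)    ≡⟨ ^-homo-* g (k % r) _ ⟩
      g ^ (k % r) * g ^ ((k ℕ./ r) ℕ.* r) ≡⟨ cong (λ n → g ^ (k % r) * g ^ n) (ℕ.*-comm (k ℕ./ r) r) ⟩
      g ^ (k % r) * g ^ (r ℕ.* (k ℕ./ r)) ≡⟨ cong (g ^ (k % r) *_) (^-assocʳ g r (k ℕ./ r)) ⟨
      g ^ (k % r) * (g ^ r) ^ (k ℕ./ r)  ≡⟨ cong (λ u → g ^ (k % r) * u ^ (k ℕ./ r)) gʳ≡1 ⟩
      g ^ (k % r) * 1# ^ (k ℕ./ r)       ≡⟨ cong (g ^ (k % r) *_) (1^n≡1 (k ℕ./ r)) ⟩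
      g ^ (k % r) * 1#                   ≡⟨ *-identityʳ _ ⟩
      g ^ (k % r)                        ∎)

    -- If `g ^ r` is 1, then 0 and the first `r` powers of `g` already cover the field, so the order
    -- is at most `r + 1`.
    period-large : ∀ {r} → 0 ℕ.< r → g ^ r ≡ 1# → order-1 ℕ.≤ r
    period-large {r} 0<r gʳ≡1 = ℕ.s≤s⁻¹ (subst (ℕ._≤ suc r) (sym 1+[order-1]) (cover⇒order≤ f f-onto))
      where
      instance _ = ℕ.>-nonZero 0<r
      f : Fin (suc r) → Carrier
      f zero    = 0#
      f (suc i) = g ^ toℕ i
      f-onto : ∀ x → ∃ λ i → f i ≡ x
      f-onto x with x ≟ 0#
      ... | yes x≡0 = zero , sym x≡0
      ... | no  x≢0 with log x x≢0
      ...   | k , x≡gᵏ = suc (fromℕ< (ℕ.m%n<n k r)) , (begin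
        g ^ toℕ (fromℕ< (ℕ.m%n<n k r))  ≡⟨ cong (g ^_) (Fin.toℕ-fromℕ< (ℕ.m%n<n k r)) ⟩
        g ^ (k % r)                     ≡⟨ g^-periodic gʳ≡1 k ⟩
        g ^ k                           ≡⟨ x≡gᵏ ⟨
        x                               ∎)

    g^-difference : ∀ {i j} → i ℕ.≤ j → g ^ i ≡ g ^ j → g ^ (j ℕ.∸ i) ≡ 1#
    g^-difference {i} {j} i≤j eq = *-cancelˡ (^-≢0 i g≢0) (begin
      g ^ i * g ^ (j ℕ.∸ i)  ≡⟨ ^-homo-* g i _ ⟨
      g ^ (i ℕ.+ (j ℕ.∸ i))  ≡⟨ cong (g ^_) (ℕ.m+[n∸m]≡n i≤j) ⟩
      g ^ j                  ≡⟨ eq ⟨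
      g ^ i                  ≡⟨ *-identityʳ _ ⟨
      g ^ i * 1#             ∎)

    g^-injective : ∀ {i j} → i ℕ.< order-1 → j ℕ.< order-1 → g ^ i ≡ g ^ j → i ≡ j
    g^-injective {i} {j} i<r j<r eq with ℕ.<-cmp i j
    ... | tri≈ _ i≡j _ = i≡j
    ... | tri< i<j _ _ = contradiction
      (period-large (ℕ.m<n⇒0<n∸m i<j) (g^-difference (ℕ.<⇒≤ i<j) eq))
      (ℕ.<⇒≱ (ℕ.≤-<-trans (ℕ.m∸n≤m j i) j<r))
    ... | tri> _ _ j<i = contradiction
      (period-large (ℕ.m<n⇒0<n∸m j<i) (g^-difference (ℕ.<⇒≤ j<i) (sym eq)))
      (ℕ.<⇒≱ (ℕ.≤-<-trans (ℕ.m∸n≤m i j) i<r))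

    -- Among the exponents from 0 to `order-1` two give the same power, because there are only
    -- `order-1` nonzero values. Their difference is a period of at most `order-1`, and
    -- `period-large` excludes shorter ones.
    g^order-1 : g ^ order-1 ≡ 1#
    g^order-1 = subst (λ r → g ^ r ≡ 1#) (ℕ.≤-antisym r≤order-1 (period-large 0<r gʳ≡1)) gʳ≡1
      where
      toℕ-to-injective : ∀ {x y} → toℕ (to x) ≡ toℕ (to y) → x ≡ y
      toℕ-to-injective {x} {y} eq = begin
        x            ≡⟨ strictlyInverseʳ x ⟨
        from (to x)  ≡⟨ cong from (Fin.toℕ-injective eq) ⟩
        from (to y)  ≡⟨ strictlyInverseʳ y ⟩
        y            ∎
      to′ : Carrier → Fin (suc order-1)
      to′ x = Fin.cast (sym 1+[order-1]) (to x)
      to′-injective : ∀ {x y} → to′ x ≡ to′ y → x ≡ y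
      to′-injective {x} {y} eq = toℕ-to-injective (begin
        toℕ (to x)   ≡⟨ Fin.toℕ-cast _ (to x) ⟨
        toℕ (to′ x)  ≡⟨ cong toℕ eq ⟩
        toℕ (to′ y)  ≡⟨ Fin.toℕ-cast _ (to y) ⟩
        toℕ (to y)   ∎)
      0≢gⁱ : ∀ i → to′ 0# ≢ to′ (g ^ i)
      0≢gⁱ i eq = ^-≢0 i g≢0 (sym (to′-injective eq))
      collision = Fin.pigeonhole (ℕ.n<1+n order-1) (λ i → punchOut (0≢gⁱ (toℕ i)))
      i = toℕ (proj₁ collision)
      j = toℕ (proj₁ (proj₂ collision))
      r = j ℕ.∸ i
      i<j : i ℕ.< j
      i<j = proj₁ (proj₂ (proj₂ collision))
      gⁱ≡gʲ : g ^ i ≡ g ^ j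
      gⁱ≡gʲ = to′-injective (Fin.punchOut-injective (0≢gⁱ i) (0≢gⁱ j) (proj₂ (proj₂ (proj₂ collision))))
      0<r : 0 ℕ.< r
      0<r = ℕ.m<n⇒0<n∸m i<j
      gʳ≡1 : g ^ r ≡ 1#
      gʳ≡1 = g^-difference (ℕ.<⇒≤ i<j) gⁱ≡gʲ
      r≤order-1 : r ℕ.≤ order-1
      r≤order-1 = ℕ.≤-trans (ℕ.m∸n≤m j i) (ℕ.s≤s⁻¹ (Fin.toℕ<n (proj₁ (proj₂ collision))))

    -- i = g ^ ((q - 1) / 4): its square squares to 1 and differs from 1.
    -1-isSquare : order % 4 ≡ 1 → ∃ λ i → i * i ≡ - 1#
    -1-isSquare order%4≡1 = i , x∙y⁻¹≈ε⇒x≈y (i * i) (- 1#) (xy≡0⇒y≡0 i²-1≢0 (begin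
      (i * i - 1#) * (i * i - - 1#)
        ≡⟨ solve 1 (λ i → (i :* i :- :1) :* (i :* i :- :- :1) := i :* i :* (i :* i) :- :1) refl i ⟩
      i * i * (i * i) - 1#
        ≡⟨ cong (λ u → u * u - 1#) i²≡ ⟩
      g ^ (j ℕ.+ j) * g ^ (j ℕ.+ j) - 1#
        ≡⟨ cong (_- 1#) (^-homo-* g (j ℕ.+ j) (j ℕ.+ j)) ⟨
      g ^ (j ℕ.+ j ℕ.+ (j ℕ.+ j)) - 1#
        ≡⟨ cong (λ n → g ^ n - 1#) 4j≡ ⟨
      g ^ order-1 - 1#
        ≡⟨ cong (_- 1#) g^order-1 ⟩
      1# - 1#
        ≡⟨ -‿inverseʳ 1# ⟩
      0# ∎))
      where
      j = order ℕ./ 4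
      i = g ^ j
      4j≡ : order-1 ≡ j ℕ.+ j ℕ.+ (j ℕ.+ j)
      4j≡ = begin
        ℕ.pred order                            ≡⟨ cong ℕ.pred (ℕ.m≡m%n+[m/n]*n order 4) ⟩
        ℕ.pred (order % 4 ℕ.+ j ℕ.* 4)          ≡⟨ cong (λ r → ℕ.pred (r ℕ.+ j ℕ.* 4)) order%4≡1 ⟩
        j ℕ.* 4                                 ≡⟨ ℕ.*-comm j 4 ⟩
        j ℕ.+ (j ℕ.+ (j ℕ.+ (j ℕ.+ 0)))         ≡⟨ cong (λ n → j ℕ.+ (j ℕ.+ (j ℕ.+ n))) (ℕ.+-identityʳ j) ⟩
        j ℕ.+ (j ℕ.+ (j ℕ.+ j))                 ≡⟨ ℕ.+-assoc j j (j ℕ.+ j) ⟨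
        j ℕ.+ j ℕ.+ (j ℕ.+ j)                   ∎
      i²≡ : i * i ≡ g ^ (j ℕ.+ j)
      i²≡ = sym (^-homo-* g j j)
      0<j : 0 ℕ.< j
      0<j = ℕ.n≢0⇒n>0 λ j≡0 → order-1≢0 (trans 4j≡ (cong (λ j → j ℕ.+ j ℕ.+ (j ℕ.+ j)) j≡0))
      i²-1≢0 : i * i - 1# ≢ 0#
      i²-1≢0 eq = ℕ.<⇒≱ (ℕ.m<m+n (j ℕ.+ j) (ℕ.<-≤-trans 0<j (ℕ.m≤m+n j j)))
        (subst (ℕ._≤ j ℕ.+ j) 4j≡ (period-large (ℕ.<-≤-trans 0<j (ℕ.m≤m+n j j))
          (trans (sym i²≡) (x∙y⁻¹≈ε⇒x≈y (i * i) 1# eq))))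

    -- Powers of g run through the units, even and odd powers through the squares
    -- and the nonsquares, each of them twice.
    module _ {c ℓ} (R : CommutativeRing c ℓ) where

      private
        module R where
          open CommutativeRing R public
          open Sums R public
      open R.Reindexing ℕ._≟_ _≟_ renaming (∑-reindex to ∑-reindexℕ)
      open import Relation.Binary.Reasoning.Setoid R.setoid renaming (begin_ to beginR_; _∎ to _∎R)

      ∑-powers : ∀ (f : Carrier → R.Carrier) → R.∑ (downFrom order-1) (λ k → f (g ^ k)) R.≈ R.∑ units f
      ∑-powers = ∑-reindexℕ (Unique.downFrom⁺ order-1) units-unique (g ^_) (λ x → log′ x % order-1)
        (λ {k} _ → ∈-units (^-≢0 k g≢0))
        (λ {x} _ → ∈.∈-downFrom⁺ (ℕ.m%n<n (log′ x) order-1))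
        (λ {k} k∈ → g^-injective (ℕ.m%n<n _ order-1) (∈.∈-downFrom⁻ k∈) (log′-correct (^-≢0 k g≢0)))
        (λ x∈ → log′-correct (units-≢0 x∈))
        where
        instance _ : ℕ.NonZero order-1
        _ = ℕ.≢-nonZero order-1≢0
        exponent : Dec (x ≡ 0#) → ℕ
        exponent (yes _)   = 0
        exponent (no x≢0) = proj₁ (log _ x≢0)
        exponent-correct : ∀ (d : Dec (x ≡ 0#)) → x ≢ 0# → g ^ exponent d ≡ x
        exponent-correct (yes x≡0) x≢0 = contradiction x≡0 x≢0
        exponent-correct (no x≢0)  _   = sym (proj₂ (log _ x≢0))
        log′ : Carrier → ℕ
        log′ x = exponent (x ≟ 0#)
        log′-correct : x ≢ 0# → g ^ (log′ x % order-1) ≡ x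
        log′-correct x≢0 = trans (g^-periodic g^order-1 _) (exponent-correct (_ ≟ 0#) x≢0)

      ∑-even+odd : ∀ (F : ℕ → R.Carrier) r →
        R.∑ (downFrom r) (λ k → F (k ℕ.+ k)) R.+ R.∑ (downFrom r) (λ k → F (suc (k ℕ.+ k))) R.≈
        R.∑ (downFrom (r ℕ.+ r)) F
      ∑-even+odd F zero    = R.+-identityˡ R.0#
      ∑-even+odd F (suc r) rewrite ℕ.+-suc r r = beginR
        (F (r ℕ.+ r) R.+ E) R.+ (F (suc (r ℕ.+ r)) R.+ O)  ≈⟨ interchange _ _ _ _ ⟩
        (F (r ℕ.+ r) R.+ F (suc (r ℕ.+ r))) R.+ (E R.+ O)  ≈⟨ R.+-cong (R.+-comm _ _) (∑-even+odd F r) ⟩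
        (F (suc (r ℕ.+ r)) R.+ F (r ℕ.+ r)) R.+ R.∑ (downFrom (r ℕ.+ r)) F  ≈⟨ R.+-assoc _ _ _ ⟩
        F (suc (r ℕ.+ r)) R.+ (F (r ℕ.+ r) R.+ R.∑ (downFrom (r ℕ.+ r)) F)  ∎R
        where
        open import Algebra.Properties.CommutativeSemigroup R.+-commutativeSemigroup using (interchange)
        E = R.∑ (downFrom r) (λ k → F (k ℕ.+ k))
        O = R.∑ (downFrom r) (λ k → F (suc (k ℕ.+ k)))

      ∑-downFrom-+ : ∀ (F : ℕ → R.Carrier) m n →
        R.∑ (downFrom (m ℕ.+ n)) F R.≈ R.∑ (downFrom m) (λ k → F (k ℕ.+ n)) R.+ R.∑ (downFrom n) F
      ∑-downFrom-+ F zero    n = R.sym (R.+-identityˡ _)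
      ∑-downFrom-+ F (suc m) n = R.trans (R.+-congˡ (∑-downFrom-+ F m n)) (R.sym (R.+-assoc _ _ _))

      ∑-squares+nonsquares : ∀ (f : Carrier → R.Carrier) →
        R.∑ units (λ a → f (a * a)) R.+ R.∑ units (λ a → f (g * (a * a))) R.≈ R.∑ units f R.+ R.∑ units f
      ∑-squares+nonsquares f = beginR
        R.∑ units (λ a → f (a * a)) R.+ R.∑ units (λ a → f (g * (a * a)))
          ≈⟨ R.+-cong (∑-powers _) (∑-powers _) ⟨
        R.∑ (downFrom r) (λ k → f (g ^ k * g ^ k)) R.+ R.∑ (downFrom r) (λ k → f (g * (g ^ k * g ^ k)))
          ≈⟨ R.+-cong (R.∑-cong (downFrom r) λ k → R.reflexive (cong f (^-homo-* g k k)))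
                      (R.∑-cong (downFrom r) λ k → R.reflexive (cong (λ u → f (g * u)) (^-homo-* g k k))) ⟨
        R.∑ (downFrom r) (λ k → f (g ^ (k ℕ.+ k))) R.+ R.∑ (downFrom r) (λ k → f (g ^ suc (k ℕ.+ k)))
          -- The exponents 2k and 2k + 1 with k < r fill exactly two periods of `g`.
          ≈⟨ ∑-even+odd (λ k → f (g ^ k)) r ⟩
        R.∑ (downFrom (r ℕ.+ r)) (λ k → f (g ^ k))
          ≈⟨ ∑-downFrom-+ (λ k → f (g ^ k)) r r ⟩
        R.∑ (downFrom r) (λ k → f (g ^ (k ℕ.+ r))) R.+ R.∑ (downFrom r) (λ k → f (g ^ k))
          ≈⟨ R.+-congʳ (R.∑-cong (downFrom r) λ k → R.reflexive (cong f (gᵏ⁺ʳ≡gᵏ k))) ⟩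
        R.∑ (downFrom r) (λ k → f (g ^ k)) R.+ R.∑ (downFrom r) (λ k → f (g ^ k))
          ≈⟨ R.+-cong (∑-powers f) (∑-powers f) ⟩
        R.∑ units f R.+ R.∑ units f ∎R
        where
        r = order-1
        gᵏ⁺ʳ≡gᵏ : ∀ k → g ^ (k ℕ.+ r) ≡ g ^ k
        gᵏ⁺ʳ≡gᵏ k = trans (^-homo-* g k r) (trans (cong (g ^ k *_) g^order-1) (*-identityʳ _))

  -- Substitutions in sums over the field and its units.

  module _ {c ℓ} (R : CommutativeRing c ℓ) where

    private
      module R where
        open CommutativeRing R public
        open Sums R public
    open R.Reindexing _≟_ _≟_ renaming (∑-reindex to ∑-reindexᴿ)
    open import Relation.Binary.Reasoning.Setoid R.setoid renaming (begin_ to beginR_; _∎ to _∎R)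

    ∑-elements : ∀ f → R.∑ elements f R.≈ f 0# R.+ R.∑ units f
    ∑-elements f = beginR
      R.∑ elements f
        ≈⟨ R.∑-cong elements (λ x → R.⟦⟧-split (x ≟ 0#) (f x)) ⟩
      R.∑ elements (λ x → R.⟦ x ≟ 0# ⟧ R.* f x R.+ R.⟦ ¬? (x ≟ 0#) ⟧ R.* f x)
        ≈⟨ R.∑-+ elements _ _ ⟩
      R.∑ elements (λ x → R.⟦ x ≟ 0# ⟧ R.* f x) R.+ R.∑ elements (λ x → R.⟦ ¬? (x ≟ 0#) ⟧ R.* f x)
        ≈⟨ R.+-cong (R.Kronecker.∑-δ _≟_ elements-unique (∈-elements 0#) f)
                    (R.sym (R.∑-filter (λ x → ¬? (x ≟ 0#)) elements f)) ⟩
      f 0# R.+ R.∑ units f ∎R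

    ∑-dilate : ∀ {s} → s ≢ 0# → ∀ f → R.∑ elements (λ x → f (s * x)) R.≈ R.∑ elements f
    ∑-dilate {s} s≢0 = ∑-reindexᴿ elements-unique elements-unique (s *_) (s ⁻¹ *_)
      (λ _ → ∈-elements _) (λ _ → ∈-elements _)
      (λ {x} _ → x⁻¹[xy]≡y s≢0 x) (λ {x} _ → x[x⁻¹y]≡y s≢0 x)

    ∑-dilate-units : ∀ {s} → s ≢ 0# → ∀ f → R.∑ units (λ x → f (s * x)) R.≈ R.∑ units f
    ∑-dilate-units {s} s≢0 = ∑-reindexᴿ units-unique units-unique (s *_) (s ⁻¹ *_)
      (λ x∈ → ∈-units (*-≢0 s≢0 (units-≢0 x∈))) (λ x∈ → ∈-units (*-≢0 (⁻¹-≢0 s≢0) (units-≢0 x∈)))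
      (λ {x} _ → x⁻¹[xy]≡y s≢0 x) (λ {x} _ → x[x⁻¹y]≡y s≢0 x)

    ∑-translate : ∀ b f → R.∑ elements (λ x → f (x + b)) R.≈ R.∑ elements f
    ∑-translate b = ∑-reindexᴿ elements-unique elements-unique (_+ b) (_- b)
      (λ _ → ∈-elements _) (λ _ → ∈-elements _)
      (λ {x} _ → solve 2 (λ x b → x :+ b :- b := x) refl x b)
      (λ {x} _ → solve 2 (λ x b → x :- b :+ b := x) refl x b)

    ∑-invert-units : ∀ f → R.∑ units (λ x → f (x ⁻¹)) R.≈ R.∑ units f
    ∑-invert-units = ∑-reindexᴿ units-unique units-unique _⁻¹ _⁻¹
      (λ x∈ → ∈-units (⁻¹-≢0 (units-≢0 x∈))) (λ x∈ → ∈-units (⁻¹-≢0 (units-≢0 x∈)))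
      (λ x∈ → ⁻¹-involutive (units-≢0 x∈)) (λ x∈ → ⁻¹-involutive (units-≢0 x∈))
      where
      ⁻¹-involutive : x ≢ 0# → x ⁻¹ ⁻¹ ≡ x
      ⁻¹-involutive {x} x≢0 = *-cancelˡ (⁻¹-≢0 x≢0)
        (trans (⁻¹-inverseʳ (⁻¹-≢0 x≢0)) (sym (⁻¹-inverseˡ x≢0)))

-- Vectors over the finite field and chords of a sphere.

module GeometryProperties (F : FiniteField) where

  open import Data.List.Membership.Propositional using () renaming (_∈_ to _∈ˡ_)

  open FiniteField F hiding (_-_)
  open Geometry F
  open FieldProperties F
  open IntegerSolver commutativeRing
  open import Data.Bool.Properties using (T?)
  open ≡ using (refl; sym; trans; cong; cong₂)
  open ≡.≡-Reasoning

  private variable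
    d : ℕ

  points-unique : ∀ d → Unique (points d)
  points-unique zero    = [] ∷ []
  points-unique (suc d) = Unique.cartesianProductWith⁺ _∷_ Vec.∷-injective elements-unique (points-unique d)

  ∈-points : (x : Point d) → x ∈ˡ points d
  ∈-points []      = here refl
  ∈-points (a ∷ x) = ∈.∈-cartesianProductWith⁺ _∷_ (∈-elements a) (∈-points x)

  members-unique : (E : Subset d) → Unique (members E)
  members-unique E = Unique.filter⁺ (T? ∘ E) (points-unique _)

  ∈-members : ∀ {E : Subset d} {x} → x ∈ E → x ∈ˡ members E
  ∈-members {E = E} = ∈.∈-filter⁺ (T? ∘ E) (∈-points _)

  members-∈ : ∀ {E : Subset d} {x} → x ∈ˡ members E → x ∈ E
  members-∈ {E = E} x∈ = proj₂ (∈.∈-filter⁻ (T? ∘ E) {xs = points _} x∈)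

  infixr 8 _⊛_
  _⊛_ : Carrier → Point d → Point d
  t ⊛ x = Vec.map (t *_) x

  -ᵖ-self : (x : Point d) → x -ᵖ x ≡ 0ᵖ
  -ᵖ-self []      = refl
  -ᵖ-self (a ∷ x) = cong₂ _∷_ (-‿inverseʳ a) (-ᵖ-self x)

  x-y≡0⇒x≡y : (x y : Point d) → x -ᵖ y ≡ 0ᵖ → x ≡ y
  x-y≡0⇒x≡y []      []      _  = refl
  x-y≡0⇒x≡y (a ∷ x) (b ∷ y) eq with Vec.∷-injective eq
  ... | a-b≡0 , x-y≡0 = cong₂ _∷_ (x∙y⁻¹≈ε⇒x≈y a b a-b≡0) (x-y≡0⇒x≡y x y x-y≡0)

  -ᵖ-cancelʳ : (x y z : Point d) → x -ᵖ z ≡ y -ᵖ z → x ≡ y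
  -ᵖ-cancelʳ []      []      []      _  = refl
  -ᵖ-cancelʳ (a ∷ x) (b ∷ y) (c ∷ z) eq with Vec.∷-injective eq
  ... | p , q = cong₂ _∷_
    (begin
      a          ≡⟨ solve 2 (λ a c → a := a :- c :+ c) refl a c ⟩
      a - c + c  ≡⟨ cong (_+ c) p ⟩
      b - c + c  ≡⟨ solve 2 (λ b c → b :- c :+ c := b) refl b c ⟩
      b          ∎)
    (-ᵖ-cancelʳ x y z q)

  ⊛-cancelˡ : ∀ {t} → t ≢ 0# → (x y : Point d) → t ⊛ x ≡ t ⊛ y → x ≡ y
  ⊛-cancelˡ t≢0 []      []      _  = refl
  ⊛-cancelˡ t≢0 (a ∷ x) (b ∷ y) eq with Vec.∷-injective eq
  ... | p , q = cong₂ _∷_ (*-cancelˡ t≢0 p) (⊛-cancelˡ t≢0 x y q)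

  +ᵖ≡+ᵖ⇒≡ : (x y z w : Point d) → x +ᵖ y ≡ z +ᵖ w → y ≡ z +ᵖ w -ᵖ x
  +ᵖ≡+ᵖ⇒≡ []      []      []      []      _  = refl
  +ᵖ≡+ᵖ⇒≡ (a ∷ x) (b ∷ y) (c ∷ z) (e ∷ w) eq with Vec.∷-injective eq
  ... | p , q = cong₂ _∷_
    (trans (solve 2 (λ a b → b := a :+ b :- a) refl a b) (cong (_- a) p))
    (+ᵖ≡+ᵖ⇒≡ x y z w q)

  ·-comm : (x y : Point d) → x · y ≡ y · x
  ·-comm []      []      = refl
  ·-comm (a ∷ x) (b ∷ y) = cong₂ _+_ (*-comm a b) (·-comm x y)

  ·-distribˡ-+ : (x y z : Point d) → x · (y +ᵖ z) ≡ x · y + x · z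
  ·-distribˡ-+ []      []      []      = sym (+-identityˡ 0#)
  ·-distribˡ-+ (a ∷ x) (b ∷ y) (c ∷ z) = trans (cong (a * (b + c) +_) (·-distribˡ-+ x y z))
    (solve 5 (λ a b c u v → a :* (b :+ c) :+ (u :+ v) := a :* b :+ u :+ (a :* c :+ v)) refl a b c (x · y) (x · z))

  ·-distribˡ-- : (x y z : Point d) → x · (y -ᵖ z) ≡ x · y - x · z
  ·-distribˡ-- []      []      []      = sym (-‿inverseʳ 0#)
  ·-distribˡ-- (a ∷ x) (b ∷ y) (c ∷ z) = trans (cong (a * (b - c) +_) (·-distribˡ-- x y z))
    (solve 5 (λ a b c u v → a :* (b :- c) :+ (u :- v) := a :* b :+ u :- (a :* c :+ v)) refl a b c (x · y) (x · z))

  ·-⊛ : ∀ t (x y : Point d) → x · (t ⊛ y) ≡ t * (x · y)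
  ·-⊛ t []      []      = sym (zeroʳ t)
  ·-⊛ t (a ∷ x) (b ∷ y) = trans (cong (a * (t * b) +_) (·-⊛ t x y))
    (solve 4 (λ t a b u → a :* (t :* b) :+ t :* u := t :* (a :* b :+ u)) refl t a b (x · y))

  ⊛-· : ∀ t (x y : Point d) → (t ⊛ x) · y ≡ t * (x · y)
  ⊛-· t x y = trans (·-comm (t ⊛ x) y) (trans (·-⊛ t y x) (cong (t *_) (·-comm y x)))

  ⊛-inverse : ∀ {s t} → s * t ≡ 1# → (x : Point d) → s ⊛ (t ⊛ x) ≡ x
  ⊛-inverse st≡1 []      = refl
  ⊛-inverse {s = s} {t} st≡1 (a ∷ x) = cong₂ _∷_
    (trans (sym (*-assoc s t a)) (trans (cong (_* a) st≡1) (*-identityˡ a)))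
    (⊛-inverse st≡1 x)

  ∥∥≡· : (x : Point d) → ∥ x ∥ ≡ x · x
  ∥∥≡· []      = refl
  ∥∥≡· (a ∷ x) = cong₂ _+_ (cong (a *_) (*-identityʳ a)) (∥∥≡· x)

  ∥-∥ : (x y : Point d) → ∥ x -ᵖ y ∥ ≡ ∥ x ∥ + ∥ y ∥ - 2# * (x · y)
  ∥-∥ x y = begin
    ∥ x -ᵖ y ∥
      ≡⟨ ∥∥≡· (x -ᵖ y) ⟩
    (x -ᵖ y) · (x -ᵖ y)
      ≡⟨ ·-distribˡ-- (x -ᵖ y) x y ⟩
    (x -ᵖ y) · x - (x -ᵖ y) · y
      ≡⟨ cong₂ _-_ (trans (·-comm _ x) (·-distribˡ-- x x y)) (trans (·-comm _ y) (·-distribˡ-- y x y)) ⟩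
    (x · x - x · y) - (y · x - y · y)
      ≡⟨ cong (λ u → (x · x - x · y) - (u - y · y)) (·-comm y x) ⟩
    (x · x - x · y) - (x · y - y · y)
      ≡⟨ solve 3 (λ a b c → (a :- b) :- (b :- c) := a :+ c :- (:1 :+ :1) :* b) refl (x · x) (x · y) (y · y) ⟩
    x · x + y · y - 2# * (x · y)
      ≡⟨ cong₂ (λ u v → u + v - 2# * (x · y)) (∥∥≡· x) (∥∥≡· y) ⟨
    ∥ x ∥ + ∥ y ∥ - 2# * (x · y) ∎

  ∥⊛∥ : ∀ t (x : Point d) → ∥ t ⊛ x ∥ ≡ t * t * ∥ x ∥
  ∥⊛∥ t x = begin
    ∥ t ⊛ x ∥          ≡⟨ ∥∥≡· (t ⊛ x) ⟩
    (t ⊛ x) · (t ⊛ x)  ≡⟨ ·-⊛ t (t ⊛ x) x ⟩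
    t * ((t ⊛ x) · x)  ≡⟨ cong (t *_) (trans (·-comm _ x) (·-⊛ t x x)) ⟩
    t * (t * (x · x))  ≡⟨ *-assoc t t _ ⟨
    t * t * (x · x)    ≡⟨ cong (t * t *_) (∥∥≡· x) ⟨
    t * t * ∥ x ∥      ∎

  ∥⊛-⊛∥ : ∀ s t {g} (x y : Point d) → ∥ x ∥ ≡ g → ∥ y ∥ ≡ g →
          ∥ s ⊛ x -ᵖ t ⊛ y ∥ ≡ s * s * g + t * t * g - 2# * (t * (s * (x · y)))
  ∥⊛-⊛∥ s t {g} x y ∥x∥≡g ∥y∥≡g = begin
    ∥ s ⊛ x -ᵖ t ⊛ y ∥
      ≡⟨ ∥-∥ (s ⊛ x) (t ⊛ y) ⟩
    ∥ s ⊛ x ∥ + ∥ t ⊛ y ∥ - 2# * ((s ⊛ x) · (t ⊛ y))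
      ≡⟨ cong₂ (λ i j → i + j - 2# * ((s ⊛ x) · (t ⊛ y)))
           (trans (∥⊛∥ s x) (cong (s * s *_) ∥x∥≡g)) (trans (∥⊛∥ t y) (cong (t * t *_) ∥y∥≡g)) ⟩
    s * s * g + t * t * g - 2# * ((s ⊛ x) · (t ⊛ y))
      ≡⟨ cong (λ e → s * s * g + t * t * g - 2# * e) (trans (·-⊛ t (s ⊛ x) y) (cong (t *_) (⊛-· s x y))) ⟩
    s * s * g + t * t * g - 2# * (t * (s * (x · y))) ∎

  ·-self : ∀ {g} (x : Point d) → ∥ x ∥ ≡ g → x · x ≡ g
  ·-self x ∥x∥≡g = trans (sym (∥∥≡· x)) ∥x∥≡g

  module _ {g : Carrier} (x : Point d) (∥x∥≡g : ∥ x ∥ ≡ g) where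

    -- On the sphere both quadratic terms equal `g`, so the norm of a chord from `x` is a linear
    -- function of the chord.
    ∥-∥-sphere : ∀ z → ∥ z ∥ ≡ g → ∥ z -ᵖ x ∥ ≡ - (2# * (x · (z -ᵖ x)))
    ∥-∥-sphere z ∥z∥≡g = begin
      ∥ z -ᵖ x ∥                    ≡⟨ ∥-∥ z x ⟩
      ∥ z ∥ + ∥ x ∥ - 2# * (z · x)  ≡⟨ cong₂ (λ a b → a + b - 2# * (z · x)) ∥z∥≡g ∥x∥≡g ⟩
      g + g - 2# * (z · x)          ≡⟨ solve 2 (λ g p → g :+ g :- (:1 :+ :1) :* p := :- ((:1 :+ :1) :* (p :- g))) refl g (z · x) ⟩
      - (2# * (z · x - g))          ≡⟨ cong₂ (λ a b → - (2# * (a - b))) (·-comm z x) (sym (·-self x ∥x∥≡g)) ⟩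
      - (2# * (x · z - x · x))      ≡⟨ cong (λ e → - (2# * e)) (·-distribˡ-- x z x) ⟨
      - (2# * (x · (z -ᵖ x)))       ∎

    -- Turns the null condition on a chord, by which directions are weighted, into the equation
    -- `x · y ≡ g`, by which the elliptic form counts pairs.
    null⇒dot≡g : ∀ y → ∥ y ∥ ≡ g → ∥ y -ᵖ x ∥ ≡ 0# → x · y - g ≡ 0#
    null⇒dot≡g y ∥y∥≡g null = begin
      x · y - g      ≡⟨ cong (λ e → x · y - e) (·-self x ∥x∥≡g) ⟨
      x · y - x · x  ≡⟨ ·-distribˡ-- x y x ⟨
      x · (y -ᵖ x)   ≡⟨ xy≡0⇒y≡0 (-‿≢0 2≢0) (trans
                          (solve 2 (λ c p → (:- c) :* p := :- (c :* p)) refl 2# (x · (y -ᵖ x)))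
                          (trans (sym (∥-∥-sphere y ∥y∥≡g)) null)) ⟩
      0#             ∎

    -- The norm of `w` is quadratic in the scale, while by `∥-∥-sphere` the norm of the chord is
    -- linear in the chord; one factor `t` remains. For `∥ w ∥ ≢ 0#` this is a linear equation that
    -- determines `t`.
    scale-determined : ∀ {w t} z → ∥ z ∥ ≡ g → w ≡ t ⊛ (z -ᵖ x) → t * - (2# * (x · w)) ≡ ∥ w ∥
    scale-determined {w} {t} z ∥z∥≡g refl = begin
      t * - (2# * (x · (t ⊛ (z -ᵖ x))))  ≡⟨ cong (λ e → t * - (2# * e)) (·-⊛ t x (z -ᵖ x)) ⟩
      t * - (2# * (t * (x · (z -ᵖ x))))  ≡⟨ solve 3 (λ t c p → t :* :- (c :* (t :* p)) := t :* t :* :- (c :* p)) refl t 2# (x · (z -ᵖ x)) ⟩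
      t * t * - (2# * (x · (z -ᵖ x)))    ≡⟨ cong (t * t *_) (∥-∥-sphere z ∥z∥≡g) ⟨
      t * t * ∥ z -ᵖ x ∥                 ≡⟨ ∥⊛∥ t (z -ᵖ x) ⟨
      ∥ t ⊛ (z -ᵖ x) ∥                   ∎

    -- Expanding the norm of `y = z + w - x` gives g + 2 (z - x) · (w - x), and this norm is `g` as
    -- well.
    parallelogram⇒rectangle : ∀ y z w → ∥ y ∥ ≡ g → ∥ z ∥ ≡ g → ∥ w ∥ ≡ g →
      x +ᵖ y ≡ z +ᵖ w → (z -ᵖ x) · (w -ᵖ x) ≡ 0#
    parallelogram⇒rectangle y z w ∥y∥≡g ∥z∥≡g ∥w∥≡g eq = xy≡0⇒y≡0 2≢0 (begin
      2# * ((z -ᵖ x) · (w -ᵖ x))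
        ≡⟨ cong (2# *_) (trans (·-distribˡ-- (z -ᵖ x) w x) (cong₂ _-_
             (trans (·-comm (z -ᵖ x) w) (·-distribˡ-- w z x)) (trans (·-comm (z -ᵖ x) x) (·-distribˡ-- x z x)))) ⟩
      2# * (w · z - w · x - (x · z - x · x))
        ≡⟨ cong (λ e → 2# * (w · z - w · x - (x · z - e))) (·-self x ∥x∥≡g) ⟩
      2# * (w · z - w · x - (x · z - g))
        ≡⟨ solve 4 (λ g p r s → (:1 :+ :1) :* (p :- r :- (s :- g)) :=
             g :+ p :+ (p :+ g) :+ g :- (:1 :+ :1) :* (s :+ r) :- g) refl g (w · z) (w · x) (x · z) ⟩
      g + w · z + (w · z + g) + g - 2# * (x · z + w · x) - g
        ≡⟨ cong (_- g) ∥y∥≡ ⟨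
      ∥ y ∥ - g
        ≡⟨ trans (cong (_- g) ∥y∥≡g) (-‿inverseʳ g) ⟩
      0# ∎)
      where
      ∥z+w∥≡ : ∥ z +ᵖ w ∥ ≡ g + w · z + (w · z + g)
      ∥z+w∥≡ = begin
        ∥ z +ᵖ w ∥                       ≡⟨ trans (∥∥≡· (z +ᵖ w)) (·-distribˡ-+ (z +ᵖ w) z w) ⟩
        (z +ᵖ w) · z + (z +ᵖ w) · w      ≡⟨ cong₂ _+_ (trans (·-comm _ z) (·-distribˡ-+ z z w)) (trans (·-comm _ w) (·-distribˡ-+ w z w)) ⟩
        z · z + z · w + (w · z + w · w)  ≡⟨ cong₂ (λ a b → a + b + (w · z + w · w)) (·-self z ∥z∥≡g) (·-comm z w) ⟩
        g + w · z + (w · z + w · w)      ≡⟨ cong (λ e → g + w · z + (w · z + e)) (·-self w ∥w∥≡g) ⟩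
        g + w · z + (w · z + g)          ∎
      ∥y∥≡ : ∥ y ∥ ≡ g + w · z + (w · z + g) + g - 2# * (x · z + w · x)
      ∥y∥≡ = begin
        ∥ y ∥
          ≡⟨ trans (cong ∥_∥ (+ᵖ≡+ᵖ⇒≡ x y z w eq)) (∥-∥ (z +ᵖ w) x) ⟩
        ∥ z +ᵖ w ∥ + ∥ x ∥ - 2# * ((z +ᵖ w) · x)
          ≡⟨ cong₂ (λ a b → a + b - 2# * ((z +ᵖ w) · x)) ∥z+w∥≡ ∥x∥≡g ⟩
        g + w · z + (w · z + g) + g - 2# * ((z +ᵖ w) · x)
          ≡⟨ cong (λ e → g + w · z + (w · z + g) + g - 2# * e) (trans (·-comm (z +ᵖ w) x)
               (trans (·-distribˡ-+ x z w) (cong (x · z +_) (·-comm x w)))) ⟩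
        g + w · z + (w · z + g) + g - 2# * (x · z + w · x) ∎

-- Ordered field arithmetic and real powers.

module RealProperties (R : Reals) where

  open Reals R
  open module CR = CommutativeRing commutativeRing public
    using (refl; sym; trans; setoid; reflexive;
           +-cong; +-congˡ; +-congʳ; +-comm; +-assoc; +-identityˡ; +-identityʳ; -‿cong; -‿inverseʳ; -‿inverseˡ;
           *-cong; *-congˡ; *-congʳ; *-comm; *-assoc; *-identityˡ; *-identityʳ; zeroˡ; zeroʳ; distribˡ; distribʳ)
  open module ℝ-Sums = Sums commutativeRing public
  open IntegerSolver commutativeRing public
  open import Algebra.Properties.Semiring.Mult semiring using (×-homo-+; ×1-homo-*)
  open import Algebra.Properties.Semiring.Exp semiring public using () renaming (^-homo-* to ^ⁿ-homo-*; ^-congˡ to ^ⁿ-congˡ; ^-assocʳ to ^ⁿ-assocʳ)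
  open import Data.List.Membership.Propositional using (_∈_)
  open import Relation.Binary.Bundles using (Poset)
  open import Relation.Binary.Structures using (IsDecTotalOrder)

  open module Order = IsDecTotalOrder isDecTotalOrder public
    using (_≤?_; total; antisym; ≤-respˡ-≈; ≤-respʳ-≈)
    renaming (refl to ≤-refl; trans to ≤-trans; reflexive to ≤-reflexive; _≟_ to _≈?_)

  poset : Poset 0ℓ 0ℓ 0ℓ
  poset = record { isPartialOrder = Order.isPartialOrder }

  module ≤-Reasoning where
    open import Relation.Binary.Reasoning.PartialOrder poset public

  open ≤-Reasoning

  private variable
    a : Level
    A : Set a
    x y z w : ℝ

  ≰⇒≥ : ¬ (x ≤ y) → y ≤ x
  ≰⇒≥ {x} {y} x≰y with total x y
  ... | inj₁ x≤y = contradiction x≤y x≰y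
  ... | inj₂ y≤x = y≤x

  <⇒≤ : x < y → x ≤ y
  <⇒≤ = proj₁

  <⇒≉ : x < y → y ≉ x
  <⇒≉ x<y y≈x = proj₂ x<y (sym y≈x)

  <-≤-trans : x < y → y ≤ z → x < z
  <-≤-trans (x≤y , x≉y) y≤z = ≤-trans x≤y y≤z , λ x≈z → x≉y (antisym x≤y (≤-respʳ-≈ (sym x≈z) y≤z))

  +-monoʳ-≤ : ∀ z → x ≤ y → z + x ≤ z + y
  +-monoʳ-≤ z x≤y = ≤-respˡ-≈ (+-comm _ _) (≤-respʳ-≈ (+-comm _ _) (+-monoˡ-≤ z x≤y))

  +-mono-≤ : x ≤ y → z ≤ w → x + z ≤ y + w
  +-mono-≤ {y = y} {z} x≤y z≤w = ≤-trans (+-monoˡ-≤ z x≤y) (+-monoʳ-≤ y z≤w)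

  x≤y⇒0≤y-x : x ≤ y → 0# ≤ y - x
  x≤y⇒0≤y-x {x} {y} x≤y = ≤-respˡ-≈ (-‿inverseʳ x) (+-monoˡ-≤ (- x) x≤y)

  0≤y-x⇒x≤y : 0# ≤ y - x → x ≤ y
  0≤y-x⇒x≤y {y} {x} 0≤ = ≤-respˡ-≈ (+-identityˡ x)
    (≤-respʳ-≈ (solve 2 (λ x y → y :- x :+ x := y) refl x y) (+-monoˡ-≤ x 0≤))

  ≤-by-difference : ∀ z → 0# ≤ z → y - x ≈ z → x ≤ y
  ≤-by-difference z 0≤z eq = 0≤y-x⇒x≤y (≤-respʳ-≈ (sym eq) 0≤z)

  *-monoˡ-≤ : 0# ≤ z → x ≤ y → z * x ≤ z * y
  *-monoˡ-≤ {z} {x} {y} 0≤z x≤y = ≤-by-difference _ (*-nonneg 0≤z (x≤y⇒0≤y-x x≤y))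
    (solve 3 (λ x y z → z :* y :- z :* x := z :* (y :- x)) refl x y z)

  *-monoʳ-≤ : 0# ≤ z → x ≤ y → x * z ≤ y * z
  *-monoʳ-≤ 0≤z x≤y = ≤-respˡ-≈ (*-comm _ _) (≤-respʳ-≈ (*-comm _ _) (*-monoˡ-≤ 0≤z x≤y))

  *-mono-≤ : 0# ≤ x → x ≤ y → 0# ≤ z → z ≤ w → x * z ≤ y * w
  *-mono-≤ 0≤x x≤y 0≤z z≤w = ≤-trans (*-monoʳ-≤ 0≤z x≤y) (*-monoˡ-≤ (≤-trans 0≤x x≤y) z≤w)

  +-nonneg : 0# ≤ x → 0# ≤ y → 0# ≤ x + y
  +-nonneg 0≤x 0≤y = ≤-respˡ-≈ (+-identityˡ 0#) (+-mono-≤ 0≤x 0≤y)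

  x≤x+y : 0# ≤ y → x ≤ x + y
  x≤x+y {y} {x} 0≤y = ≤-respˡ-≈ (+-identityʳ x) (+-monoʳ-≤ x 0≤y)

  neg-nonneg : x ≤ 0# → 0# ≤ - x
  neg-nonneg {x} x≤0 = ≤-respʳ-≈ (+-identityˡ (- x)) (x≤y⇒0≤y-x x≤0)

  0≤x² : ∀ x → 0# ≤ x * x
  0≤x² x with total 0# x
  ... | inj₁ 0≤x = *-nonneg 0≤x 0≤x
  ... | inj₂ x≤0 = ≤-respʳ-≈ (solve 1 (λ x → (:- x) :* (:- x) := x :* x) refl x)
                     (*-nonneg (neg-nonneg x≤0) (neg-nonneg x≤0))

  0≤1 : 0# ≤ 1#
  0≤1 = ≤-respʳ-≈ (*-identityˡ 1#) (0≤x² 1#)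

  0<1 : 0# < 1#
  0<1 = 0≤1 , 0≉1

  xy≈0⇒y≈0 : x ≉ 0# → x * y ≈ 0# → y ≈ 0#
  xy≈0⇒y≈0 {x} {y} x≉0 xy≈0 = begin-equality
    y                ≈⟨ *-identityˡ y ⟨
    1# * y           ≈⟨ *-congʳ (*-inverse x≉0) ⟨
    x * x ⁻¹ * y     ≈⟨ solve 3 (λ x i y → x :* i :* y := i :* (x :* y)) refl x (x ⁻¹) y ⟩
    x ⁻¹ * (x * y)   ≈⟨ *-congˡ xy≈0 ⟩
    x ⁻¹ * 0#        ≈⟨ zeroʳ _ ⟩
    0#               ∎

  *-cancelˡ-≈ : x ≉ 0# → x * y ≈ x * z → y ≈ z
  *-cancelˡ-≈ {x} {y} {z} x≉0 eq = begin-equality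
    y          ≈⟨ solve 2 (λ y z → y := y :- z :+ z) refl y z ⟩
    y - z + z  ≈⟨ +-congʳ (xy≈0⇒y≈0 x≉0 (trans (solve 3 (λ x y z → x :* (y :- z) := x :* y :- x :* z) refl x y z)
                    (trans (+-congʳ eq) (-‿inverseʳ _)))) ⟩
    0# + z     ≈⟨ +-identityˡ z ⟩
    z          ∎

  x²≈0⇒x≈0 : x * x ≈ 0# → x ≈ 0#
  x²≈0⇒x≈0 {x} x²≈0 with x ≈? 0#
  ... | yes x≈0 = x≈0
  ... | no x≉0  = xy≈0⇒y≈0 x≉0 x²≈0

  *-pos : 0# < x → 0# < y → 0# < x * y
  *-pos (0≤x , 0≉x) (0≤y , 0≉y) = *-nonneg 0≤x 0≤y , λ 0≈xy → 0≉y (sym (xy≈0⇒y≈0 (0≉x ∘ sym) (sym 0≈xy)))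

  +-pos : 0# ≤ x → 0# < y → 0# < x + y
  +-pos {x} {y} 0≤x 0<y = <-≤-trans 0<y (≤-respʳ-≈ (+-comm y x) (x≤x+y 0≤x))

  *-cancelˡ-≤ : 0# < z → z * x ≤ z * y → x ≤ y
  *-cancelˡ-≤ {z} {x} {y} 0<z zx≤zy with total x y
  ... | inj₁ x≤y = x≤y
  ... | inj₂ y≤x = ≤-reflexive (*-cancelˡ-≈ (<⇒≉ 0<z) (antisym zx≤zy (*-monoˡ-≤ (<⇒≤ 0<z) y≤x)))

  ⁻¹-pos : 0# < x → 0# < x ⁻¹
  ⁻¹-pos {x} 0<x with total 0# (x ⁻¹)
  ... | inj₁ 0≤ = 0≤ , λ 0≈ → 0≉1 (trans (sym (zeroʳ x)) (trans (*-congˡ 0≈) (*-inverse (<⇒≉ 0<x))))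
  ... | inj₂ ≤0 = ⊥-elim (0≉1 (antisym 0≤1 (begin
    1#          ≈⟨ *-inverse (<⇒≉ 0<x) ⟨
    x * x ⁻¹    ≤⟨ *-monoˡ-≤ (<⇒≤ 0<x) ≤0 ⟩
    x * 0#      ≈⟨ zeroʳ x ⟩
    0#          ∎)))

  /-cancel : y ≉ 0# → y * (x / y) ≈ x
  /-cancel {y} {x} y≉0 = begin-equality
    y * (x * y ⁻¹)  ≈⟨ solve 3 (λ x y i → y :* (x :* i) := y :* i :* x) refl x y (y ⁻¹) ⟩
    y * y ⁻¹ * x    ≈⟨ *-congʳ (*-inverse y≉0) ⟩
    1# * x          ≈⟨ *-identityˡ x ⟩
    x               ∎

  /-unique : y ≉ 0# → y * z ≈ x → x / y ≈ z
  /-unique y≉0 yz≈x = *-cancelˡ-≈ y≉0 (trans (/-cancel y≉0) (sym yz≈x))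

  ∑-mono∈ : ∀ (xs : List A) {f g} → (∀ {x} → x ∈ xs → f x ≤ g x) → ∑ xs f ≤ ∑ xs g
  ∑-mono∈ []       f≤g = ≤-refl
  ∑-mono∈ (x ∷ xs) f≤g = +-mono-≤ (f≤g (here ≡.refl)) (∑-mono∈ xs (f≤g ∘ there))

  ∑-mono : ∀ (xs : List A) {f g} → (∀ x → f x ≤ g x) → ∑ xs f ≤ ∑ xs g
  ∑-mono xs f≤g = ∑-mono∈ xs (λ {x} _ → f≤g x)

  ∑-nonneg : ∀ (xs : List A) {f} → (∀ x → 0# ≤ f x) → 0# ≤ ∑ xs f
  ∑-nonneg xs 0≤f = ≤-respˡ-≈ (∑-0 xs) (∑-mono xs 0≤f)

  ⟦⟧-nonneg : ∀ {p} {P : Set p} (P? : Dec P) → 0# ≤ ⟦ P? ⟧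
  ⟦⟧-nonneg (yes _) = 0≤1
  ⟦⟧-nonneg (no _)  = ≤-refl

  ⟦⟧-≤1 : ∀ {p} {P : Set p} (P? : Dec P) → ⟦ P? ⟧ ≤ 1#
  ⟦⟧-≤1 (yes _) = ≤-refl
  ⟦⟧-≤1 (no _)  = 0≤1

  ⟦⟧-mono : ∀ {p q} {P : Set p} {Q : Set q} (P? : Dec P) (Q? : Dec Q) → (P → Q) → ⟦ P? ⟧ ≤ ⟦ Q? ⟧
  ⟦⟧-mono (yes p) Q? P→Q = ≤-reflexive (sym (⟦⟧-yes Q? (P→Q p)))
  ⟦⟧-mono (no _)  Q? P→Q = ⟦⟧-nonneg Q?

  ∑-atMostOne : ∀ {p} {P : A → Set p} (P? : ∀ x → Dec (P x)) {xs : List A} → Unique xs →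
    (∀ {x y} → x ∈ xs → y ∈ xs → P x → P y → x ≡.≡ y) → ∑ xs (λ x → ⟦ P? x ⟧) ≤ 1#
  ∑-atMostOne P? [] _ = 0≤1
  ∑-atMostOne P? {x ∷ xs} (x∉xs ∷ xs!) unique with P? x
  ... | yes px = ≤-reflexive (trans (+-congˡ (trans
          (∑-cong∈ xs (λ {y} y∈ → ⟦⟧-no (P? y) (λ py → All.lookup x∉xs y∈ (unique (here ≡.refl) (there y∈) px py))))
          (∑-0 xs))) (+-identityʳ 1#))
  ... | no _   = ≤-respˡ-≈ (sym (+-identityˡ _)) (∑-atMostOne P? xs! (λ y∈ z∈ → unique (there y∈) (there z∈)))

  -- Averaging: it will provide a point whose removal destroys at least the expected share of the
  -- solutions.
  ∑-pigeonhole : ∀ (xs : List A) {f g : A → ℝ} → (∃ λ x → x ∈ xs) → ∑ xs f ≤ ∑ xs g →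
                 ∃ λ x → x ∈ xs × f x ≤ g x
  ∑-pigeonhole (x ∷ []) _ ∑≤ = x , here ≡.refl , ≤-respˡ-≈ (+-identityʳ _) (≤-respʳ-≈ (+-identityʳ _) ∑≤)
  ∑-pigeonhole (x ∷ xs@(y ∷ ys)) {f} {g} _ ∑≤ with f x ≤? g x | ∑-pigeonhole (y ∷ ys) {f} {g} (y , here ≡.refl)
  ... | yes fx≤gx | _   = x , here ≡.refl , fx≤gx
  ... | no  fx≰gx | rec with z , z∈ , fz≤gz ← rec (begin
    ∑ xs f               ≈⟨ solve 2 (λ a b → a := a :+ b :- b) refl (∑ xs f) (f x) ⟩
    ∑ xs f + f x - f x   ≤⟨ +-monoˡ-≤ (- f x) (≤-respˡ-≈ (+-comm _ _) (≤-trans ∑≤ (+-monoˡ-≤ _ (≰⇒≥ fx≰gx)))) ⟩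
    f x + ∑ xs g - f x   ≈⟨ solve 2 (λ a b → b :+ a :- b := a) refl (∑ xs g) (f x) ⟩
    ∑ xs g               ∎)
    = z , there z∈ , fz≤gz

  ι-+ : ∀ m n → ι (m ℕ.+ n) ≈ ι m + ι n
  ι-+ = ×-homo-+ 1#

  ι-* : ∀ m n → ι (m ℕ.* n) ≈ ι m * ι n
  ι-* = ×1-homo-*

  ι-nonneg : ∀ n → 0# ≤ ι n
  ι-nonneg zero    = ≤-refl
  ι-nonneg (suc n) = +-nonneg 0≤1 (ι-nonneg n)

  ι-mono : ∀ {m n} → m ℕ.≤ n → ι m ≤ ι n
  ι-mono {n = n} ℕ.z≤n = ι-nonneg n
  ι-mono {suc m} {suc n} (ℕ.s≤s m≤n) = +-monoʳ-≤ 1# (ι-mono {m} {n} m≤n)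

  ι1≈1 : ι 1 ≈ 1#
  ι1≈1 = +-identityʳ 1#

  1≤ι : ∀ {n} → 1 ℕ.≤ n → 1# ≤ ι n
  1≤ι {n} 1≤n = ≤-respˡ-≈ ι1≈1 (ι-mono {1} {n} 1≤n)

  ι-pos : ∀ {n} → 1 ℕ.≤ n → 0# < ι n
  ι-pos {n} 1≤n = <-≤-trans 0<1 (1≤ι {n} 1≤n)

  0<ι : ∀ n → 0# < ι (suc n)
  0<ι n = ι-pos {suc n} (ℕ.s≤s ℕ.z≤n)

  ι≉0 : ∀ n → ι (suc n) ≉ 0#
  ι≉0 n = <⇒≉ (0<ι n)

  ^ⁿ-pos : ∀ n → 0# < x → 0# < x ^ⁿ n
  ^ⁿ-pos zero    0<x = 0<1
  ^ⁿ-pos (suc n) 0<x = *-pos 0<x (^ⁿ-pos n 0<x)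

  ^ⁿ-nonneg : ∀ n → 0# ≤ x → 0# ≤ x ^ⁿ n
  ^ⁿ-nonneg zero    0≤x = 0≤1
  ^ⁿ-nonneg (suc n) 0≤x = *-nonneg 0≤x (^ⁿ-nonneg n 0≤x)

  ^ⁿ-monoˡ-≤ : ∀ n → 0# ≤ x → x ≤ y → x ^ⁿ n ≤ y ^ⁿ n
  ^ⁿ-monoˡ-≤ zero    0≤x x≤y = ≤-refl
  ^ⁿ-monoˡ-≤ (suc n) 0≤x x≤y = *-mono-≤ 0≤x x≤y (^ⁿ-nonneg n 0≤x) (^ⁿ-monoˡ-≤ n 0≤x x≤y)

  1≤^ⁿ : ∀ n → 1# ≤ x → 1# ≤ x ^ⁿ n
  1≤^ⁿ zero    1≤x = ≤-refl
  1≤^ⁿ (suc n) 1≤x = ≤-respˡ-≈ (*-identityˡ 1#) (*-mono-≤ 0≤1 1≤x 0≤1 (1≤^ⁿ n 1≤x))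

  *-^ⁿ : ∀ x y n → (x * y) ^ⁿ n ≈ x ^ⁿ n * y ^ⁿ n
  *-^ⁿ x y zero    = sym (*-identityˡ 1#)
  *-^ⁿ x y (suc n) = trans (*-congˡ (*-^ⁿ x y n))
    (solve 4 (λ x y a b → x :* y :* (a :* b) := x :* a :* (y :* b)) refl x y _ _)

  ^-0 : 0# < x → x ^ 0# ≈ 1#
  ^-0 {x} 0<x = *-cancelˡ-≈ (<⇒≉ (^-pos 0# 0<x)) (begin-equality
    x ^ 0# * x ^ 0#  ≈⟨ ^-distribˡ-+ 0# 0# 0<x ⟨
    x ^ (0# + 0#)    ≈⟨ ^-cong refl (+-identityˡ 0#) ⟩
    x ^ 0#           ≈⟨ *-identityʳ _ ⟨
    x ^ 0# * 1#      ∎)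

  ^-ι : ∀ n → 0# < x → x ^ ι n ≈ x ^ⁿ n
  ^-ι zero    0<x = ^-0 0<x
  ^-ι {x} (suc n) 0<x = begin-equality
    x ^ (1# + ι n)    ≈⟨ ^-distribˡ-+ 1# (ι n) 0<x ⟩
    x ^ 1# * x ^ ι n  ≈⟨ *-cong (^-identityʳ 0<x) (^-ι n 0<x) ⟩
    x * x ^ⁿ n        ∎

  ^-neg : ∀ r → 0# < x → x ^ r * x ^ (- r) ≈ 1#
  ^-neg {x} r 0<x = begin-equality
    x ^ r * x ^ (- r)  ≈⟨ ^-distribˡ-+ r (- r) 0<x ⟨
    x ^ (r - r)        ≈⟨ ^-cong refl (-‿inverseʳ r) ⟩
    x ^ 0#             ≈⟨ ^-0 0<x ⟩
    1#                 ∎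

  1≤^ : ∀ {r} → 1# ≤ x → 0# ≤ r → 1# ≤ x ^ r
  1≤^ {x} 1≤x 0≤r = ≤-respˡ-≈ (^-0 (<-≤-trans 0<1 1≤x)) (^-monoʳ-≤ 1≤x 0≤r)

  -- The axioms give monotonicity in the exponent. It is applied to the base `y / x`, which is at
  -- least 1, and y^r = x^r (y/x)^r transfers it.
  ^-monoˡ-≤ : ∀ {r} → 0# ≤ r → 0# < x → x ≤ y → x ^ r ≤ y ^ r
  ^-monoˡ-≤ {x} {y} {r} 0≤r 0<x x≤y = begin
    x ^ r                ≈⟨ *-identityʳ _ ⟨
    x ^ r * 1#           ≤⟨ *-monoˡ-≤ (<⇒≤ (^-pos r 0<x)) (1≤^ 1≤y/x 0≤r) ⟩
    x ^ r * (y / x) ^ r  ≈⟨ ^-distribʳ-* r 0<x (<-≤-trans 0<1 1≤y/x) ⟨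
    (x * (y / x)) ^ r    ≈⟨ ^-cong (/-cancel (<⇒≉ 0<x)) refl ⟩
    y ^ r                ∎
    where
    1≤y/x : 1# ≤ y / x
    1≤y/x = *-cancelˡ-≤ 0<x (begin
      x * 1#       ≈⟨ *-identityʳ x ⟩
      x            ≤⟨ x≤y ⟩
      y            ≈⟨ /-cancel (<⇒≉ 0<x) ⟨
      x * (y / x)  ∎)

  -- Admits the base 0, since the Fourier norm of a set may vanish; there the power is specified for
  -- positive exponents only, hence the strict hypothesis on `r`.
  ^-monoˡ-≤′ : ∀ {r} → 0# < r → 0# ≤ x → 0# < y → x ≤ y → x ^ r ≤ y ^ r
  ^-monoˡ-≤′ {x} {y} {r} 0<r 0≤x 0<y x≤y with x ≈? 0#
  ... | yes x≈0 = ≤-respˡ-≈ (trans (sym (0^ 0<r)) (^-cong (sym x≈0) refl)) (<⇒≤ (^-pos r 0<y))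
  ... | no x≉0  = ^-monoˡ-≤ (<⇒≤ 0<r) (0≤x , x≉0 ∘ sym) x≤y

  1/-pos : ∀ n → 0# < ι 1 / ι (suc n)
  1/-pos n = *-pos (0<ι 0) (⁻¹-pos (0<ι n))

  *-1/ : ∀ n → ι (suc n) * (ι 1 / ι (suc n)) ≈ 1#
  *-1/ n = trans (/-cancel (ι≉0 n)) ι1≈1

  ^ⁿ-root : ∀ n → 0# < x → (x ^ⁿ suc n) ^ (ι 1 / ι (suc n)) ≈ x
  ^ⁿ-root {x} n 0<x = begin-equality
    (x ^ⁿ suc n) ^ (ι 1 / ι (suc n))     ≈⟨ ^-cong (^-ι (suc n) 0<x) refl ⟨
    (x ^ ι (suc n)) ^ (ι 1 / ι (suc n))  ≈⟨ ^-*-assoc _ _ 0<x ⟩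
    x ^ (ι (suc n) * (ι 1 / ι (suc n)))  ≈⟨ ^-cong refl (*-1/ n) ⟩
    x ^ 1#                               ≈⟨ ^-identityʳ 0<x ⟩
    x                                    ∎

  root-^ⁿ : ∀ n → 0# ≤ x → (x ^ (ι 1 / ι (suc n))) ^ⁿ suc n ≈ x
  root-^ⁿ {x} n 0≤x with x ≈? 0#
  ... | yes x≈0 = begin-equality
    (x ^ (ι 1 / ι (suc n))) ^ⁿ suc n   ≈⟨ ^ⁿ-congˡ (suc n) (trans (^-cong x≈0 refl) (0^ (1/-pos n))) ⟩
    0# * 0# ^ⁿ n                       ≈⟨ zeroˡ _ ⟩
    0#                                 ≈⟨ x≈0 ⟨
    x                                  ∎
  ... | no x≉0 = begin-equality
    (x ^ (ι 1 / ι (suc n))) ^ⁿ suc n   ≈⟨ ^-ι (suc n) (^-pos _ 0<x) ⟨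
    (x ^ (ι 1 / ι (suc n))) ^ ι (suc n) ≈⟨ ^-*-assoc _ _ 0<x ⟩
    x ^ ((ι 1 / ι (suc n)) * ι (suc n)) ≈⟨ ^-cong refl (trans (*-comm _ _) (*-1/ n)) ⟩
    x ^ 1#                             ≈⟨ ^-identityʳ 0<x ⟩
    x                                  ∎
    where
    0<x : 0# < x
    0<x = 0≤x , x≉0 ∘ sym

-- Complex numbers as a commutative ring with a multiplicative norm.

module ComplexProperties (R : Reals) where

  open Reals R
  open Complex R
  open RealProperties R
  open ≤-Reasoning

  private variable
    a : Level
    A : Set a

  -ᶜ_ : ℂ → ℂ
  -ᶜ z = (- re z) +i (- im z)

  ℂ-commutativeRing : CommutativeRing 0ℓ 0ℓ
  ℂ-commutativeRing = record
    { Carrier = ℂ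
    ; _≈_ = _≈ᶜ_
    ; _+_ = _+ᶜ_
    ; _*_ = _*ᶜ_
    ; -_  = -ᶜ_
    ; 0#  = 0ᶜ
    ; 1#  = 1ᶜ
    ; isCommutativeRing = record
      { isRing = record
        { +-isAbelianGroup = record
          { isGroup = record
            { isMonoid = record
              { isSemigroup = record
                { isMagma = record
                  { isEquivalence = record
                    { refl  = refl , refl
                    ; sym   = λ (p , q) → sym p , sym q
                    ; trans = λ (p , q) (r , s) → trans p r , trans q s
                    }
                  ; ∙-cong = λ (p , q) (r , s) → +-cong p r , +-cong q s
                  }
                ; assoc = λ _ _ _ → +-assoc _ _ _ , +-assoc _ _ _
                }
              ; identity = (λ _ → +-identityˡ _ , +-identityˡ _) , (λ _ → +-identityʳ _ , +-identityʳ _)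
              }
            ; inverse = (λ _ → -‿inverseˡ _ , -‿inverseˡ _) , (λ _ → -‿inverseʳ _ , -‿inverseʳ _)
            ; ⁻¹-cong = λ (p , q) → -‿cong p , -‿cong q
            }
          ; comm = λ _ _ → +-comm _ _ , +-comm _ _
          }
        ; *-cong = λ (p , q) (r , s) →
            +-cong (*-cong p r) (-‿cong (*-cong q s)) , +-cong (*-cong p s) (*-cong q r)
        ; *-assoc = λ (a +i b) (c +i d) (e +i f) →
            solve 6 (λ a b c d e f →
              (a :* c :- b :* d) :* e :- (a :* d :+ b :* c) :* f :=
              a :* (c :* e :- d :* f) :- b :* (c :* f :+ d :* e)) refl a b c d e f ,
            solve 6 (λ a b c d e f →
              (a :* c :- b :* d) :* f :+ (a :* d :+ b :* c) :* e :=
              a :* (c :* f :+ d :* e) :+ b :* (c :* e :- d :* f)) refl a b c d e f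
        ; *-identity =
            (λ (a +i b) →
              solve 2 (λ a b → :1 :* a :- :0 :* b := a) refl a b ,
              solve 2 (λ a b → :1 :* b :+ :0 :* a := b) refl a b) ,
            (λ (a +i b) →
              solve 2 (λ a b → a :* :1 :- b :* :0 := a) refl a b ,
              solve 2 (λ a b → a :* :0 :+ b :* :1 := b) refl a b)
        ; distrib =
            (λ (a +i b) (c +i d) (e +i f) →
              solve 6 (λ a b c d e f → a :* (c :+ e) :- b :* (d :+ f) :=
                a :* c :- b :* d :+ (a :* e :- b :* f)) refl a b c d e f ,
              solve 6 (λ a b c d e f → a :* (d :+ f) :+ b :* (c :+ e) :=
                a :* d :+ b :* c :+ (a :* f :+ b :* e)) refl a b c d e f) ,
            (λ (a +i b) (c +i d) (e +i f) →
              solve 6 (λ a b c d e f → (c :+ e) :* a :- (d :+ f) :* b :=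
                c :* a :- d :* b :+ (e :* a :- f :* b)) refl a b c d e f ,
              solve 6 (λ a b c d e f → (c :+ e) :* b :+ (d :+ f) :* a :=
                c :* b :+ d :* a :+ (e :* b :+ f :* a)) refl a b c d e f)
        }
      ; *-comm = λ (a +i b) (c +i d) →
          solve 4 (λ a b c d → a :* c :- b :* d := c :* a :- d :* b) refl a b c d ,
          solve 4 (λ a b c d → a :* d :+ b :* c := c :* b :+ d :* a) refl a b c d
      }
    }

  module ℂ-Ring = CommutativeRing ℂ-commutativeRing
  module ℂ-Sums = Sums ℂ-commutativeRing
  module ℂ-Solver = IntegerSolver ℂ-commutativeRing

  conj : ℂ → ℂ
  conj z = re z +i (- im z)

  norm² : ℂ → ℝ
  norm² z = re z * re z + im z * im z

  embed : ℝ → ℂ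
  embed x = x +i 0#

  conj-∑ : ∀ (xs : List A) f → conj (ℂ-Sums.∑ xs f) ≈ᶜ ℂ-Sums.∑ xs (conj ∘ f)
  conj-∑ []       f = refl , solve 0 (:- :0 := :0) refl
  conj-∑ (x ∷ xs) f = +-congˡ (proj₁ (conj-∑ xs f)) ,
    trans (solve 2 (λ a b → :- (a :+ b) := :- a :+ :- b) refl _ _) (+-congˡ (proj₂ (conj-∑ xs f)))

  embed-cong : ∀ {x y} → x ≈ y → embed x ≈ᶜ embed y
  embed-cong eq = eq , refl

  embed-+ : ∀ x y → embed (x + y) ≈ᶜ embed x +ᶜ embed y
  embed-+ x y = refl , sym (+-identityˡ 0#)

  embed-neg : ∀ x → embed (- x) ≈ᶜ -ᶜ embed x
  embed-neg x = refl , solve 0 (:0 := :- :0) refl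

  embed-* : ∀ x y → embed (x * y) ≈ᶜ embed x *ᶜ embed y
  embed-* x y =
    solve 2 (λ x y → x :* y := x :* y :- :0 :* :0) refl x y ,
    solve 2 (λ x y → :0 := x :* :0 :+ :0 :* y) refl x y

  embed-∑ : ∀ (xs : List A) f → embed (∑ xs f) ≈ᶜ ℂ-Sums.∑ xs (embed ∘ f)
  embed-∑ []       f = refl , refl
  embed-∑ (x ∷ xs) f = ℂ-Ring.trans (embed-+ _ _) (ℂ-Ring.+-congˡ (embed-∑ xs f))

  embed-⟦⟧ : ∀ {p} {P : Set p} (P? : Dec P) → embed ⟦ P? ⟧ ≈ᶜ ℂ-Sums.⟦ P? ⟧
  embed-⟦⟧ (yes _) = refl , refl
  embed-⟦⟧ (no _)  = refl , refl

  z*conj[z] : ∀ z → z *ᶜ conj z ≈ᶜ embed (norm² z)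
  z*conj[z] (a +i b) =
    solve 2 (λ a b → a :* a :- b :* (:- b) := a :* a :+ b :* b) refl a b ,
    solve 2 (λ a b → a :* (:- b) :+ b :* a := :0) refl a b

  norm²-cong : ∀ {z w} → z ≈ᶜ w → norm² z ≈ norm² w
  norm²-cong (p , q) = +-cong (*-cong p p) (*-cong q q)

  norm²-nonneg : ∀ z → 0# ≤ norm² z
  norm²-nonneg z = +-nonneg (0≤x² (re z)) (0≤x² (im z))

  norm²-* : ∀ z w → norm² (z *ᶜ w) ≈ norm² z * norm² w
  norm²-* (a +i b) (c +i d) = solve 4 (λ a b c d →
    (a :* c :- b :* d) :* (a :* c :- b :* d) :+ (a :* d :+ b :* c) :* (a :* d :+ b :* c) :=
    (a :* a :+ b :* b) :* (c :* c :+ d :* d)) refl a b c d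

  norm²-embed : ∀ x → norm² (embed x) ≈ x * x
  norm²-embed x = solve 1 (λ x → x :* x :+ :0 :* :0 := x :* x) refl x

  norm²-• : ∀ x z → norm² (x • z) ≈ x * x * norm² z
  norm²-• x (a +i b) = solve 3 (λ x a b → x :* a :* (x :* a) :+ x :* b :* (x :* b) :=
    x :* x :* (a :* a :+ b :* b)) refl x a b

  norm²≈0⇒≈0 : ∀ z → norm² z ≈ 0# → z ≈ᶜ 0ᶜ
  norm²≈0⇒≈0 (a +i b) eq =
    x²≈0⇒x≈0 (antisym (≤-respʳ-≈ eq (x≤x+y (0≤x² b))) (0≤x² a)) ,
    x²≈0⇒x≈0 (antisym (≤-respʳ-≈ (trans (+-comm _ _) eq) (x≤x+y (0≤x² a))) (0≤x² b))

  -- Even powers of `abs` are polynomial in the coordinates, so the square root in its definition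
  -- disappears from the fourth moment.
  abs^4 : ∀ z → abs z ^ⁿ 4 ≈ norm² z * norm² z
  abs^4 z = begin-equality
    abs z ^ⁿ 4                  ≈⟨ solve 1 (λ a → a :* (a :* (a :* (a :* :1))) := a :* (a :* :1) :* (a :* (a :* :1))) refl (abs z) ⟩
    abs z ^ⁿ 2 * abs z ^ⁿ 2     ≈⟨ *-cong (root-^ⁿ 1 (norm²-nonneg z)) (root-^ⁿ 1 (norm²-nonneg z)) ⟩
    norm² z * norm² z           ∎

  abs≈1⇒norm²≈1 : ∀ z → abs z ≈ 1# → norm² z ≈ 1#
  abs≈1⇒norm²≈1 z eq = begin-equality
    norm² z            ≈⟨ root-^ⁿ 1 (norm²-nonneg z) ⟨
    abs z ^ⁿ 2         ≈⟨ ^ⁿ-congˡ 2 eq ⟩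
    1# * (1# * 1#)     ≈⟨ trans (*-identityˡ _) (*-identityˡ _) ⟩
    1#                 ∎

  -- The squared norm is multiplicative and vanishes only at 0, which reduces the claim to the
  -- reals.
  zw≈0⇒w≈0 : ∀ {z w} → ¬ (z ≈ᶜ 0ᶜ) → z *ᶜ w ≈ᶜ 0ᶜ → w ≈ᶜ 0ᶜ
  zw≈0⇒w≈0 {z} {w} z≉0 zw≈0 = norm²≈0⇒≈0 w
    (xy≈0⇒y≈0 (z≉0 ∘ norm²≈0⇒≈0 z) (begin-equality
      norm² z * norm² w    ≈⟨ norm²-* z w ⟨
      norm² (z *ᶜ w)       ≈⟨ norm²-cong zw≈0 ⟩
      norm² 0ᶜ             ≈⟨ norm²-embed 0# ⟩
      0# * 0#              ≈⟨ zeroˡ 0# ⟩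
      0#                   ∎))

-- Character sums with values in a commutative ring.

module RingCharacters (F : FiniteField) (𝕂 : CommutativeRing 0ℓ 0ℓ) where

  private
    module 𝔽 = FiniteField F
    module K = CommutativeRing 𝕂

  -- The values of the character lie in an arbitrary commutative ring, in which
  -- complex conjugation is replaced by χ (- x).
  record RingCharacter : Set where
    field
      χ   : 𝔽.Carrier → K.Carrier
      χ-0 : χ 𝔽.0# K.≈ K.1#
      χ-+ : ∀ x y → χ (x 𝔽.+ y) K.≈ χ x K.* χ y
      ∑-χ : Sums.∑ 𝕂 𝔽.elements χ K.≈ K.0#

module CharacterSums (F : FiniteField) (𝕂 : CommutativeRing 0ℓ 0ℓ) (character : RingCharacters.RingCharacter F 𝕂) where

  private module K = CommutativeRing 𝕂
  open RingCharacters F 𝕂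
  open RingCharacter character
  open K using () renaming (_≈_ to _≈ᶜ_; _+_ to _+ᶜ_; _*_ to _*ᶜ_; -_ to -ᶜ_; 0# to 0ᶜ; 1# to 1ᶜ)
  open Sums 𝕂
  open FiniteField F hiding (_-_)
  open Geometry F hiding (_∈_)
  open FieldProperties F
  open GeometryProperties F
  open IntegerSolver commutativeRing
  open IntegerSolver 𝕂 using () renaming (solve to solveᶜ; _:+_ to _⊕_; _:*_ to _⊗_; _:-_ to _⊝_; :-_ to ⊝_; _:=_ to _⊜_; :1 to 1ᴾ)
  open import Algebra.Properties.CommutativeSemigroup K.*-commutativeSemigroup using () renaming (interchange to *-interchange)
  open import Algebra.Properties.Semiring.Exp semiring using (^-homo-*)
  open import Algebra.Properties.Semiring.Mult K.semiring using () renaming (_×_ to _×ᶜ_)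
  open import Algebra.Properties.Semiring.Exp K.semiring using () renaming (_^_ to _^ᶜ_; ^-congˡ to ^ᶜ-congˡ; ^-homo-* to ^ᶜ-homo-*)
  open import Data.List.Membership.Propositional using (_∈_)
  open import Data.Product.Properties using (≡-dec)
  open import Relation.Binary.Reasoning.Setoid K.setoid

  private variable
    a : Level
    A : Set a
    d : ℕ

  q : K.Carrier
  q = order ×ᶜ 1ᶜ

  χ-cong : ∀ {x y} → x ≡ y → χ x ≈ᶜ χ y
  χ-cong x≡y = K.reflexive (≡.cong χ x≡y)

  ∑-χ-* : ∀ b → ∑ elements (λ a → χ (a * b)) ≈ᶜ q *ᶜ ⟦ b ≟ 0# ⟧
  ∑-χ-* b with b ≟ 0#
  ... | yes b≡0 = begin
    ∑ elements (λ a → χ (a * b))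
      ≈⟨ ∑-cong elements (λ a → K.trans (χ-cong (≡.trans (≡.cong (a *_) b≡0) (zeroʳ a))) χ-0) ⟩
    ∑ elements (const 1ᶜ)         ≈⟨ ∑-length elements ⟩
    List.length elements ×ᶜ 1ᶜ     ≡⟨ ≡.cong (_×ᶜ 1ᶜ) length-elements ⟩
    q                              ≈⟨ K.trans (K.*-congˡ (⟦⟧-yes (b ≟ 0#) b≡0)) (K.*-identityʳ q) ⟨
    q *ᶜ ⟦ b ≟ 0# ⟧               ∎
  ... | no b≢0 = begin
    ∑ elements (λ a → χ (a * b))  ≈⟨ ∑-cong elements (λ a → χ-cong (*-comm a b)) ⟩
    ∑ elements (λ a → χ (b * a))  ≈⟨ ∑-dilate 𝕂 b≢0 χ ⟩
    ∑ elements χ                  ≈⟨ ∑-χ ⟩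
    0ᶜ                             ≈⟨ K.trans (K.*-congˡ (⟦⟧-no (b ≟ 0#) b≢0)) (K.zeroʳ q) ⟨
    q *ᶜ ⟦ b ≟ 0# ⟧               ∎

  ∑-χ-· : ∀ (u : Point d) → ∑ (points d) (λ w → χ (w · u)) ≈ᶜ q ^ᶜ d *ᶜ ⟦ u ≟ᵖ 0ᵖ ⟧
  ∑-χ-· {zero} [] = K.trans (K.+-identityʳ _) (K.trans χ-0 (K.sym (K.*-identityʳ 1ᶜ)))
  ∑-χ-· {suc d} (b ∷ u) = begin
    ∑ (points (suc d)) (λ w → χ (w · (b ∷ u)))
      ≈⟨ ∑-cartesianProductWith _∷_ elements (points d) (λ w → χ (w · (b ∷ u))) ⟩
    ∑ elements (λ a → ∑ (points d) (λ w → χ (a * b + w · u)))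
      ≈⟨ ∑-cong elements (λ a → ∑-cong (points d) (λ w → χ-+ (a * b) (w · u))) ⟩
    ∑ elements (λ a → ∑ (points d) (λ w → χ (a * b) *ᶜ χ (w · u)))
      ≈⟨ ∑-*-∑ elements (points d) _ _ ⟨
    ∑ elements (λ a → χ (a * b)) *ᶜ ∑ (points d) (λ w → χ (w · u))
      ≈⟨ K.*-cong (∑-χ-* b) (∑-χ-· u) ⟩
    (q *ᶜ ⟦ b ≟ 0# ⟧) *ᶜ (q ^ᶜ d *ᶜ ⟦ u ≟ᵖ 0ᵖ ⟧)
      ≈⟨ *-interchange _ _ _ _ ⟩
    (q *ᶜ q ^ᶜ d) *ᶜ (⟦ b ≟ 0# ⟧ *ᶜ ⟦ u ≟ᵖ 0ᵖ ⟧)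
      ≈⟨ K.*-congˡ (K.trans (K.sym (⟦⟧-× (b ≟ 0#) (u ≟ᵖ 0ᵖ)))
           (⟦⟧-cong (b ≟ 0# ×-dec u ≟ᵖ 0ᵖ) ((b ∷ u) ≟ᵖ 0ᵖ) (λ (p , r) → ≡.cong₂ _∷_ p r) Vec.∷-injective)) ⟩
    q ^ᶜ suc d *ᶜ ⟦ (b ∷ u) ≟ᵖ 0ᵖ ⟧ ∎

  module _ (I : List A) (v : A → Point d) where

    expSum expSum⁻ : Point d → K.Carrier
    expSum  w = ∑ I (λ i → χ (w · v i))
    expSum⁻ w = ∑ I (λ i → χ (- (w · v i)))

    ∣expSum∣² : Point d → K.Carrier
    ∣expSum∣² w = expSum w *ᶜ expSum⁻ w

    ∣expSum∣²-expand : ∀ w → ∣expSum∣² w ≈ᶜ ∑ I (λ i → ∑ I (λ j → χ (w · (v i -ᵖ v j))))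
    ∣expSum∣²-expand w = begin
      ∣expSum∣² w
        ≈⟨ ∑-*-∑ I I _ _ ⟩
      ∑ I (λ i → ∑ I (λ j → χ (w · v i) *ᶜ χ (- (w · v j))))
        ≈⟨ ∑-cong I (λ i → ∑-cong I (λ j →
             K.trans (K.sym (χ-+ _ _)) (χ-cong (≡.sym (·-distribˡ-- w (v i) (v j)))))) ⟩
      ∑ I (λ i → ∑ I (λ j → χ (w · (v i -ᵖ v j)))) ∎

    ∑-weighted-∣expSum∣² : ∀ (κ : Point d → K.Carrier) →
      ∑ (points d) (λ w → κ w *ᶜ ∣expSum∣² w) ≈ᶜ
      ∑ I (λ i → ∑ I (λ j → ∑ (points d) (λ w → κ w *ᶜ χ (w · (v i -ᵖ v j)))))
    ∑-weighted-∣expSum∣² κ = begin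
      ∑ (points d) (λ w → κ w *ᶜ ∣expSum∣² w)
        ≈⟨ ∑-cong (points d) (λ w → K.trans (K.*-congˡ (∣expSum∣²-expand w))
             (K.trans (*-∑ I (κ w) _) (∑-cong I (λ i → *-∑ I (κ w) _)))) ⟩
      ∑ (points d) (λ w → ∑ I (λ i → ∑ I (λ j → κ w *ᶜ χ (w · (v i -ᵖ v j)))))
        ≈⟨ ∑-swap (points d) I _ ⟩
      ∑ I (λ i → ∑ (points d) (λ w → ∑ I (λ j → κ w *ᶜ χ (w · (v i -ᵖ v j)))))
        ≈⟨ ∑-cong I (λ i → ∑-swap (points d) I _) ⟩
      ∑ I (λ i → ∑ I (λ j → ∑ (points d) (λ w → κ w *ᶜ χ (w · (v i -ᵖ v j))))) ∎

    coincidences : K.Carrier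
    coincidences = ∑ I (λ i → ∑ I (λ j → ⟦ v i ≟ᵖ v j ⟧))

    -- The family `v` may repeat points. By orthogonality a pair of indices contributes exactly if
    -- their points agree, so repetitions enter with the square of their multiplicity.
    plancherel : ∑ (points d) ∣expSum∣² ≈ᶜ q ^ᶜ d *ᶜ coincidences
    plancherel = begin
      ∑ (points d) ∣expSum∣²
        ≈⟨ ∑-cong (points d) ∣expSum∣²-expand ⟩
      ∑ (points d) (λ w → ∑ I (λ i → ∑ I (λ j → χ (w · (v i -ᵖ v j)))))
        ≈⟨ ∑-swap (points d) I _ ⟩
      ∑ I (λ i → ∑ (points d) (λ w → ∑ I (λ j → χ (w · (v i -ᵖ v j)))))
        ≈⟨ ∑-cong I (λ i → ∑-swap (points d) I _) ⟩
      ∑ I (λ i → ∑ I (λ j → ∑ (points d) (λ w → χ (w · (v i -ᵖ v j)))))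
        ≈⟨ ∑-cong I (λ i → ∑-cong I (λ j → inner i j)) ⟩
      ∑ I (λ i → ∑ I (λ j → q ^ᶜ d *ᶜ ⟦ v i ≟ᵖ v j ⟧))
        ≈⟨ K.trans (*-∑ I _ _) (∑-cong I (λ i → *-∑ I _ _)) ⟨
      q ^ᶜ d *ᶜ coincidences ∎
      where
      inner : ∀ i j → ∑ (points d) (λ w → χ (w · (v i -ᵖ v j))) ≈ᶜ q ^ᶜ d *ᶜ ⟦ v i ≟ᵖ v j ⟧
      inner i j = K.trans (∑-χ-· (v i -ᵖ v j)) (K.*-congˡ
        (⟦⟧-cong (v i -ᵖ v j ≟ᵖ 0ᵖ) (v i ≟ᵖ v j)
          (x-y≡0⇒x≡y (v i) (v j)) (λ eq → ≡.trans (≡.cong (_-ᵖ v j) eq) (-ᵖ-self (v j)))))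

  -- Quadratic Gauss sums.

  G : Carrier → K.Carrier
  G t = ∑ elements (λ a → χ (t * (a * a)))

  -- The linear coefficient is given in the form 2tc, so that the square is completed to t (a + c)²
  -- without a division; the division by 2t is made once, where the lemma is applied.
  G-complete-square : ∀ t c → ∑ elements (λ a → χ (t * (a * a) + a * (2# * t * c))) ≈ᶜ G t *ᶜ χ (- (t * (c * c)))
  G-complete-square t c = begin
    ∑ elements (λ a → χ (t * (a * a) + a * (2# * t * c)))
      ≈⟨ ∑-cong elements (λ a → K.trans (χ-cong (square a)) (χ-+ _ _)) ⟩
    ∑ elements (λ a → χ (t * ((a + c) * (a + c))) *ᶜ χ (- (t * (c * c))))
      ≈⟨ ∑-translate 𝕂 c (λ a → χ (t * (a * a)) *ᶜ χ (- (t * (c * c)))) ⟩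
    ∑ elements (λ a → χ (t * (a * a)) *ᶜ χ (- (t * (c * c))))
      ≈⟨ ∑-* elements _ _ ⟨
    G t *ᶜ χ (- (t * (c * c))) ∎
    where
    square : ∀ a → t * (a * a) + a * (2# * t * c) ≡ t * ((a + c) * (a + c)) - t * (c * c)
    square a = solve 3 (λ t a c → t :* (a :* a) :+ a :* ((:1 :+ :1) :* t :* c) :=
      t :* ((a :+ c) :* (a :+ c)) :- t :* (c :* c)) ≡.refl t a c

  G-complete-squares : ∀ t (c : Point d) →
    ∑ (points d) (λ w → χ (t * ∥ w ∥ + w · ((2# * t) ⊛ c))) ≈ᶜ G t ^ᶜ d *ᶜ χ (- (t * ∥ c ∥))
  G-complete-squares {zero} t [] = K.trans (K.+-identityʳ _) (K.trans
    (χ-cong (solve 1 (λ t → t :* :0 :+ :0 := :- (t :* :0)) ≡.refl t)) (K.sym (K.*-identityˡ _)))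
  G-complete-squares {suc d} t (b ∷ c) = begin
    ∑ (points (suc d)) (λ w → χ (t * ∥ w ∥ + w · ((2# * t) ⊛ (b ∷ c))))
      ≈⟨ ∑-cartesianProductWith _∷_ elements (points d) (λ w → χ (t * ∥ w ∥ + w · ((2# * t) ⊛ (b ∷ c)))) ⟩
    ∑ elements (λ a → ∑ (points d) (λ w → χ (t * (a ^ 2 + ∥ w ∥) + (a * (2# * t * b) + w · ((2# * t) ⊛ c)))))
      ≈⟨ ∑-cong elements (λ a → ∑-cong (points d) (λ w →
           K.trans (χ-cong (regroup a ∥ w ∥ _ _)) (χ-+ _ _))) ⟩
    ∑ elements (λ a → ∑ (points d) (λ w → χ (t * (a * a) + a * (2# * t * b)) *ᶜ χ (t * ∥ w ∥ + w · ((2# * t) ⊛ c))))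
      ≈⟨ ∑-*-∑ elements (points d) _ _ ⟨
    ∑ elements (λ a → χ (t * (a * a) + a * (2# * t * b))) *ᶜ ∑ (points d) (λ w → χ (t * ∥ w ∥ + w · ((2# * t) ⊛ c)))
      ≈⟨ K.*-cong (G-complete-square t b) (G-complete-squares t c) ⟩
    (G t *ᶜ χ (- (t * (b * b)))) *ᶜ (G t ^ᶜ d *ᶜ χ (- (t * ∥ c ∥)))
      ≈⟨ solveᶜ 4 (λ x y z w → (x ⊗ y) ⊗ (z ⊗ w) ⊜ (x ⊗ z) ⊗ (y ⊗ w)) K.refl (G t) _ _ _ ⟩
    (G t *ᶜ G t ^ᶜ d) *ᶜ (χ (- (t * (b * b))) *ᶜ χ (- (t * ∥ c ∥)))
      ≈⟨ K.*-congˡ (K.trans (K.sym (χ-+ _ _)) (χ-cong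
           (solve 3 (λ t b u → :- (t :* (b :* b)) :+ :- (t :* u) := :- (t :* (b :* (b :* :1) :+ u))) ≡.refl t b ∥ c ∥))) ⟩
    G t ^ᶜ suc d *ᶜ χ (- (t * ∥ b ∷ c ∥)) ∎
    where
    regroup : ∀ a u v w → t * (a ^ 2 + u) + (v + w) ≡ (t * (a * a) + v) + (t * u + w)
    regroup a u v w = solve 5 (λ t a u v w → t :* (a :* (a :* :1) :+ u) :+ (v :+ w) :=
      (t :* (a :* a) :+ v) :+ (t :* u :+ w)) ≡.refl t a u v w

  G-square : ∀ t {h} → h ≢ 0# → G (t * (h * h)) ≈ᶜ G t
  G-square t {h} h≢0 = K.trans
    (∑-cong elements (λ a → χ-cong (solve 3 (λ t h a → t :* (h :* h) :* (a :* a) := t :* (h :* a :* (h :* a))) ≡.refl t h a)))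
    (∑-dilate 𝕂 h≢0 (λ a → χ (t * (a * a))))

  -- This is |G|² = q. After the translation of `a` by `b` the terms in b² cancel, and the sum over
  -- `b`, now linear in the exponent, leaves only `a = 0`.
  G-conj : ∀ {t} → t ≢ 0# → G t *ᶜ G (- t) ≈ᶜ q
  G-conj {t} t≢0 = begin
    G t *ᶜ G (- t)
      ≈⟨ ∑-*-∑ elements elements _ _ ⟩
    ∑ elements (λ a → ∑ elements (λ b → χ (t * (a * a)) *ᶜ χ (- t * (b * b))))
      ≈⟨ ∑-swap elements elements _ ⟩
    ∑ elements (λ b → ∑ elements (λ a → χ (t * (a * a)) *ᶜ χ (- t * (b * b))))
      ≈⟨ ∑-cong elements (λ b → ∑-translate 𝕂 b (λ a → χ (t * (a * a)) *ᶜ χ (- t * (b * b)))) ⟨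
    ∑ elements (λ b → ∑ elements (λ a → χ (t * ((a + b) * (a + b))) *ᶜ χ (- t * (b * b))))
      ≈⟨ ∑-cong elements (λ b → ∑-cong elements (λ a → separate a b)) ⟩
    ∑ elements (λ b → ∑ elements (λ a → χ (t * (a * a)) *ᶜ χ (b * (2# * t * a))))
      ≈⟨ ∑-swap elements elements _ ⟩
    ∑ elements (λ a → ∑ elements (λ b → χ (t * (a * a)) *ᶜ χ (b * (2# * t * a))))
      ≈⟨ ∑-cong elements (λ a → *-∑ elements _ _) ⟨
    ∑ elements (λ a → χ (t * (a * a)) *ᶜ ∑ elements (λ b → χ (b * (2# * t * a))))
      ≈⟨ ∑-cong elements (λ a → K.*-congˡ (K.trans (∑-χ-* (2# * t * a)) (indicator a))) ⟩
    ∑ elements (λ a → χ (t * (a * a)) *ᶜ (q *ᶜ ⟦ a ≟ 0# ⟧))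
      ≈⟨ ∑-cong elements (λ a → solveᶜ 3 (λ x y z → x ⊗ (y ⊗ z) ⊜ z ⊗ (x ⊗ y)) K.refl _ _ _) ⟩
    ∑ elements (λ a → ⟦ a ≟ 0# ⟧ *ᶜ (χ (t * (a * a)) *ᶜ q))
      ≈⟨ Kronecker.∑-δ _≟_ elements-unique (∈-elements 0#) (λ a → χ (t * (a * a)) *ᶜ q) ⟩
    χ (t * (0# * 0#)) *ᶜ q
      ≈⟨ K.*-congʳ (K.trans (χ-cong (solve 1 (λ t → t :* (:0 :* :0) := :0) ≡.refl t)) χ-0) ⟩
    1ᶜ *ᶜ q
      ≈⟨ K.*-identityˡ _ ⟩
    q ∎
    where
    separate : ∀ a b → χ (t * ((a + b) * (a + b))) *ᶜ χ (- t * (b * b)) ≈ᶜ χ (t * (a * a)) *ᶜ χ (b * (2# * t * a))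
    separate a b = K.trans (K.sym (χ-+ _ _)) (K.trans (χ-cong
      (solve 3 (λ t a b → t :* ((a :+ b) :* (a :+ b)) :+ (:- t) :* (b :* b) :=
        t :* (a :* a) :+ b :* ((:1 :+ :1) :* t :* a)) ≡.refl t a b)) (χ-+ _ _))
    indicator : ∀ a → q *ᶜ ⟦ 2# * t * a ≟ 0# ⟧ ≈ᶜ q *ᶜ ⟦ a ≟ 0# ⟧
    indicator a = K.*-congˡ
      (⟦⟧-cong (2# * t * a ≟ 0#) (a ≟ 0#) (xy≡0⇒y≡0 (*-≢0 2≢0 t≢0))
        (λ a≡0 → ≡.trans (≡.cong (2# * t *_) a≡0) (zeroʳ _)))

  module GaussSigns {g : Carrier} (g-primitive : Primitive F g) where

    private
      g≢0 = proj₁ g-primitive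
      log = proj₂ g-primitive

    -- G t + G (t g) counts every value of t a twice, so it vanishes.
    G-nonsquare : ∀ {t} → t ≢ 0# → G (t * g) ≈ᶜ -ᶜ G t
    G-nonsquare {t} t≢0 = begin
      G (t * g)
        ≈⟨ solveᶜ 2 (λ x y → y ⊜ (x ⊕ y) ⊝ x) K.refl (G t) (G (t * g)) ⟩
      (G t +ᶜ G (t * g)) +ᶜ -ᶜ G t
        ≈⟨ K.+-congʳ (K.trans (K.+-cong (∑-elements 𝕂 _) (∑-elements 𝕂 _)) vanish) ⟩
      0ᶜ +ᶜ -ᶜ G t
        ≈⟨ K.+-identityˡ _ ⟩
      -ᶜ G t ∎
      where
      f : Carrier → K.Carrier
      f a = χ (t * a)
      χ0≈1 : ∀ s → χ (s * (0# * 0#)) ≈ᶜ 1ᶜ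
      χ0≈1 s = K.trans (χ-cong (solve 1 (λ s → s :* (:0 :* :0) := :0) ≡.refl s)) χ-0
      vanish : (χ (t * (0# * 0#)) +ᶜ ∑ units (λ a → χ (t * (a * a)))) +ᶜ
               (χ (t * g * (0# * 0#)) +ᶜ ∑ units (λ a → χ (t * g * (a * a)))) ≈ᶜ 0ᶜ
      vanish = begin
        (χ (t * (0# * 0#)) +ᶜ ∑ units (λ a → f (a * a))) +ᶜ (χ (t * g * (0# * 0#)) +ᶜ ∑ units (λ a → χ (t * g * (a * a))))
          ≈⟨ K.+-cong (K.+-congʳ (χ0≈1 t)) (K.+-cong (χ0≈1 (t * g)) (∑-cong units (λ a → χ-cong (*-assoc t g (a * a))))) ⟩
        (1ᶜ +ᶜ ∑ units (λ a → f (a * a))) +ᶜ (1ᶜ +ᶜ ∑ units (λ a → f (g * (a * a))))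
          ≈⟨ solveᶜ 3 (λ x y z → (x ⊕ y) ⊕ (x ⊕ z) ⊜ (x ⊕ x) ⊕ (y ⊕ z)) K.refl 1ᶜ _ _ ⟩
        (1ᶜ +ᶜ 1ᶜ) +ᶜ (∑ units (λ a → f (a * a)) +ᶜ ∑ units (λ a → f (g * (a * a))))
          ≈⟨ K.+-congˡ (∑-squares+nonsquares g-primitive 𝕂 f) ⟩
        (1ᶜ +ᶜ 1ᶜ) +ᶜ (∑ units f +ᶜ ∑ units f)
          ≈⟨ solveᶜ 2 (λ x y → (x ⊕ x) ⊕ (y ⊕ y) ⊜ (x ⊕ y) ⊕ (x ⊕ y)) K.refl 1ᶜ _ ⟩
        (1ᶜ +ᶜ ∑ units f) +ᶜ (1ᶜ +ᶜ ∑ units f)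
          ≈⟨ K.+-cong total total ⟩
        0ᶜ +ᶜ 0ᶜ
          ≈⟨ K.+-identityˡ 0ᶜ ⟩
        0ᶜ ∎
        where
        total : 1ᶜ +ᶜ ∑ units f ≈ᶜ 0ᶜ
        total = begin
          1ᶜ +ᶜ ∑ units f      ≈⟨ K.+-congʳ (K.trans (χ-cong (zeroʳ t)) χ-0) ⟨
          f 0# +ᶜ ∑ units f    ≈⟨ ∑-elements 𝕂 f ⟨
          ∑ elements f         ≈⟨ ∑-dilate 𝕂 t≢0 χ ⟩
          ∑ elements χ         ≈⟨ ∑-χ ⟩
          0ᶜ                    ∎

    -1≢0 : - 1# ≢ 0#
    -1≢0 = -‿≢0 (0≢1 ∘ ≡.sym)

    -- If -1 is a square, then `G (- t)` equals `G t`, and `G-conj` evaluates the square of `G t`.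
    i²≡-1⇒G²≈q : ∀ {t i} → t ≢ 0# → i * i ≡ - 1# → G t *ᶜ G t ≈ᶜ q
    i²≡-1⇒G²≈q {t} {i} t≢0 i²≡-1 = begin
      G t *ᶜ G t          ≈⟨ K.*-congˡ (G-square t i≢0) ⟨
      G t *ᶜ G (t * (i * i)) ≡⟨ ≡.cong (λ s → G t *ᶜ G s) (≡.trans (≡.cong (t *_) i²≡-1) (solve 1 (λ t → t :* :- :1 := :- t) ≡.refl t)) ⟩
      G t *ᶜ G (- t)         ≈⟨ G-conj t≢0 ⟩
      q             ∎
      where
      i≢0 : i ≢ 0#
      i≢0 i≡0 = -1≢0 (≡.trans (≡.sym i²≡-1) (≡.trans (≡.cong (_* i) i≡0) (zeroˡ i)))

    -- If -1 is `g` times a square, then `G (- t)` is the negative of `G t` by `G-nonsquare`, which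
    -- reverses the sign of the evaluation.
    gh²≡-1⇒G²≈-q : ∀ {t h} → t ≢ 0# → g * (h * h) ≡ - 1# → G t *ᶜ G t ≈ᶜ -ᶜ q
    gh²≡-1⇒G²≈-q {t} {h} t≢0 gh²≡-1 = begin
      G t *ᶜ G t              ≈⟨ solveᶜ 1 (λ x → x ⊗ x ⊜ ⊝ (x ⊗ (⊝ x))) K.refl (G t) ⟩
      -ᶜ (G t *ᶜ (-ᶜ G t))    ≈⟨ K.-‿cong (K.*-congˡ (G-nonsquare t≢0)) ⟨
      -ᶜ (G t *ᶜ G (t * g))   ≈⟨ K.-‿cong (K.*-congˡ (G-square (t * g) h≢0)) ⟨
      -ᶜ (G t *ᶜ G (t * g * (h * h))) ≡⟨ ≡.cong (λ s → -ᶜ (G t *ᶜ G s)) (≡.trans (*-assoc t g (h * h)) (≡.trans (≡.cong (t *_) gh²≡-1) (solve 1 (λ t → t :* :- :1 := :- t) ≡.refl t))) ⟩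
      -ᶜ (G t *ᶜ G (- t))  ≈⟨ K.-‿cong (G-conj t≢0) ⟩
      -ᶜ q              ∎
      where
      h≢0 : h ≢ 0#
      h≢0 h≡0 = -1≢0 (≡.trans (≡.sym gh²≡-1) (≡.trans (≡.cong (λ h → g * (h * h)) h≡0) (solve 1 (λ g → g :* (:0 :* :0) := :0) ≡.refl g)))

    -- The parity of the logarithm of -1 decides between the two evaluations of the square; their
    -- signs agree after squaring once more.
    G⁴≈q² : ∀ {t} → t ≢ 0# → (G t *ᶜ G t) *ᶜ (G t *ᶜ G t) ≈ᶜ q *ᶜ q
    G⁴≈q² {t} t≢0 = from-log (log (- 1#) -1≢0)
      where
      from-parity : ∀ {k} → - 1# ≡ g ^ k → (∃ λ j → k ≡ j ℕ.+ j ⊎ k ≡ suc (j ℕ.+ j)) →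
                    (G t *ᶜ G t) *ᶜ (G t *ᶜ G t) ≈ᶜ q *ᶜ q
      from-parity -1≡gᵏ (j , inj₁ ≡.refl) = K.*-cong G²≈q G²≈q
        where
        G²≈q : G t *ᶜ G t ≈ᶜ q
        G²≈q = i²≡-1⇒G²≈q t≢0 (≡.sym (≡.trans -1≡gᵏ (^-homo-* g j j)))
      from-parity -1≡gᵏ (j , inj₂ ≡.refl) = K.trans (K.*-cong G²≈-q G²≈-q)
        (solveᶜ 1 (λ x → (⊝ x) ⊗ (⊝ x) ⊜ x ⊗ x) K.refl q)
        where
        G²≈-q : G t *ᶜ G t ≈ᶜ -ᶜ q
        G²≈-q = gh²≡-1⇒G²≈-q t≢0 (≡.sym (≡.trans -1≡gᵏ (≡.cong (g *_) (^-homo-* g j j))))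
      from-log : (∃ λ k → - 1# ≡ g ^ k) → (G t *ᶜ G t) *ᶜ (G t *ᶜ G t) ≈ᶜ q *ᶜ q
      from-log (k , -1≡gᵏ) = from-parity -1≡gᵏ (halve k)

    -- In these two cases (-1)^m is a square, that is, the sign of G(t)^(2m) is +1.
    GoodSign : ℕ → Set
    GoodSign m = order % 4 ≡ 1 ⊎ (∃ λ k → m ≡ k ℕ.+ k)

    *ᶜ-^ᶜ : ∀ z n → (z *ᶜ z) ^ᶜ n ≈ᶜ z ^ᶜ (n ℕ.+ n)
    *ᶜ-^ᶜ z n = K.trans (*-^ᶜ n) (K.sym (^ᶜ-homo-* z n n))
      where
      *-^ᶜ : ∀ n → (z *ᶜ z) ^ᶜ n ≈ᶜ z ^ᶜ n *ᶜ z ^ᶜ n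
      *-^ᶜ zero    = K.sym (K.*-identityˡ 1ᶜ)
      *-^ᶜ (suc n) = K.trans (K.*-congˡ (*-^ᶜ n))
        (solveᶜ 2 (λ x y → (x ⊗ x) ⊗ (y ⊗ y) ⊜ (x ⊗ y) ⊗ (x ⊗ y)) K.refl z (z ^ᶜ n))

    -- For q ≡ 1 modulo 4 the element -1 is a square, so already the square of `G t` is q. For even
    -- `m` only fourth powers occur, whose value is the same whether or not -1 is a square.
    G²ᵐ : ∀ {t m} → t ≢ 0# → GoodSign m → G t ^ᶜ (m ℕ.+ m) ≈ᶜ q ^ᶜ m
    G²ᵐ {t} {m} t≢0 (inj₁ q%4≡1) = begin
      G t ^ᶜ (m ℕ.+ m)    ≈⟨ *ᶜ-^ᶜ (G t) m ⟨
      (G t *ᶜ G t) ^ᶜ m   ≈⟨ ^ᶜ-congˡ m (i²≡-1⇒G²≈q t≢0 (proj₂ (-1-isSquare g-primitive q%4≡1))) ⟩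
      q ^ᶜ m              ∎
    G²ᵐ {t} {m} t≢0 (inj₂ (k , ≡.refl)) = begin
      G t ^ᶜ (m ℕ.+ m)                   ≈⟨ *ᶜ-^ᶜ (G t) m ⟨
      (G t *ᶜ G t) ^ᶜ (k ℕ.+ k)          ≈⟨ *ᶜ-^ᶜ (G t *ᶜ G t) k ⟨
      ((G t *ᶜ G t) *ᶜ (G t *ᶜ G t)) ^ᶜ k ≈⟨ ^ᶜ-congˡ k (G⁴≈q² t≢0) ⟩
      (q *ᶜ q) ^ᶜ k          ≈⟨ *ᶜ-^ᶜ (q) k ⟩
      q ^ᶜ m                     ∎

    -- The Gauss sum of the quadratic form ∥ w ∥ - g w₀² in 2m + 2 variables: the
    -- form is elliptic, whence the minus sign.
    G-elliptic : ∀ {t m} → t ≢ 0# → GoodSign m →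
      G t ^ᶜ suc (m ℕ.+ m) *ᶜ G (- (t * g)) ≈ᶜ -ᶜ (q ^ᶜ suc m)
    G-elliptic {t} {m} t≢0 good = begin
      G t ^ᶜ suc (m ℕ.+ m) *ᶜ G (- (t * g))
        ≈⟨ K.*-cong (K.*-congˡ (G²ᵐ t≢0 good)) (K.reflexive (≡.cong G (solve 2 (λ t g → :- (t :* g) := (:- t) :* g) ≡.refl t g))) ⟩
      (G t *ᶜ q ^ᶜ m) *ᶜ G (- t * g)
        ≈⟨ K.*-congˡ (G-nonsquare -t≢0) ⟩
      (G t *ᶜ q ^ᶜ m) *ᶜ (-ᶜ G (- t))
        ≈⟨ solveᶜ 3 (λ x y z → (x ⊗ y) ⊗ (⊝ z) ⊜ ⊝ (x ⊗ z ⊗ y)) K.refl (G t) _ _ ⟩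
      -ᶜ (G t *ᶜ G (- t) *ᶜ q ^ᶜ m)
        ≈⟨ K.-‿cong (K.*-congʳ (G-conj t≢0)) ⟩
      -ᶜ (q ^ᶜ suc m) ∎
      where
      -t≢0 : - t ≢ 0#
      -t≢0 = -‿≢0 t≢0

  ψ : Carrier → K.Carrier
  ψ c = ∑ units (λ t → χ (t * c))

  ψ-indicator : ∀ c → ψ c ≈ᶜ q *ᶜ ⟦ c ≟ 0# ⟧ +ᶜ -ᶜ 1ᶜ
  ψ-indicator c = begin
    ψ c
      ≈⟨ solveᶜ 1 (λ x → x ⊜ 1ᴾ ⊕ x ⊝ 1ᴾ) K.refl (ψ c) ⟩
    1ᶜ +ᶜ ψ c +ᶜ -ᶜ 1ᶜ
      ≈⟨ K.+-congʳ (K.+-congʳ (K.trans (χ-cong (zeroˡ c)) χ-0)) ⟨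
    χ (0# * c) +ᶜ ψ c +ᶜ -ᶜ 1ᶜ
      ≈⟨ K.+-congʳ (∑-elements 𝕂 (λ t → χ (t * c))) ⟨
    ∑ elements (λ t → χ (t * c)) +ᶜ -ᶜ 1ᶜ
      ≈⟨ K.+-congʳ (∑-χ-* c) ⟩
    q *ᶜ ⟦ c ≟ 0# ⟧ +ᶜ -ᶜ 1ᶜ ∎

  ψ-dilate : ∀ {s} → s ≢ 0# → ∀ c → ψ (s * c) ≈ᶜ ψ c
  ψ-dilate {s} s≢0 c = K.trans
    (∑-cong units (λ t → χ-cong (solve 3 (λ s t c → t :* (s :* c) := s :* t :* c) ≡.refl s t c)))
    (∑-dilate-units 𝕂 s≢0 (λ t → χ (t * c)))

  #units : K.Carrier
  #units = ∑ units (const 1ᶜ)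

  -- A second moment over the zeros of an elliptic quadratic form.

  module NullPairs {g : Carrier} (g-primitive : Primitive F g) {m : ℕ}
    (good : GaussSigns.GoodSign g-primitive m)
    (xs : List (Point (suc (m ℕ.+ m)))) (xs-unique : Unique xs)
    (∥xs∥≡g : ∀ {x} → x ∈ xs → ∥ x ∥ ≡ g) where

    open GaussSigns g-primitive

    private
      D = suc (suc (m ℕ.+ m))
      V = Point (suc (m ℕ.+ m))
      g≢0 = proj₁ g-primitive

    -- The scales gain a factor of about q. All pairs of scales contribute equally to the excess q Z
    -- - n², which is thus multiplied by the square of `#units`, while the diagonal is multiplied by
    -- `#units` only.
    scaledPoints : List (Carrier × V)
    scaledPoints = cartesianProduct units xs

    -- The product of W = (w₀ , w) with the lift of (s , x) is s (w · x - g w₀). For x on the sphere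
    -- the lift is a zero of the dual form ∥ w ∥ - w₀² / g.
    lift : Carrier × V → Point D
    lift (s , x) = s * - g ∷ s ⊛ x

    -- The elliptic form; lift maps into its zero set.
    Q : Point D → Carrier
    Q (w₀ ∷ w) = ∥ w ∥ - g * (w₀ * w₀)

    Φ : Carrier → Point D → K.Carrier
    Φ t W = χ (t * Q W)

    -- The Fourier transform of `Φ t` is the Gauss sum of the form times a character of the dual
    -- form at the frequency. As both lifts are zeros of the dual form, only the polar term of their
    -- difference survives, a multiple of `x · y - g`.
    twisted : ∀ {t} → t ≢ 0# → ∀ s x s′ y → ∥ x ∥ ≡ g → ∥ y ∥ ≡ g →
      ∑ (points D) (λ W → Φ t W *ᶜ χ (W · (lift (s , x) -ᵖ lift (s′ , y)))) ≈ᶜ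
      -ᶜ (q ^ᶜ suc m) *ᶜ χ ((2# * t) ⁻¹ * (s * s′ * (x · y - g)))
    twisted {t} t≢0 s x s′ y ∥x∥≡g ∥y∥≡g = begin
      ∑ (points D) (λ W → Φ t W *ᶜ χ (W · (b ∷ u)))
        ≈⟨ ∑-cartesianProductWith _∷_ elements (points (suc (m ℕ.+ m))) _ ⟩
      ∑ elements (λ a → ∑ pts (λ w → χ (t * (∥ w ∥ - g * (a * a))) *ᶜ χ (a * b + w · u)))
        ≈⟨ ∑-cong elements (λ a → ∑-cong pts (λ w → regroup a w)) ⟩
      ∑ elements (λ a → ∑ pts (λ w → χ (t′ * (a * a) + a * (2# * t′ * c₀)) *ᶜ χ (t * ∥ w ∥ + w · ((2# * t) ⊛ c))))
        ≈⟨ ∑-*-∑ elements pts _ _ ⟨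
      ∑ elements (λ a → χ (t′ * (a * a) + a * (2# * t′ * c₀))) *ᶜ ∑ pts (λ w → χ (t * ∥ w ∥ + w · ((2# * t) ⊛ c)))
        ≈⟨ K.*-cong (G-complete-square t′ c₀) (G-complete-squares t c) ⟩
      (G t′ *ᶜ χ (- (t′ * (c₀ * c₀)))) *ᶜ (G t ^ᶜ suc (m ℕ.+ m) *ᶜ χ (- (t * ∥ c ∥)))
        ≈⟨ solveᶜ 4 (λ a b c d → (a ⊗ b) ⊗ (c ⊗ d) ⊜ (c ⊗ a) ⊗ (b ⊗ d)) K.refl (G t′) _ _ _ ⟩
      (G t ^ᶜ suc (m ℕ.+ m) *ᶜ G t′) *ᶜ (χ (- (t′ * (c₀ * c₀))) *ᶜ χ (- (t * ∥ c ∥)))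
        ≈⟨ K.*-cong (G-elliptic t≢0 good) (K.trans (K.sym (χ-+ _ _)) (χ-cong exponent)) ⟩
      -ᶜ (q ^ᶜ suc m) *ᶜ χ (r * (s * s′ * (x · y - g))) ∎
      where
      pts = points (suc (m ℕ.+ m))
      r = (2# * t) ⁻¹
      2tr≡1 : 2# * t * r ≡ 1#
      2tr≡1 = ⁻¹-inverseʳ (*-≢0 2≢0 t≢0)
      b = s * - g - s′ * - g
      u = s ⊛ x -ᵖ s′ ⊛ y
      c = r ⊛ u
      t′ = - (t * g)
      c₀ = r * (s - s′)
      u≡ : u ≡ (2# * t) ⊛ c
      u≡ = ≡.sym (⊛-inverse (⁻¹-inverseʳ (*-≢0 2≢0 t≢0)) u)
      b≡ : b ≡ 2# * t′ * c₀
      b≡ = ≡.trans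
        (solve 3 (λ s s′ g → s :* :- g :- s′ :* :- g := :1 :* (:- g) :* (s :- s′)) ≡.refl s s′ g)
        (≡.trans (≡.cong (λ e → e * - g * (s - s′)) (≡.sym 2tr≡1))
        (solve 5 (λ t r g s s′ → (:1 :+ :1) :* t :* r :* (:- g) :* (s :- s′) :=
           (:1 :+ :1) :* (:- (t :* g)) :* (r :* (s :- s′))) ≡.refl t r g s s′))
      regroup : ∀ a w → χ (t * (∥ w ∥ - g * (a * a))) *ᶜ χ (a * b + w · u) ≈ᶜ
                        χ (t′ * (a * a) + a * (2# * t′ * c₀)) *ᶜ χ (t * ∥ w ∥ + w · ((2# * t) ⊛ c))
      regroup a w = begin
        χ (t * (∥ w ∥ - g * (a * a))) *ᶜ χ (a * b + w · u)
          ≈⟨ χ-+ _ _ ⟨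
        χ (t * (∥ w ∥ - g * (a * a)) + (a * b + w · u))
          ≈⟨ χ-cong (solve 6 (λ t n g a b v → t :* (n :- g :* (a :* a)) :+ (a :* b :+ v) :=
               ((:- (t :* g)) :* (a :* a) :+ a :* b) :+ (t :* n :+ v)) ≡.refl t ∥ w ∥ g a b (w · u)) ⟩
        χ ((t′ * (a * a) + a * b) + (t * ∥ w ∥ + w · u))
          ≈⟨ χ-+ _ _ ⟩
        χ (t′ * (a * a) + a * b) *ᶜ χ (t * ∥ w ∥ + w · u)
          ≡⟨ ≡.cong₂ (λ b u → χ (t′ * (a * a) + a * b) *ᶜ χ (t * ∥ w ∥ + w · u)) b≡ u≡ ⟩
        χ (t′ * (a * a) + a * (2# * t′ * c₀)) *ᶜ χ (t * ∥ w ∥ + w · ((2# * t) ⊛ c)) ∎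
      exponent : - (t′ * (c₀ * c₀)) + - (t * ∥ c ∥) ≡ r * (s * s′ * (x · y - g))
      exponent = ≡.trans
        (≡.cong (λ e → - (t′ * (c₀ * c₀)) + - (t * e))
          (≡.trans (∥⊛∥ r u) (≡.cong (r * r *_) (∥⊛-⊛∥ s s′ x y ∥x∥≡g ∥y∥≡g))))
        (≡.trans (solve 6 (λ t r g s s′ p →
           :- ((:- (t :* g)) :* (r :* (s :- s′) :* (r :* (s :- s′)))) :+
           :- (t :* (r :* r :* (s :* s :* g :+ s′ :* s′ :* g :- (:1 :+ :1) :* (s′ :* (s :* p))))) :=
           (:1 :+ :1) :* t :* r :* (r :* (s :* s′ :* (p :- g)))) ≡.refl t r g s s′ (x · y))
        (≡.trans (≡.cong (_* (r * (s * s′ * (x · y - g)))) 2tr≡1) (*-identityˡ _)))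

    ∑-units-[2t]⁻¹ : ∀ c → ∑ units (λ t → χ ((2# * t) ⁻¹ * c)) ≈ᶜ ψ c
    ∑-units-[2t]⁻¹ c = K.trans (∑-dilate-units 𝕂 2≢0 (λ t → χ (t ⁻¹ * c))) (∑-invert-units 𝕂 (λ t → χ (t * c)))

    nullSum : K.Carrier
    nullSum = ∑ (points D) (λ W → ⟦ Q W ≟ 0# ⟧ *ᶜ ∣expSum∣² scaledPoints lift W)

    #xs nullPairs : K.Carrier
    #xs = ∑ xs (const 1ᶜ)
    nullPairs = ∑ xs (λ x → ∑ xs (λ y → ⟦ x · y - g ≟ 0# ⟧))

    -- As `g` is not 0, the first coordinate of a lift determines the scale, and the others then
    -- determine the point: the lifts are pairwise distinct and only the diagonal counts.
    coincidences-lift : coincidences scaledPoints lift ≈ᶜ #units *ᶜ #xs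
    coincidences-lift = begin
      ∑ scaledPoints (λ i → ∑ scaledPoints (λ j → ⟦ lift i ≟ᵖ lift j ⟧))
        ≈⟨ ∑-cong∈ scaledPoints (λ {i} i∈ → K.trans
             (∑-cong∈ scaledPoints (λ {j} j∈ → K.trans
               (⟦⟧-cong (lift i ≟ᵖ lift j) (≡-dec _≟_ _≟ᵖ_ j i) (≡.sym ∘ lift-injective i∈ j∈) (λ { ≡.refl → ≡.refl }))
               (K.sym (K.*-identityʳ _))))
             (Kronecker.∑-δ (≡-dec _≟_ _≟ᵖ_) scaledPoints-unique i∈ (const 1ᶜ))) ⟩
      ∑ scaledPoints (const 1ᶜ)
        ≈⟨ ∑-cartesianProduct units xs _ ⟩
      ∑ units (λ s → ∑ xs (const 1ᶜ))
        ≈⟨ K.trans (∑-* units (const 1ᶜ) #xs) (∑-cong units (λ _ → K.*-identityˡ _)) ⟨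
      #units *ᶜ #xs ∎
      where
      scaledPoints-unique : Unique scaledPoints
      scaledPoints-unique = Unique.cartesianProduct⁺ units-unique xs-unique
      lift-injective : ∀ {i j} → i ∈ scaledPoints → j ∈ scaledPoints → lift i ≡ lift j → i ≡ j
      lift-injective {s , x} {s′ , y} i∈ _ eq with Vec.∷-injective eq
      ... | p , r = helper (*-cancelˡ -g≢0 (≡.trans (*-comm _ s) (≡.trans p (*-comm s′ _)))) r
        where
        -g≢0 : - g ≢ 0#
        -g≢0 = -‿≢0 g≢0
        s≢0 : s ≢ 0#
        s≢0 = units-≢0 (proj₁ (∈.∈-cartesianProduct⁻ units xs i∈))
        helper : s ≡ s′ → s ⊛ x ≡ s′ ⊛ y → (s , x) ≡ (s′ , y)
        helper ≡.refl r = ≡.cong (s ,_) (⊛-cancelˡ s≢0 x y r)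

    ∑-ψ-scaledPoints : ∑ scaledPoints (λ (s , x) → ∑ scaledPoints (λ (s′ , y) → ψ (s * s′ * (x · y - g)))) ≈ᶜ
                       #units *ᶜ #units *ᶜ (q *ᶜ nullPairs +ᶜ -ᶜ (#xs *ᶜ #xs))
    ∑-ψ-scaledPoints = begin
      ∑ scaledPoints (λ (s , x) → ∑ scaledPoints (λ (s′ , y) → ψ (s * s′ * (x · y - g))))
        ≈⟨ ∑-cong∈ scaledPoints (λ i∈ → ∑-cong∈ scaledPoints (λ j∈ →
             ψ-dilate (*-≢0 (unit i∈) (unit j∈)) _)) ⟩
      ∑ scaledPoints (λ (s , x) → ∑ scaledPoints (λ (s′ , y) → ψ (x · y - g)))
        ≈⟨ ∑-cong scaledPoints (λ (s , x) → ∑-scaledPoints (λ y → ψ (x · y - g))) ⟩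
      ∑ scaledPoints (λ (s , x) → #units *ᶜ ∑ xs (λ y → ψ (x · y - g)))
        ≈⟨ ∑-scaledPoints (λ x → #units *ᶜ ∑ xs (λ y → ψ (x · y - g))) ⟩
      #units *ᶜ ∑ xs (λ x → #units *ᶜ ∑ xs (λ y → ψ (x · y - g)))
        ≈⟨ K.*-congˡ (*-∑ xs #units _) ⟨
      #units *ᶜ (#units *ᶜ ∑ xs (λ x → ∑ xs (λ y → ψ (x · y - g))))
        ≈⟨ K.*-assoc _ _ _ ⟨
      #units *ᶜ #units *ᶜ ∑ xs (λ x → ∑ xs (λ y → ψ (x · y - g)))
        ≈⟨ K.*-congˡ (∑-cong xs (λ x → K.trans (∑-cong xs (λ y → ψ-indicator (x · y - g)))
             (K.trans (∑-- xs _ _) (K.+-congʳ (K.sym (*-∑ xs q _)))))) ⟩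
      #units *ᶜ #units *ᶜ ∑ xs (λ x → q *ᶜ ∑ xs (λ y → ⟦ x · y - g ≟ 0# ⟧) +ᶜ -ᶜ #xs)
        ≈⟨ K.*-congˡ (K.trans (∑-- xs _ _) (K.+-cong (K.sym (*-∑ xs q _))
             (K.-‿cong (K.trans (∑-cong xs (λ _ → K.sym (K.*-identityˡ _))) (K.sym (∑-* xs (const 1ᶜ) #xs)))))) ⟩
      #units *ᶜ #units *ᶜ (q *ᶜ nullPairs +ᶜ -ᶜ (#xs *ᶜ #xs)) ∎
      where
      unit : ∀ {i} → i ∈ scaledPoints → proj₁ i ≢ 0#
      unit i∈ = units-≢0 (proj₁ (∈.∈-cartesianProduct⁻ units xs i∈))
      ∑-scaledPoints : ∀ (f : V → K.Carrier) → ∑ scaledPoints (λ (_ , x) → f x) ≈ᶜ #units *ᶜ ∑ xs f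
      ∑-scaledPoints f = K.trans (∑-cartesianProduct units xs _)
        (K.trans (∑-cong units (λ _ → K.sym (K.*-identityˡ _))) (K.sym (∑-* units (const 1ᶜ) _)))

    -- The condition that the form vanishes at `W` is expanded into a sum over t. The term t = 0 is
    -- Plancherel's identity, the others are given by `twisted`. The minus sign of the elliptic
    -- Gauss sum is decisive: it makes a lower bound for `nullSum` an upper bound for `nullPairs`.
    nullSum-identity : q *ᶜ nullSum ≈ᶜ
      q ^ᶜ D *ᶜ (#units *ᶜ #xs) +ᶜ
      -ᶜ (q ^ᶜ suc m) *ᶜ (#units *ᶜ #units *ᶜ (q *ᶜ nullPairs +ᶜ -ᶜ (#xs *ᶜ #xs)))
    nullSum-identity = begin
      q *ᶜ nullSum
        ≈⟨ *-∑ (points D) q _ ⟩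
      ∑ (points D) (λ W → q *ᶜ (⟦ Q W ≟ 0# ⟧ *ᶜ S² W))
        ≈⟨ ∑-cong (points D) (λ W → K.trans (K.sym (K.*-assoc _ _ _))
             (K.trans (K.*-congʳ (K.sym (∑-χ-* (Q W)))) (∑-* elements _ _))) ⟩
      ∑ (points D) (λ W → ∑ elements (λ t → Φ t W *ᶜ S² W))
        ≈⟨ ∑-swap (points D) elements _ ⟩
      ∑ elements (λ t → ∑ (points D) (λ W → Φ t W *ᶜ S² W))
        ≈⟨ ∑-elements 𝕂 _ ⟩
      ∑ (points D) (λ W → Φ 0# W *ᶜ S² W) +ᶜ ∑ units (λ t → ∑ (points D) (λ W → Φ t W *ᶜ S² W))
        ≈⟨ K.+-cong untwisted (∑-cong units (λ t → ∑-weighted-∣expSum∣² scaledPoints lift (Φ t))) ⟩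
      main +ᶜ ∑ units (λ t → ∑ scaledPoints (λ i → ∑ scaledPoints (λ j →
        ∑ (points D) (λ W → Φ t W *ᶜ χ (W · (lift i -ᵖ lift j))))))
        ≈⟨ K.+-congˡ (∑-cong∈ units (λ t∈ → ∑-cong∈ scaledPoints (λ i∈ → ∑-cong∈ scaledPoints (λ j∈ →
             twisted (units-≢0 t∈) _ _ _ _ (∥∥≡g i∈) (∥∥≡g j∈))))) ⟩
      main +ᶜ ∑ units (λ t → ∑ scaledPoints (λ (s , x) → ∑ scaledPoints (λ (s′ , y) →
        -ᶜ (q ^ᶜ suc m) *ᶜ χ ((2# * t) ⁻¹ * (s * s′ * (x · y - g))))))
        ≈⟨ K.+-congˡ (K.trans (∑-swap units scaledPoints _) (∑-cong scaledPoints (λ i → ∑-swap units scaledPoints _))) ⟩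
      main +ᶜ ∑ scaledPoints (λ (s , x) → ∑ scaledPoints (λ (s′ , y) → ∑ units (λ t →
        -ᶜ (q ^ᶜ suc m) *ᶜ χ ((2# * t) ⁻¹ * (s * s′ * (x · y - g))))))
        ≈⟨ K.+-congˡ (∑-cong scaledPoints (λ i → ∑-cong scaledPoints (λ j →
             K.trans (K.sym (*-∑ units _ _)) (K.*-congˡ (∑-units-[2t]⁻¹ _))))) ⟩
      main +ᶜ ∑ scaledPoints (λ (s , x) → ∑ scaledPoints (λ (s′ , y) →
        -ᶜ (q ^ᶜ suc m) *ᶜ ψ (s * s′ * (x · y - g))))
        ≈⟨ K.+-congˡ (K.trans (*-∑ scaledPoints _ _) (∑-cong scaledPoints (λ i → *-∑ scaledPoints _ _))) ⟨
      main +ᶜ -ᶜ (q ^ᶜ suc m) *ᶜ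
        ∑ scaledPoints (λ (s , x) → ∑ scaledPoints (λ (s′ , y) → ψ (s * s′ * (x · y - g))))
        ≈⟨ K.+-congˡ (K.*-congˡ ∑-ψ-scaledPoints) ⟩
      main +ᶜ
        -ᶜ (q ^ᶜ suc m) *ᶜ (#units *ᶜ #units *ᶜ (q *ᶜ nullPairs +ᶜ -ᶜ (#xs *ᶜ #xs))) ∎
      where
      main = q ^ᶜ D *ᶜ (#units *ᶜ #xs)
      S² = ∣expSum∣² scaledPoints lift
      ∥∥≡g : ∀ {i} → i ∈ scaledPoints → ∥ proj₂ i ∥ ≡ g
      ∥∥≡g i∈ = ∥xs∥≡g (proj₂ (∈.∈-cartesianProduct⁻ units xs i∈))
      untwisted : ∑ (points D) (λ W → Φ 0# W *ᶜ S² W) ≈ᶜ main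
      untwisted = K.trans
        (∑-cong (points D) (λ W → K.trans (K.*-congʳ (K.trans (χ-cong (zeroˡ (Q W))) χ-0)) (K.*-identityˡ _)))
        (K.trans (plancherel scaledPoints lift) (K.*-congˡ coincidences-lift))

-- Specialisation to complex characters and return to real identities.

module ComplexCharacter (R : Reals) (F : FiniteField) (character : NontrivialAdditiveCharacter R F) where

  private module 𝔽 = FiniteField F
  open Reals R
  open RealProperties R
  open Complex R
  open ComplexProperties R
  private module K = ℂ-Ring
  open ℂ-Sums using () renaming (∑ to ∑ᶜ)
  open Geometry F hiding (_∈_)
  open FieldProperties F using (units; ∑-translate)
  open GeometryProperties F
  open NontrivialAdditiveCharacter character
  open import Algebra.Properties.Semiring.Mult K.semiring using () renaming (_×_ to _×ᶜ_)
  open import Algebra.Properties.Semiring.Exp K.semiring using () renaming (_^_ to _^ᶜ_)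
  import Algebra.Properties.Group K.+-group as KG
  open import Data.List.Membership.Propositional using (_∈_)
  open import Relation.Binary.Reasoning.Setoid K.setoid

  private variable
    a : Level
    A : Set a
    d : ℕ

  [z-1]w : ∀ z w → (z +ᶜ -ᶜ 1ᶜ) *ᶜ w ≈ᶜ w *ᶜ z +ᶜ -ᶜ w
  [z-1]w z w = K.trans (K.distribʳ w z (-ᶜ 1ᶜ))
    (K.+-cong (K.*-comm z w) (-1*x≈-x w))
    where open import Algebra.Properties.Ring K.ring using (-1*x≈-x)

  -- Translation by an element `b` with `χ b` different from 1 multiplies the sum by `χ b` and also
  -- leaves it unchanged.
  ∑-χ : ∑ᶜ 𝔽.elements χ ≈ᶜ 0ᶜ
  ∑-χ = zw≈0⇒w≈0 (proj₂ nontrivial ∘ KG.x∙y⁻¹≈ε⇒x≈y (χ b) 1ᶜ) (begin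
    (χ b +ᶜ -ᶜ 1ᶜ) *ᶜ S
      ≈⟨ [z-1]w (χ b) S ⟩
    S *ᶜ χ b +ᶜ -ᶜ S
      ≈⟨ K.+-congʳ (ℂ-Sums.∑-* 𝔽.elements χ (χ b)) ⟩
    ∑ᶜ 𝔽.elements (λ x → χ x *ᶜ χ b) +ᶜ -ᶜ S
      ≈⟨ K.+-congʳ (ℂ-Sums.∑-cong 𝔽.elements (λ x → χ-+ x b)) ⟨
    ∑ᶜ 𝔽.elements (λ x → χ (x 𝔽.+ b)) +ᶜ -ᶜ S
      ≈⟨ K.+-congʳ (∑-translate ℂ-commutativeRing b χ) ⟩
    S +ᶜ -ᶜ S
      ≈⟨ K.-‿inverseʳ S ⟩
    0ᶜ ∎)
    where
    b = proj₁ nontrivial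
    S = ∑ᶜ 𝔽.elements χ

  ringCharacter : RingCharacters.RingCharacter F ℂ-commutativeRing
  ringCharacter = record { χ = χ ; χ-0 = χ-0 ; χ-+ = χ-+ ; ∑-χ = ∑-χ }

  module χ-Sums = CharacterSums F ℂ-commutativeRing ringCharacter

  χ-neg : ∀ x → χ (𝔽.- x) ≈ᶜ conj (χ x)
  χ-neg x = begin
    χ (𝔽.- x)                         ≈⟨ K.*-identityʳ _ ⟨
    χ (𝔽.- x) *ᶜ 1ᶜ                   ≈⟨ K.*-congˡ (K.trans (z*conj[z] (χ x)) (embed-cong (abs≈1⇒norm²≈1 (χ x) (χ-unit x)))) ⟨
    χ (𝔽.- x) *ᶜ (χ x *ᶜ conj (χ x))  ≈⟨ K.*-assoc (χ (𝔽.- x)) (χ x) (conj (χ x)) ⟨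
    χ (𝔽.- x) *ᶜ χ x *ᶜ conj (χ x)    ≈⟨ K.*-congʳ (χ-+ (𝔽.- x) x) ⟨
    χ (𝔽.- x 𝔽.+ x) *ᶜ conj (χ x)     ≈⟨ K.*-congʳ (K.trans (χ-Sums.χ-cong (-‿inverseˡ′ x)) χ-0) ⟩
    1ᶜ *ᶜ conj (χ x)                  ≈⟨ K.*-identityˡ _ ⟩
    conj (χ x)                        ∎
    where open FieldProperties F using () renaming (-‿inverseˡ to -‿inverseˡ′)

  q : ℝ
  q = ι 𝔽.order

  embed-× : ∀ n → n ×ᶜ 1ᶜ ≈ᶜ embed (ι n)
  embed-× zero    = K.refl
  embed-× (suc n) = K.trans (K.+-congˡ (embed-× n)) (K.sym (embed-+ 1# (ι n)))

  embed-^ᶜ : ∀ {z x} n → z ≈ᶜ embed x → z ^ᶜ n ≈ᶜ embed (x ^ⁿ n)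
  embed-^ᶜ zero    _  = K.refl
  embed-^ᶜ {z} {x} (suc n) eq = K.trans (K.*-cong eq (embed-^ᶜ n eq)) (K.sym (embed-* x (x ^ⁿ n)))

  embed-∑′ : ∀ (xs : List A) {f g} → (∀ x → f x ≈ᶜ embed (g x)) → ∑ᶜ xs f ≈ᶜ embed (∑ xs g)
  embed-∑′ xs f≈g = K.trans (ℂ-Sums.∑-cong xs f≈g) (K.sym (embed-∑ xs _))

  embed-*′ : ∀ {z w x y} → z ≈ᶜ embed x → w ≈ᶜ embed y → z *ᶜ w ≈ᶜ embed (x * y)
  embed-*′ {x = x} {y} p r = K.trans (K.*-cong p r) (K.sym (embed-* x y))

  embed-+′ : ∀ {z w x y} → z ≈ᶜ embed x → w ≈ᶜ embed y → z +ᶜ w ≈ᶜ embed (x + y)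
  embed-+′ {x = x} {y} p r = K.trans (K.+-cong p r) (K.sym (embed-+ x y))

  embed-neg′ : ∀ {z x} → z ≈ᶜ embed x → -ᶜ z ≈ᶜ embed (- x)
  embed-neg′ {x = x} p = K.trans (K.-‿cong p) (K.sym (embed-neg x))

  -- Transfers an identity of character sums to the reals, once both sides are recognised as
  -- embedded real numbers.
  embed-injective : ∀ {z w x y} → z ≈ᶜ w → z ≈ᶜ embed x → w ≈ᶜ embed y → x ≈ y
  embed-injective z≈w p r = proj₁ (K.trans (K.sym p) (K.trans z≈w r))

  embed-q : χ-Sums.q ≈ᶜ embed q
  embed-q = embed-× 𝔽.order

  ∣expSum∣²≈norm² : ∀ (I : List A) (v : A → Point d) w →
    χ-Sums.∣expSum∣² I v w ≈ᶜ embed (norm² (χ-Sums.expSum I v w))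
  ∣expSum∣²≈norm² I v w = K.trans
    (K.*-congˡ {χ-Sums.expSum I v w} (K.trans (ℂ-Sums.∑-cong I (λ i → χ-neg (w · v i))) (K.sym (conj-∑ I _))))
    (z*conj[z] (χ-Sums.expSum I v w))

  #units : ℝ
  #units = ∑ units (const 1#)

  plancherel : ∀ (I : List A) (v : A → Point d) →
    ∑ (points d) (λ w → norm² (χ-Sums.expSum I v w)) ≈ q ^ⁿ d * ∑ I (λ i → ∑ I (λ j → ⟦ v i ≟ᵖ v j ⟧))
  plancherel {d = d} I v = embed-injective (χ-Sums.plancherel I v)
    (embed-∑′ (points d) (∣expSum∣²≈norm² I v))
    (embed-*′ (embed-^ᶜ d embed-q) (embed-∑′ I (λ i → embed-∑′ I (λ j → K.sym (embed-⟦⟧ (v i ≟ᵖ v j))))))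

  module NullPairs {g : 𝔽.Carrier} (g-primitive : Primitive F g) {m : ℕ}
    (good : χ-Sums.GaussSigns.GoodSign g-primitive m)
    (xs : List (Point (suc (m ℕ.+ m)))) (xs-unique : Unique xs)
    (∥xs∥≡g : ∀ {x} → x ∈ xs → ∥ x ∥ ≡ g) where

    private module N = χ-Sums.NullPairs g-primitive good xs xs-unique ∥xs∥≡g

    n Z P : ℝ
    n = ∑ xs (const 1#)
    Z = ∑ xs (λ x → ∑ xs (λ y → ⟦ x · y 𝔽.- g 𝔽.≟ 𝔽.0# ⟧))
    P = ∑ (points (suc (suc (m ℕ.+ m)))) (λ W → ⟦ N.Q W 𝔽.≟ 𝔽.0# ⟧ * norm² (χ-Sums.expSum N.scaledPoints N.lift W))

    P-identity : q * P ≈ q ^ⁿ suc (suc (m ℕ.+ m)) * (#units * n) + - (q ^ⁿ suc m) * (#units * #units * (q * Z - n * n))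
    P-identity = embed-injective N.nullSum-identity
      (embed-*′ embed-q (embed-∑′ (points (suc (suc (m ℕ.+ m)))) (λ W →
        embed-*′ (K.sym (embed-⟦⟧ (N.Q W 𝔽.≟ 𝔽.0#))) (∣expSum∣²≈norm² N.scaledPoints N.lift W))))
      (embed-+′ (embed-*′ (embed-^ᶜ (suc (suc (m ℕ.+ m))) embed-q) (embed-*′ embed-#units embed-#xs))
        (embed-*′ (embed-neg′ (embed-^ᶜ (suc m) embed-q)) (embed-*′ (embed-*′ embed-#units embed-#units)
          (embed-+′ (embed-*′ embed-q (embed-∑′ xs (λ x → embed-∑′ xs (λ y → K.sym (embed-⟦⟧ (x · y 𝔽.- g 𝔽.≟ 𝔽.0#))))))
            (embed-neg′ (embed-*′ embed-#xs embed-#xs))))))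
      where
      embed-#units : χ-Sums.#units ≈ᶜ embed #units
      embed-#units = embed-∑′ units (λ _ → K.refl)
      embed-#xs : N.#xs ≈ᶜ embed n
      embed-#xs = embed-∑′ xs (λ _ → K.refl)

    P-nonneg : 0# ≤ P
    P-nonneg = ∑-nonneg (points (suc (suc (m ℕ.+ m)))) (λ W → *-nonneg (⟦⟧-nonneg (N.Q W 𝔽.≟ 𝔽.0#)) (norm²-nonneg _))

-- Additive energy of subsets of a sphere.

module Energy (R : Reals) (F : FiniteField) (character : NontrivialAdditiveCharacter R F) where

  private module 𝔽 where
    open FiniteField F public hiding (_-_)
    open FieldProperties F public
    open IntegerSolver commutativeRing public
  open Reals R
  open RealProperties R
  open ComplexProperties R using (conj; conj-∑; norm²-*; embed; embed-⟦⟧; norm²; norm²-cong; norm²-embed; module ℂ-Ring; module ℂ-Sums)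
  open Complex R
  open Geometry F hiding (_∈_)
  open GeometryProperties F
  open ComplexCharacter R F character
  open NontrivialAdditiveCharacter character using (χ; χ-+)
  open 𝔽 using (units; 2#)
  open import Data.List.Membership.Propositional using (_∈_)
  open ≤-Reasoning

  private variable
    d : ℕ

  q≈1+#units : q ≈ 1# + #units
  q≈1+#units = begin-equality
    ι 𝔽.order                      ≡⟨ ≡.cong ι 𝔽.length-elements ⟨
    ι (length 𝔽.elements)          ≈⟨ ∑-length 𝔽.elements ⟨
    ∑ 𝔽.elements (const 1#)        ≈⟨ 𝔽.∑-elements commutativeRing (const 1#) ⟩
    1# + #units                    ∎

  2≤order : 2 ℕ.≤ 𝔽.order
  2≤order = ℕ.≤∧≢⇒< (ℕ.n≢0⇒n>0 𝔽.order≢0) (𝔽.order≢1 ∘ ≡.sym)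

  1≤#units : 1# ≤ #units
  1≤#units = ≤-by-difference (q - ι 2) (x≤y⇒0≤y-x (ι-mono {2} {𝔽.order} 2≤order))
    (trans (solve 1 (λ u → u :- :1 := :1 :+ u :- :2) refl #units) (+-congʳ (sym q≈1+#units)))

  0<#units : 0# < #units
  0<#units = <-≤-trans 0<1 1≤#units

  1≤q : 1# ≤ q
  1≤q = 1≤ι {𝔽.order} (ℕ.≤-trans (ℕ.s≤s ℕ.z≤n) 2≤order)

  0<q : 0# < q
  0<q = <-≤-trans 0<1 1≤q

  #units≤q : #units ≤ q
  #units≤q = ≤-respʳ-≈ (trans (+-comm _ _) (sym q≈1+#units)) (x≤x+y 0≤1)

  q≤2#units : q ≤ #units + #units
  q≤2#units = ≤-respˡ-≈ (sym q≈1+#units) (+-monoˡ-≤ #units 1≤#units)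

  module NullPairs-Bound {g : 𝔽.Carrier} (g-primitive : Primitive F g) {m : ℕ}
    (good : χ-Sums.GaussSigns.GoodSign g-primitive m)
    (xs : List (Point (suc (m ℕ.+ m)))) (xs-unique : Unique xs)
    (∥xs∥≡g : ∀ {x} → x ∈ xs → ∥ x ∥ ≡ g) where

    private module N = NullPairs g-primitive good xs xs-unique ∥xs∥≡g
    open N using (n; Z) public

    -- Inserting `0# ≤ P` into `P-identity` and cancelling `q ^ⁿ suc m * #units` bounds the excess
    -- of q Z over n².
    nullPairs-bound : q * Z ≤ n * n + ι 2 * (q ^ⁿ m * n)
    nullPairs-bound with total (q * Z - n * n) 0#
    ... | inj₁ excess≤0 = begin
      q * Z                        ≈⟨ solve 2 (λ a b → a := b :+ (a :- b)) refl (q * Z) (n * n) ⟩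
      n * n + (q * Z - n * n)      ≤⟨ +-monoʳ-≤ (n * n) (≤-trans excess≤0 0≤2qᵐn) ⟩
      n * n + ι 2 * (q ^ⁿ m * n)   ∎
      where
      0≤2qᵐn : 0# ≤ ι 2 * (q ^ⁿ m * n)
      0≤2qᵐn = *-nonneg (ι-nonneg 2) (*-nonneg (^ⁿ-nonneg m (<⇒≤ 0<q)) (∑-nonneg xs (λ _ → 0≤1)))
    ... | inj₂ 0≤excess = begin
      q * Z                        ≈⟨ solve 2 (λ a b → a := b :+ (a :- b)) refl (q * Z) (n * n) ⟩
      n * n + (q * Z - n * n)      ≤⟨ +-monoʳ-≤ (n * n) (*-cancelˡ-≤ 0<q q*excess≤) ⟩
      n * n + ι 2 * (q ^ⁿ m * n)   ∎
      where
      excess = q * Z - n * n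
      cancelled : #units * excess ≤ q ^ⁿ suc m * n
      cancelled = *-cancelˡ-≤ (*-pos (^ⁿ-pos (suc m) 0<q) 0<#units) (≤-by-difference (q * N.P) (*-nonneg (<⇒≤ 0<q) N.P-nonneg) (begin-equality
        q ^ⁿ suc m * #units * (q ^ⁿ suc m * n) - q ^ⁿ suc m * #units * (#units * excess)
          ≈⟨ solve 4 (λ a u n e → a :* u :* (a :* n) :- a :* u :* (u :* e) := (a :* a) :* (u :* n) :+ (:- a) :* (u :* u :* e))
               refl (q ^ⁿ suc m) #units n excess ⟩
        q ^ⁿ suc m * q ^ⁿ suc m * (#units * n) + - (q ^ⁿ suc m) * (#units * #units * excess)
          ≈⟨ +-congʳ (*-congʳ (trans (sym (^ⁿ-homo-* q (suc m) (suc m))) (reflexive (≡.cong (q ^ⁿ_) (≡.cong suc (ℕ.+-suc m m)))))) ⟩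
        q ^ⁿ suc (suc (m ℕ.+ m)) * (#units * n) + - (q ^ⁿ suc m) * (#units * #units * excess)
          ≈⟨ N.P-identity ⟨
        q * N.P ∎))
      -- The factor 2 arises because `#units` has been cancelled where q is wanted. The comparison q
      -- ≤ 2 (q - 1) is multiplied by the excess, which is why its sign was decided beforehand.
      q*excess≤ : q * excess ≤ q * (ι 2 * (q ^ⁿ m * n))
      q*excess≤ = begin
        q * excess                    ≤⟨ *-monoʳ-≤ 0≤excess q≤2#units ⟩
        (#units + #units) * excess    ≈⟨ solve 2 (λ u e → (u :+ u) :* e := :2 :* (u :* e)) refl #units excess ⟩
        ι 2 * (#units * excess)       ≤⟨ *-monoˡ-≤ (ι-nonneg 2) cancelled ⟩
        ι 2 * (q * q ^ⁿ m * n)        ≈⟨ solve 3 (λ q a n → :2 :* (q :* a :* n) := q :* (:2 :* (a :* n))) refl q (q ^ⁿ m) n ⟩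
        q * (ι 2 * (q ^ⁿ m * n))      ∎

  weight-of : ∀ {p} {P : Set p} → Dec P → ℝ
  weight-of (yes _) = q
  weight-of (no _)  = 1#

  -- A bound for the number of further points of the sphere on the line through a
  -- point x of the sphere in direction w: null lines may lie on the sphere.
  weight coweight : Point d → ℝ
  weight   w = weight-of (∥ w ∥ 𝔽.≟ 𝔽.0#)
  coweight w = weight w ⁻¹

  0<weight : ∀ (w : Point d) → 0# < weight w
  0<weight w with ∥ w ∥ 𝔽.≟ 𝔽.0#
  ... | yes _ = 0<q
  ... | no _  = 0<1

  coweight*weight : ∀ (w : Point d) → coweight w * weight w ≈ 1#
  coweight*weight w = trans (*-comm _ _) (*-inverse (<⇒≉ (0<weight w)))

  0≤coweight : ∀ (w : Point d) → 0# ≤ coweight w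
  0≤coweight w = <⇒≤ (⁻¹-pos (0<weight w))

  weight≤ : ∀ (w : Point d) → weight w ≤ 1# + q * ⟦ ∥ w ∥ 𝔽.≟ 𝔽.0# ⟧
  weight≤ w with ∥ w ∥ 𝔽.≟ 𝔽.0#
  ... | yes ∥w∥≡0 = begin
    q                                      ≤⟨ x≤x+y 0≤1 ⟩
    q + 1#                                 ≈⟨ trans (+-comm q 1#) (+-congˡ (sym (trans (*-congˡ (⟦⟧-yes (∥ w ∥ 𝔽.≟ 𝔽.0#) ∥w∥≡0)) (*-identityʳ q)))) ⟩
    1# + q * ⟦ ∥ w ∥ 𝔽.≟ 𝔽.0# ⟧            ∎
  ... | no _  = x≤x+y (*-nonneg (<⇒≤ 0<q) (⟦⟧-nonneg (∥ w ∥ 𝔽.≟ 𝔽.0#)))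

  weight-of-cong : ∀ {p r} {P : Set p} {P′ : Set r} (P? : Dec P) (P′? : Dec P′) → (P → P′) → (P′ → P) →
                   weight-of P? ≈ weight-of P′?
  weight-of-cong (yes p) (yes _)  _ _ = refl
  weight-of-cong (no _)  (no _)   _ _ = refl
  weight-of-cong (yes p) (no ¬p′) f _ = contradiction (f p) ¬p′
  weight-of-cong (no ¬p) (yes p′) _ h = contradiction (h p′) ¬p

  module _ {t : 𝔽.Carrier} (t≢0 : t ≢ 𝔽.0#) (w : Point d) where

    private
      null⇒ : ∥ t ⊛ w ∥ ≡ 𝔽.0# → ∥ w ∥ ≡ 𝔽.0#
      null⇒ eq = 𝔽.xy≡0⇒y≡0 (𝔽.*-≢0 t≢0 t≢0) (≡.trans (≡.sym (∥⊛∥ t w)) eq)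
      null⇐ : ∥ w ∥ ≡ 𝔽.0# → ∥ t ⊛ w ∥ ≡ 𝔽.0#
      null⇐ eq = ≡.trans (∥⊛∥ t w) (≡.trans (≡.cong (t 𝔽.* t 𝔽.*_) eq) (𝔽.zeroʳ _))

    weight-⊛ : weight (t ⊛ w) ≈ weight w
    weight-⊛ = weight-of-cong (∥ t ⊛ w ∥ 𝔽.≟ 𝔽.0#) (∥ w ∥ 𝔽.≟ 𝔽.0#) null⇒ null⇐

    coweight-⊛ : coweight (t ⊛ w) ≈ coweight w
    coweight-⊛ = ⁻¹-cong weight-⊛

  -- The difference of the sides is ω (H λ′ - u)². Summed termwise it replaces the Cauchy-Schwarz
  -- inequality, so that no square root of a sum appears; `H` is chosen such that both sums on the
  -- right have the same bound.
  weighted-AM-GM : ∀ {ω λ′} H u → 0# ≤ ω → ω * λ′ ≈ 1# → ι 2 * (H * u) ≤ H * H * λ′ + ω * (u * u)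
  weighted-AM-GM {ω} {λ′} H u 0≤ω ωλ≈1 = ≤-by-difference (ω * ((H * λ′ - u) * (H * λ′ - u))) (*-nonneg 0≤ω (0≤x² _)) (begin-equality
    H * H * λ′ + ω * (u * u) - ι 2 * (H * u)
      ≈⟨ solve 4 (λ H l w u → H :* H :* l :+ w :* (u :* u) :- :2 :* (H :* u) :=
           H :* H :* l :* :1 :+ w :* (u :* u) :- :2 :* (H :* u) :* :1) refl H λ′ ω u ⟩
    H * H * λ′ * 1# + ω * (u * u) - ι 2 * (H * u) * 1#
      ≈⟨ +-cong (+-congʳ (*-congˡ ωλ≈1)) (-‿cong (*-congˡ ωλ≈1)) ⟨
    H * H * λ′ * (ω * λ′) + ω * (u * u) - ι 2 * (H * u) * (ω * λ′)
      ≈⟨ solve 4 (λ H l w u → H :* H :* l :* (w :* l) :+ w :* (u :* u) :- :2 :* (H :* u) :* (w :* l) :=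
           w :* ((H :* l :- u) :* (H :* l :- u))) refl H λ′ ω u ⟩
    ω * ((H * λ′ - u) * (H * λ′ - u)) ∎)

  -- Right angles in a subset of the sphere, with `H` in the role of q^(d/2).

  module Sphere-Energy {g : 𝔽.Carrier} (g≢0 : g ≢ 𝔽.0#) (xs : List (Point d)) (xs-unique : Unique xs)
    (∥xs∥≡g : ∀ {x} → x ∈ xs → ∥ x ∥ ≡ g) (H : ℝ) (0<H : 0# < H) (H²≈q^d : H * H ≈ q ^ⁿ d) where

    n : ℝ
    n = ∑ xs (const 1#)

    module Apex {x : Point d} (x∈xs : x ∈ xs) where

      scaled : List (𝔽.Carrier × Point d)
      scaled = cartesianProduct units xs

      v : 𝔽.Carrier × Point d → Point d
      v (t , y) = t ⊛ (y -ᵖ x)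

      scaled-unit : ∀ {i} → i ∈ scaled → proj₁ i ≢ 𝔽.0#
      scaled-unit i∈ = 𝔽.units-≢0 (proj₁ (∈.∈-cartesianProduct⁻ units xs i∈))

      scaled-∈ : ∀ {i} → i ∈ scaled → proj₂ i ∈ xs
      scaled-∈ i∈ = proj₂ (∈.∈-cartesianProduct⁻ units xs i∈)

      ∑-scaled : ∀ (f : Point d → ℝ) → ∑ scaled (λ (_ , y) → f y) ≈ #units * ∑ xs f
      ∑-scaled f = trans (∑-cartesianProduct units xs _)
        (trans (∑-cong units (λ _ → sym (*-identityˡ _))) (sym (∑-* units (const 1#) _)))

      reps : Point d → ℝ
      reps w = ∑ scaled (λ i → ⟦ w ≟ᵖ v i ⟧)

      -- A line through x which is not contained in the sphere meets it in at most
      -- one further point.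
      representation-unique : ∀ {w i j} → ∥ w ∥ ≢ 𝔽.0# → i ∈ scaled → j ∈ scaled → w ≡ v i → w ≡ v j → i ≡ j
      representation-unique {w} {t , y} {s , z} ∥w∥≢0 i∈ j∈ w≡vi w≡vj = same-scale t≡s w≡vi w≡vj
        where
        c = 𝔽.- (2# 𝔽.* (x · w))
        tc≡ : t 𝔽.* c ≡ ∥ w ∥
        tc≡ = scale-determined x (∥xs∥≡g x∈xs) y (∥xs∥≡g (scaled-∈ i∈)) w≡vi
        sc≡ : s 𝔽.* c ≡ ∥ w ∥
        sc≡ = scale-determined x (∥xs∥≡g x∈xs) z (∥xs∥≡g (scaled-∈ j∈)) w≡vj
        c≢0 : c ≢ 𝔽.0#
        c≢0 c≡0 = ∥w∥≢0 (≡.trans (≡.sym tc≡) (≡.trans (≡.cong (t 𝔽.*_) c≡0) (𝔽.zeroʳ t)))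
        t≡s : t ≡ s
        t≡s = 𝔽.*-cancelˡ c≢0 (≡.trans (𝔽.*-comm c t) (≡.trans tc≡ (≡.trans (≡.sym sc≡) (𝔽.*-comm s c))))
        same-scale : t ≡ s → w ≡ t ⊛ (y -ᵖ x) → w ≡ s ⊛ (z -ᵖ x) → (t , y) ≡ (s , z)
        same-scale ≡.refl p r = ≡.cong (t ,_)
          (-ᵖ-cancelʳ y z x (⊛-cancelˡ (scaled-unit i∈) (y -ᵖ x) (z -ᵖ x) (≡.trans (≡.sym p) r)))

      reps≤weight : ∀ w → reps w ≤ weight w
      reps≤weight w with ∥ w ∥ 𝔽.≟ 𝔽.0#
      ... | no ∥w∥≢0 = ∑-atMostOne (λ i → w ≟ᵖ v i) (Unique.cartesianProduct⁺ 𝔽.units-unique xs-unique)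
                         (representation-unique ∥w∥≢0)
      -- Even if the line lies on the sphere, every scale admits at most one point, and there are q
      -- - 1 scales.
      ... | yes _ = begin
        reps w
          ≈⟨ ∑-cartesianProduct units xs _ ⟩
        ∑ units (λ t → ∑ xs (λ z → ⟦ w ≟ᵖ v (t , z) ⟧))
          ≤⟨ ∑-mono∈ units (λ {t} t∈ → ∑-atMostOne (λ z → w ≟ᵖ v (t , z)) xs-unique (λ {y} {z} _ _ p r →
               -ᵖ-cancelʳ y z x (⊛-cancelˡ (𝔽.units-≢0 t∈) (y -ᵖ x) (z -ᵖ x) (≡.trans (≡.sym p) r)))) ⟩
        #units
          ≤⟨ #units≤q ⟩
        q ∎

      W : ℝ
      W = ∑ xs (λ y → weight (y -ᵖ x))

      coincidences≤ : ∑ scaled (λ i → reps (v i)) ≤ #units * W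
      coincidences≤ = begin
        ∑ scaled (λ i → reps (v i))
          ≤⟨ ∑-mono scaled (λ i → reps≤weight (v i)) ⟩
        ∑ scaled (λ i → weight (v i))
          ≈⟨ ∑-cong∈ scaled (λ {(t , y)} i∈ → weight-⊛ (scaled-unit i∈) (y -ᵖ x)) ⟩
        ∑ scaled (λ (_ , y) → weight (y -ᵖ x))
          ≈⟨ ∑-scaled (λ y → weight (y -ᵖ x)) ⟩
        #units * W ∎

      -- q times the deviation of the number of `y` with `w · (y - x) = 0` from its expected value
      -- n/q. The sum over the scales turns the exponential sum of the family `v` into this real
      -- number.
      M : Point d → ℝ
      M w = ∑ xs (λ y → q * ⟦ w · (y -ᵖ x) 𝔽.≟ 𝔽.0# ⟧ - 1#)

      M-⊛ : ∀ {t} → t ≢ 𝔽.0# → ∀ w → M (t ⊛ w) ≈ M w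
      M-⊛ {t} t≢0 w = ∑-cong xs (λ y → +-congʳ (*-congˡ (⟦⟧-cong (t ⊛ w · (y -ᵖ x) 𝔽.≟ 𝔽.0#) (w · (y -ᵖ x) 𝔽.≟ 𝔽.0#)
        (λ eq → 𝔽.xy≡0⇒y≡0 t≢0 (≡.trans (≡.sym (⊛-· t w (y -ᵖ x))) eq))
        (λ eq → ≡.trans (⊛-· t w (y -ᵖ x)) (≡.trans (≡.cong (t 𝔽.*_) eq) (𝔽.zeroʳ t))))))

      expSum≈M : ∀ w → χ-Sums.expSum scaled v w ≈ᶜ embed (M w)
      expSum≈M w = ℂ-Ring.trans (ℂ-Sums.∑-cartesianProduct units xs _)
        (ℂ-Ring.trans (ℂ-Sums.∑-swap units xs _)
        (embed-∑′ xs (λ y → ℂ-Ring.trans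
          (ℂ-Sums.∑-cong units (λ t → χ-Sums.χ-cong (·-⊛ t w (y -ᵖ x))))
          (ℂ-Ring.trans (χ-Sums.ψ-indicator (w · (y -ᵖ x)))
            (embed-+′ (embed-*′ embed-q (ℂ-Ring.sym (embed-⟦⟧ (w · (y -ᵖ x) 𝔽.≟ 𝔽.0#)))) (embed-neg′ ℂ-Ring.refl))))))

      ∑-M² : ∑ (points d) (λ w → M w * M w) ≈ q ^ⁿ d * ∑ scaled (λ i → reps (v i))
      ∑-M² = trans (∑-cong (points d) (λ w → sym (trans (norm²-cong (expSum≈M w)) (norm²-embed (M w)))))
        (plancherel scaled v)

      -- Both `M` and `coweight` are invariant under dilation, so the sum over chords may be
      -- averaged over all their multiples. Grouped by value, a vector `w` then occurs `reps w`
      -- times, at most `weight w`; the coweight cancels this multiplicity exactly and leaves the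
      -- second moment of `M` over the whole space.
      weighted-M² : ∑ xs (λ z → coweight (z -ᵖ x) * (M (z -ᵖ x) * M (z -ᵖ x))) ≤ H * H * W
      weighted-M² = *-cancelˡ-≤ 0<#units (begin
        #units * ∑ xs (λ z → coweight (z -ᵖ x) * (M (z -ᵖ x) * M (z -ᵖ x)))
          ≈⟨ ∑-scaled _ ⟨
        ∑ scaled (λ (_ , z) → coweight (z -ᵖ x) * (M (z -ᵖ x) * M (z -ᵖ x)))
          ≈⟨ ∑-cong∈ scaled (λ {(t , z)} i∈ → sym (*-cong (coweight-⊛ (scaled-unit i∈) (z -ᵖ x))
               (*-cong (M-⊛ (scaled-unit i∈) (z -ᵖ x)) (M-⊛ (scaled-unit i∈) (z -ᵖ x))))) ⟩
        ∑ scaled (λ i → F₂ (v i))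
          ≈⟨ ∑-cong scaled (λ i → sym (Kronecker.∑-δ _≟ᵖ_ (points-unique d) (∈-points (v i)) F₂)) ⟩
        ∑ scaled (λ i → ∑ (points d) (λ w → ⟦ w ≟ᵖ v i ⟧ * F₂ w))
          ≈⟨ ∑-swap scaled (points d) _ ⟩
        ∑ (points d) (λ w → ∑ scaled (λ i → ⟦ w ≟ᵖ v i ⟧ * F₂ w))
          ≈⟨ ∑-cong (points d) (λ w → sym (∑-* scaled _ (F₂ w))) ⟩
        ∑ (points d) (λ w → reps w * F₂ w)
          ≤⟨ ∑-mono (points d) (λ w → *-monoʳ-≤ (*-nonneg (0≤coweight w) (0≤x² (M w))) (reps≤weight w)) ⟩
        ∑ (points d) (λ w → weight w * F₂ w)
          ≈⟨ ∑-cong (points d) (λ w → trans (sym (*-assoc _ _ _)) (trans (*-congʳ (trans (*-comm _ _) (coweight*weight w))) (*-identityˡ _))) ⟩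
        ∑ (points d) (λ w → M w * M w)
          ≈⟨ ∑-M² ⟩
        q ^ⁿ d * ∑ scaled (λ i → reps (v i))
          ≤⟨ *-monoˡ-≤ (^ⁿ-nonneg d (<⇒≤ 0<q)) coincidences≤ ⟩
        q ^ⁿ d * (#units * W)
          ≈⟨ *-congʳ H²≈q^d ⟨
        H * H * (#units * W)
          ≈⟨ solve 3 (λ h u w → h :* h :* (u :* w) := u :* (h :* h :* w)) refl H #units W ⟩
        #units * (H * H * W) ∎)
        where
        F₂ : Point d → ℝ
        F₂ w = coweight w * (M w * M w)

      ∑-M≤ : ∑ xs (λ z → M (z -ᵖ x)) ≤ H * W
      ∑-M≤ = *-cancelˡ-≤ (*-pos (0<ι 1) 0<H) (begin
        ι 2 * H * ∑ xs (λ z → M (z -ᵖ x))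
          ≈⟨ trans (*-∑ xs _ _) (∑-cong xs (λ z → *-assoc _ _ _)) ⟩
        ∑ xs (λ z → ι 2 * (H * M (z -ᵖ x)))
          ≤⟨ ∑-mono xs (λ z → weighted-AM-GM H (M (z -ᵖ x)) (0≤coweight (z -ᵖ x)) (coweight*weight (z -ᵖ x))) ⟩
        ∑ xs (λ z → H * H * weight (z -ᵖ x) + coweight (z -ᵖ x) * (M (z -ᵖ x) * M (z -ᵖ x)))
          ≈⟨ trans (∑-+ xs _ _) (+-congʳ (sym (*-∑ xs _ _))) ⟩
        H * H * W + ∑ xs (λ z → coweight (z -ᵖ x) * (M (z -ᵖ x) * M (z -ᵖ x)))
          ≤⟨ +-monoʳ-≤ _ weighted-M² ⟩
        H * H * W + H * H * W
          ≈⟨ solve 2 (λ h w → h :* h :* w :+ h :* h :* w := :2 :* h :* (h :* w)) refl H W ⟩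
        ι 2 * H * (H * W) ∎)

      T : ℝ
      T = ∑ xs (λ z → ∑ xs (λ y → ⟦ (z -ᵖ x) · (y -ᵖ x) 𝔽.≟ 𝔽.0# ⟧))

      qT≤ : q * T ≤ n * n + H * W
      qT≤ = begin
        q * T
          ≈⟨ trans (*-∑ xs _ _) (∑-cong xs (λ z → trans (*-∑ xs _ _) (trans
               (∑-cong xs (λ y → solve 1 (λ a → a := a :- :1 :+ :1) refl _)) (∑-+ xs _ _)))) ⟩
        ∑ xs (λ z → M (z -ᵖ x) + n)
          ≈⟨ trans (∑-+ xs _ _) (+-comm _ _) ⟩
        ∑ xs (λ _ → n) + ∑ xs (λ z → M (z -ᵖ x))
          ≤⟨ +-mono-≤ (≤-reflexive (trans (∑-cong xs (λ _ → sym (*-identityˡ n))) (sym (∑-* xs (const 1#) n)))) ∑-M≤ ⟩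
        n * n + H * W ∎

    ∑W : ℝ
    ∑W = ∑ xs (λ x → ∑ xs (λ y → weight (y -ᵖ x)))

    nullPairs : ℝ
    nullPairs = ∑ xs (λ x → ∑ xs (λ y → ⟦ x · y 𝔽.- g 𝔽.≟ 𝔽.0# ⟧))

    ∑-n : ∑ xs (const n) ≈ n * n
    ∑-n = trans (∑-cong xs (λ _ → sym (*-identityˡ n))) (sym (∑-* xs (const 1#) n))

    ∑W≤ : ∑W ≤ n * n + q * nullPairs
    ∑W≤ = begin
      ∑W
        ≤⟨ ∑-mono∈ xs (λ x∈ → ∑-mono∈ xs (λ y∈ → weight≤′ x∈ y∈)) ⟩
      ∑ xs (λ x → ∑ xs (λ y → 1# + q * ⟦ x · y 𝔽.- g 𝔽.≟ 𝔽.0# ⟧))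
        ≈⟨ ∑-cong xs (λ x → trans (∑-+ xs _ _) (+-congˡ (sym (*-∑ xs q _)))) ⟩
      ∑ xs (λ x → n + q * ∑ xs (λ y → ⟦ x · y 𝔽.- g 𝔽.≟ 𝔽.0# ⟧))
        ≈⟨ trans (∑-+ xs _ _) (+-cong ∑-n (sym (*-∑ xs q _))) ⟩
      n * n + q * nullPairs ∎
      where
      weight≤′ : ∀ {x y} → x ∈ xs → y ∈ xs → weight (y -ᵖ x) ≤ 1# + q * ⟦ x · y 𝔽.- g 𝔽.≟ 𝔽.0# ⟧
      weight≤′ {x} {y} x∈ y∈ = ≤-trans (weight≤ (y -ᵖ x)) (+-monoʳ-≤ 1# (*-monoˡ-≤ (<⇒≤ 0<q)
        (⟦⟧-mono (∥ y -ᵖ x ∥ 𝔽.≟ 𝔽.0#) (x · y 𝔽.- g 𝔽.≟ 𝔽.0#) (null⇒dot≡g x (∥xs∥≡g x∈) y (∥xs∥≡g y∈)))))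

    energy : ℝ
    energy = ∑ xs (λ x → ∑ xs (λ y → ∑ xs (λ z → ∑ xs (λ w → ⟦ x +ᵖ y ≟ᵖ z +ᵖ w ⟧))))

    energy≤ : q * energy ≤ n * (n * n) + H * (n * n + q * nullPairs)
    energy≤ = begin
      q * energy
        ≈⟨ *-∑ xs q _ ⟩
      ∑ xs (λ x → q * ∑ xs (λ y → ∑ xs (λ z → ∑ xs (λ w → ⟦ x +ᵖ y ≟ᵖ z +ᵖ w ⟧))))
        ≤⟨ ∑-mono∈ xs (λ x∈ → ≤-trans (*-monoˡ-≤ (<⇒≤ 0<q) (corner x∈)) (Apex.qT≤ x∈)) ⟩
      ∑ xs (λ x → n * n + H * ∑ xs (λ y → weight (y -ᵖ x)))
        ≈⟨ trans (∑-+ xs _ _) (+-cong (trans (∑-cong xs (λ _ → sym (*-identityˡ (n * n)))) (sym (∑-* xs (const 1#) (n * n)))) (sym (*-∑ xs H _))) ⟩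
      n * (n * n) + H * ∑W
        ≤⟨ +-monoʳ-≤ _ (*-monoˡ-≤ (<⇒≤ 0<H) ∑W≤) ⟩
      n * (n * n) + H * (n * n + q * nullPairs) ∎
      where
      corner : ∀ {x} → x ∈ xs → ∑ xs (λ y → ∑ xs (λ z → ∑ xs (λ w → ⟦ x +ᵖ y ≟ᵖ z +ᵖ w ⟧))) ≤
               ∑ xs (λ z → ∑ xs (λ w → ⟦ (z -ᵖ x) · (w -ᵖ x) 𝔽.≟ 𝔽.0# ⟧))
      corner {x} x∈ = begin
        ∑ xs (λ y → ∑ xs (λ z → ∑ xs (λ w → ⟦ x +ᵖ y ≟ᵖ z +ᵖ w ⟧)))
          -- The sum over `y` becomes innermost, because `x`, `z` and `w` leave at most one choice
          -- for it; what remains is the indicator of a right angle at `x`.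
          ≈⟨ trans (∑-swap xs xs _) (∑-cong xs (λ z → ∑-swap xs xs _)) ⟩
        ∑ xs (λ z → ∑ xs (λ w → ∑ xs (λ y → ⟦ x +ᵖ y ≟ᵖ z +ᵖ w ⟧)))
          ≤⟨ ∑-mono∈ xs (λ {z} z∈ → ∑-mono∈ xs (λ {w} w∈ → fourth z∈ w∈ ((z -ᵖ x) · (w -ᵖ x) 𝔽.≟ 𝔽.0#))) ⟩
        ∑ xs (λ z → ∑ xs (λ w → ⟦ (z -ᵖ x) · (w -ᵖ x) 𝔽.≟ 𝔽.0# ⟧)) ∎
        where
        fourth : ∀ {z w} → z ∈ xs → w ∈ xs → (P? : Dec ((z -ᵖ x) · (w -ᵖ x) ≡ 𝔽.0#)) →
                 ∑ xs (λ y → ⟦ x +ᵖ y ≟ᵖ z +ᵖ w ⟧) ≤ ⟦ P? ⟧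
        fourth {z} {w} z∈ w∈ (yes _) = ∑-atMostOne (λ y → x +ᵖ y ≟ᵖ z +ᵖ w) xs-unique
          (λ {y} {y′} _ _ p r → ≡.trans (+ᵖ≡+ᵖ⇒≡ x y z w p) (≡.sym (+ᵖ≡+ᵖ⇒≡ x y′ z w r)))
        fourth {z} {w} z∈ w∈ (no ¬rect) = ≤-reflexive (trans
          (∑-cong∈ xs (λ {y} y∈ → ⟦⟧-no (x +ᵖ y ≟ᵖ z +ᵖ w) (¬rect ∘ parallelogram⇒rectangle x (∥xs∥≡g x∈) y z w (∥xs∥≡g y∈) (∥xs∥≡g z∈) (∥xs∥≡g w∈))))
          (∑-0 xs))

  -- The square of the exponential sum of `xs` is the exponential sum of the family of all x + y, so
  -- Plancherel's identity for this family counts the additive quadruples.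
  ∑-norm⁴ : ∀ (xs : List (Point d)) →
    ∑ (points d) (λ w → norm² (ℂ-Sums.∑ xs (λ y → χ (𝔽.- (w · y)))) * norm² (ℂ-Sums.∑ xs (λ y → χ (𝔽.- (w · y))))) ≈
    q ^ⁿ d * ∑ xs (λ x → ∑ xs (λ y → ∑ xs (λ z → ∑ xs (λ w → ⟦ x +ᵖ y ≟ᵖ z +ᵖ w ⟧))))
  ∑-norm⁴ {d} xs = begin-equality
    ∑ (points d) (λ w → norm² (S⁻ w) * norm² (S⁻ w))
      ≈⟨ ∑-cong (points d) (λ w → *-cong (norm²-S⁻ w) (norm²-S⁻ w)) ⟩
    ∑ (points d) (λ w → norm² (S w) * norm² (S w))
      ≈⟨ ∑-cong (points d) (λ w → trans (norm²-cong (expSum≈S² w)) (norm²-* (S w) (S w))) ⟨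
    ∑ (points d) (λ w → norm² (χ-Sums.expSum pairs plus w))
      ≈⟨ plancherel pairs plus ⟩
    q ^ⁿ d * ∑ pairs (λ i → ∑ pairs (λ j → ⟦ plus i ≟ᵖ plus j ⟧))
      ≈⟨ *-congˡ (trans (∑-cong pairs (λ i → ∑-cartesianProduct xs xs _)) (∑-cartesianProduct xs xs _)) ⟩
    q ^ⁿ d * ∑ xs (λ x → ∑ xs (λ y → ∑ xs (λ z → ∑ xs (λ w → ⟦ x +ᵖ y ≟ᵖ z +ᵖ w ⟧)))) ∎
    where
    S S⁻ : Point d → ℂ
    S  w = ℂ-Sums.∑ xs (λ y → χ (w · y))
    S⁻ w = ℂ-Sums.∑ xs (λ y → χ (𝔽.- (w · y)))
    pairs = cartesianProduct xs xs
    plus : Point d × Point d → Point d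
    plus (x , y) = x +ᵖ y
    norm²-conj : ∀ z → norm² (conj z) ≈ norm² z
    norm²-conj z = solve 2 (λ a b → a :* a :+ (:- b) :* (:- b) := a :* a :+ b :* b) refl (re z) (im z)
    norm²-S⁻ : ∀ w → norm² (S⁻ w) ≈ norm² (S w)
    norm²-S⁻ w = trans (norm²-cong (ℂ-Ring.trans (ℂ-Sums.∑-cong xs (λ y → χ-neg (w · y))) (ℂ-Ring.sym (conj-∑ xs _)))) (norm²-conj (S w))
    expSum≈S² : ∀ w → χ-Sums.expSum pairs plus w ≈ᶜ S w *ᶜ S w
    expSum≈S² w = ℂ-Ring.trans (ℂ-Sums.∑-cartesianProduct xs xs _)
      (ℂ-Ring.trans (ℂ-Sums.∑-cong xs (λ x → ℂ-Sums.∑-cong xs (λ y →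
        ℂ-Ring.trans (χ-Sums.χ-cong (·-distribˡ-+ w x y)) (χ-+ _ _))))
      (ℂ-Ring.sym (ℂ-Sums.∑-*-∑ xs xs _ _)))

-- Deletion of points and the decay of additive energy.

module Subsets (R : Reals) (F : FiniteField) where

  open Reals R
  open RealProperties R
  open FiniteField F using () renaming (_≟_ to _≟ᶠ_)
  open Geometry F renaming (_∈_ to _∈ᴱ_)
  open GeometryProperties F
  open import Data.Bool.Base as Bool using (_∧_; not)
  open import Data.Bool.Properties using (T?; T-∧)
  open import Data.List.Membership.Propositional using (_∈_)
  import Data.List.Relation.Unary.Unique.DecPropositional.Properties as UniqueDec
  open import Function.Bundles using (Equivalence)
  open ≤-Reasoning

  private variable
    ℓ : Level
    A : Set ℓ
    d : ℕ

  ∣∣≈∑ : ∀ (E : Subset d) → ι ∣ E ∣ ≈ ∑ (members E) (const 1#)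
  ∣∣≈∑ E = sym (∑-length (members E))

  ∑-length-filter : ∀ {p} {P : A → Set p} (P? : ∀ x → Dec (P x)) (xs : List A) →
                    ι (length (filter P? xs)) ≈ ∑ xs (λ x → ⟦ P? x ⟧)
  ∑-length-filter P? xs = trans (sym (∑-length (filter P? xs)))
    (trans (∑-filter P? xs (const 1#)) (∑-cong xs (λ x → *-identityʳ _)))

  quadSum : Subset d → (Point d → Point d → Point d → Point d → ℝ) → ℝ
  quadSum E f = ∑ (members E) (λ x → ∑ (members E) (λ y → ∑ (members E) (λ z → ∑ (members E) (λ w → f x y z w))))

  Λ₄≈ : ∀ (E : Subset d) → ι (Λ₄ E) ≈ quadSum E (λ x y z w → ⟦ x +ᵖ y ≟ᵖ z +ᵖ w ⟧)
  Λ₄≈ E = trans (∑-length-filter (λ ((x , y) , (z , w)) → x +ᵖ y ≟ᵖ z +ᵖ w) (cartesianProduct pairs pairs))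
    (trans (∑-cartesianProduct pairs pairs _) (trans (∑-cong pairs (λ (x , y) → ∑-cartesianProduct (members E) (members E) _))
    (∑-cartesianProduct (members E) (members E) _)))
    where pairs = cartesianProduct (members E) (members E)

  ⊆⇒length≤ : (_≟_ : DecidableEquality A) {xs ys : List A} → Unique xs → Unique ys →
              (∀ {x} → x ∈ xs → x ∈ ys) → ι (length xs) ≤ ι (length ys)
  ⊆⇒length≤ _≟_ {xs} {ys} xs! ys! xs⊆ys = begin
    ι (length xs)                           ≈⟨ ∑-length xs ⟨
    ∑ xs (const 1#)                         ≈⟨ ∑-cong∈ xs (λ {x} x∈ → trans (∑-cong ys (λ y → sym (*-identityʳ _))) (Kronecker.∑-δ _≟_ ys! (xs⊆ys x∈) (const 1#))) ⟨
    ∑ xs (λ x → ∑ ys (λ y → ⟦ y ≟ x ⟧))     ≈⟨ ∑-swap xs ys _ ⟩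
    ∑ ys (λ y → ∑ xs (λ x → ⟦ y ≟ x ⟧))     ≤⟨ ∑-mono ys (λ y → ∑-atMostOne (λ x → y ≟ x) xs! (λ _ _ p q → ≡.trans (≡.sym p) q)) ⟩
    ∑ ys (const 1#)                         ≈⟨ ∑-length ys ⟩
    ι (length ys)                           ∎

  Δ-mono : ∀ {E E′ : Subset d} → (∀ {x} → x ∈ᴱ E′ → x ∈ᴱ E) → ι ∣Δ E′ ∣ ≤ ι ∣Δ E ∣
  Δ-mono {E = E} {E′} E′⊆E = ⊆⇒length≤ _≟ᶠ_ (UniqueDec.deduplicate-! _≟ᶠ_ _) (UniqueDec.deduplicate-! _≟ᶠ_ _)
    (λ t∈ → ∈.∈-deduplicate⁺ _≟ᶠ_ (distances⊆ (∈.∈-deduplicate⁻ _≟ᶠ_ (distances E′) t∈)))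
    where
    distances : Subset _ → List _
    distances E = cartesianProductWith (λ x y → ∥ x -ᵖ y ∥) (members E) (members E)
    distances⊆ : ∀ {t} → t ∈ distances E′ → t ∈ distances E
    distances⊆ t∈ with ∈.∈-cartesianProductWith⁻ (λ x y → ∥ x -ᵖ y ∥) (members E′) (members E′) t∈
    ... | x , y , x∈ , y∈ , ≡.refl = ∈.∈-cartesianProductWith⁺ (λ x y → ∥ x -ᵖ y ∥)
      (∈-members {E = E} (E′⊆E (members-∈ x∈))) (∈-members {E = E} (E′⊆E (members-∈ y∈)))

  infixl 5 _∖_
  _∖_ : Subset d → Point d → Subset d
  (E ∖ a) x = E x ∧ not (does (x ≟ᵖ a))

  ∖-⊆ : ∀ {E : Subset d} {a x} → x ∈ᴱ (E ∖ a) → x ∈ᴱ E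
  ∖-⊆ {E = E} {a} {x} x∈ = proj₁ (Equivalence.to (T-∧ {E x}) x∈)

  ∑-∖ : ∀ (E : Subset d) a f → ∑ (members (E ∖ a)) f ≈ ∑ (members E) (λ x → ⟦ ¬? (x ≟ᵖ a) ⟧ * f x)
  ∑-∖ E a f = begin-equality
    ∑ (members (E ∖ a)) f
      ≈⟨ ∑-filter (λ x → T? ((E ∖ a) x)) (points _) f ⟩
    ∑ (points _) (λ x → ⟦ T? ((E ∖ a) x) ⟧ * f x)
      ≈⟨ ∑-cong (points _) (λ x → trans (*-congʳ (product (E x) (x ≟ᵖ a))) (*-assoc _ _ _)) ⟩
    ∑ (points _) (λ x → ⟦ T? (E x) ⟧ * (⟦ ¬? (x ≟ᵖ a) ⟧ * f x))
      ≈⟨ ∑-filter (λ x → T? (E x)) (points _) _ ⟨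
    ∑ (members E) (λ x → ⟦ ¬? (x ≟ᵖ a) ⟧ * f x) ∎
    where
    product : ∀ {P : Set} b (P? : Dec P) → ⟦ T? (b ∧ not (does P?)) ⟧ ≈ ⟦ T? b ⟧ * ⟦ ¬? P? ⟧
    product Bool.true  (yes _) = sym (*-identityˡ _)
    product Bool.true  (no _)  = sym (*-identityˡ _)
    product Bool.false P?      = sym (zeroˡ _)

  ι-injective : ∀ {m n} → ι m ≈ ι n → m ≡ n
  ι-injective {m} {n} eq = ℕ.≤-antisym (≤-from n (≤-reflexive eq)) (≤-from m (≤-reflexive (sym eq)))
    where
    ≤-from : ∀ {m} n → ι m ≤ ι n → m ℕ.≤ n
    ≤-from {m} n ιm≤ιn = ℕ.≮⇒≥ (λ n<m → proj₂ 0<1 (antisym 0≤1 (begin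
      1#                   ≈⟨ solve 1 (λ a → :1 := :1 :+ a :- a) refl (ι n) ⟩
      1# + ι n - ι n       ≤⟨ +-monoˡ-≤ (- ι n) (≤-trans (ι-mono {suc n} {m} n<m) ιm≤ιn) ⟩
      ι n - ι n            ≈⟨ -‿inverseʳ (ι n) ⟩
      0#                   ∎)))

  ∣∖∣ : ∀ {E : Subset d} {a} → a ∈ members E → suc ∣ E ∖ a ∣ ≡ ∣ E ∣
  ∣∖∣ {E = E} {a} a∈ = ι-injective (begin-equality
    1# + ι ∣ E ∖ a ∣
      ≈⟨ +-cong (sym (Kronecker.∑-δ _≟ᵖ_ (members-unique E) a∈ (const 1#))) (trans (∣∣≈∑ (E ∖ a)) (∑-∖ E a (const 1#))) ⟩
    ∑ (members E) (λ x → ⟦ x ≟ᵖ a ⟧ * 1#) + ∑ (members E) (λ x → ⟦ ¬? (x ≟ᵖ a) ⟧ * 1#)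
      ≈⟨ ∑-+ (members E) _ _ ⟨
    ∑ (members E) (λ x → ⟦ x ≟ᵖ a ⟧ * 1# + ⟦ ¬? (x ≟ᵖ a) ⟧ * 1#)
      ≈⟨ ∑-cong (members E) (λ x → ⟦⟧-split (x ≟ᵖ a) 1#) ⟨
    ∑ (members E) (const 1#)
      ≈⟨ ∣∣≈∑ E ⟨
    ι ∣ E ∣ ∎)

  quadSum-mono : ∀ (E : Subset d) {f g} →
    (∀ {x y z w} → x ∈ members E → y ∈ members E → z ∈ members E → w ∈ members E → f x y z w ≤ g x y z w) →
    quadSum E f ≤ quadSum E g
  quadSum-mono E f≤g = ∑-mono∈ (members E) λ x∈ → ∑-mono∈ (members E) λ y∈ → ∑-mono∈ (members E) λ z∈ →
    ∑-mono∈ (members E) λ w∈ → f≤g x∈ y∈ z∈ w∈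

  quadSum-+ : ∀ (E : Subset d) f g → quadSum E (λ x y z w → f x y z w + g x y z w) ≈ quadSum E f + quadSum E g
  quadSum-+ E f g = trans (∑-cong (members E) λ x → trans (∑-cong (members E) λ y → trans (∑-cong (members E) λ z →
    ∑-+ (members E) _ _) (∑-+ (members E) _ _)) (∑-+ (members E) _ _)) (∑-+ (members E) _ _)

  *-quadSum : ∀ (E : Subset d) k f → k * quadSum E f ≈ quadSum E (λ x y z w → k * f x y z w)
  *-quadSum E k f = trans (*-∑ (members E) k _) (∑-cong (members E) λ x → trans (*-∑ (members E) k _) (∑-cong (members E) λ y →
    trans (*-∑ (members E) k _) (∑-cong (members E) λ z → *-∑ (members E) k _)))

  ∑-quadSum : ∀ (as : List A) (E : Subset d) (f : A → Point d → Point d → Point d → Point d → ℝ) →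
    ∑ as (λ a → quadSum E (f a)) ≈ quadSum E (λ x y z w → ∑ as (λ a → f a x y z w))
  ∑-quadSum as E f = trans (∑-swap as (members E) _) (∑-cong (members E) λ x → trans (∑-swap as (members E) _)
    (∑-cong (members E) λ y → trans (∑-swap as (members E) _) (∑-cong (members E) λ z → ∑-swap as (members E) _)))

  quadSum-∖ : ∀ (E : Subset d) a f → quadSum (E ∖ a) f ≈
    quadSum E (λ x y z w → ⟦ ¬? (x ≟ᵖ a) ⟧ * (⟦ ¬? (y ≟ᵖ a) ⟧ * (⟦ ¬? (z ≟ᵖ a) ⟧ * (⟦ ¬? (w ≟ᵖ a) ⟧ * f x y z w))))
  quadSum-∖ E a f = begin-equality
    quadSum (E ∖ a) f
      ≈⟨ ∑-∖ E a _ ⟩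
    ∑ ms (λ x → δ x * ∑ ms′ (λ y → ∑ ms′ (λ z → ∑ ms′ (f x y z))))
      ≈⟨ ∑-cong ms (λ x → trans (*-congˡ (∑-∖ E a _)) (*-∑ ms _ _)) ⟩
    ∑ ms (λ x → ∑ ms (λ y → δ x * (δ y * ∑ ms′ (λ z → ∑ ms′ (f x y z)))))
      ≈⟨ ∑-cong ms (λ x → ∑-cong ms (λ y → trans (*-congˡ (trans (*-congˡ (∑-∖ E a _)) (*-∑ ms _ _))) (*-∑ ms _ _))) ⟩
    ∑ ms (λ x → ∑ ms (λ y → ∑ ms (λ z → δ x * (δ y * (δ z * ∑ ms′ (f x y z))))))
      ≈⟨ ∑-cong ms (λ x → ∑-cong ms (λ y → ∑-cong ms (λ z → trans (*-congˡ (trans (*-congˡ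
           (trans (*-congˡ (∑-∖ E a _)) (*-∑ ms _ _))) (*-∑ ms _ _))) (*-∑ ms _ _)))) ⟩
    quadSum E (λ x y z w → δ x * (δ y * (δ z * (δ w * f x y z w)))) ∎
    where
    ms = members E
    ms′ = members (E ∖ a)
    δ : Point _ → ℝ
    δ x = ⟦ ¬? (x ≟ᵖ a) ⟧

  -- The entry `w` is left out on purpose: given distinct `x`, `y`, `z` it differs from `x` and `y`,
  -- but it equals `z` if `z` is the midpoint of `x` and `y`. Three distinct points are what every
  -- such solution is sure to have.
  Distinct : (x y z : Point d) → Set
  Distinct x y z = x ≢ y × x ≢ z × y ≢ z

  distinct? : (x y z : Point d) → Dec (Distinct x y z)
  distinct? x y z = ¬? (x ≟ᵖ y) ×-dec ¬? (x ≟ᵖ z) ×-dec ¬? (y ≟ᵖ z)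

  -- A proper solution involves three points of E, so it is destroyed by removing
  -- any of these: on average, removals destroy a proportion 3 / ∣ E ∣ of them.
  proper : Point d → Point d → Point d → Point d → ℝ
  proper x y z w = ⟦ distinct? x y z ⟧ * ⟦ x +ᵖ y ≟ᵖ z +ᵖ w ⟧

  properEnergy : Subset d → ℝ
  properEnergy E = quadSum E proper

  proper-nonneg : ∀ (x y z w : Point d) → 0# ≤ proper x y z w
  proper-nonneg x y z w = *-nonneg (⟦⟧-nonneg (distinct? x y z)) (⟦⟧-nonneg (x +ᵖ y ≟ᵖ z +ᵖ w))

  -- As `x`, `y`, `z` are distinct, at most one of them equals `a`, so the bracket on the right is 0
  -- or 1 and tells whether these three survive. It is linear in the indicators, hence easily summed
  -- over `a`; the factor for `w` is estimated by 1.
  proper-∖ : ∀ (x y z w a : Point d) →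
    ⟦ ¬? (x ≟ᵖ a) ⟧ * (⟦ ¬? (y ≟ᵖ a) ⟧ * (⟦ ¬? (z ≟ᵖ a) ⟧ * (⟦ ¬? (w ≟ᵖ a) ⟧ * proper x y z w))) ≤
    (1# - ⟦ x ≟ᵖ a ⟧ - ⟦ y ≟ᵖ a ⟧ - ⟦ z ≟ᵖ a ⟧) * proper x y z w
  proper-∖ x y z w a = go (distinct? x y z) (x ≟ᵖ a) (y ≟ᵖ a) (z ≟ᵖ a) (w ≟ᵖ a) (⟦⟧-nonneg (x +ᵖ y ≟ᵖ z +ᵖ w))
    where
    go : (D? : Dec (Distinct x y z)) (X? : Dec (x ≡ a)) (Y? : Dec (y ≡ a)) (Z? : Dec (z ≡ a)) (W? : Dec (w ≡ a)) →
      ∀ {p} → 0# ≤ p →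
      ⟦ ¬? X? ⟧ * (⟦ ¬? Y? ⟧ * (⟦ ¬? Z? ⟧ * (⟦ ¬? W? ⟧ * (⟦ D? ⟧ * p)))) ≤
      (1# - ⟦ X? ⟧ - ⟦ Y? ⟧ - ⟦ Z? ⟧) * (⟦ D? ⟧ * p)
    go (no _) X? Y? Z? W? {p} _ = ≤-reflexive (solve 8 (λ x y z w x′ y′ z′ p →
      x :* (y :* (z :* (w :* (:0 :* p)))) := (:1 :- x′ :- y′ :- z′) :* (:0 :* p)) refl
      ⟦ ¬? X? ⟧ ⟦ ¬? Y? ⟧ ⟦ ¬? Z? ⟧ ⟦ ¬? W? ⟧ ⟦ X? ⟧ ⟦ Y? ⟧ ⟦ Z? ⟧ p)
    go (yes (x≢y , x≢z , y≢z)) (yes ≡.refl) (yes y≡a) Z? W? _ = contradiction (≡.sym y≡a) x≢y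
    go (yes (x≢y , x≢z , y≢z)) (yes ≡.refl) (no _) (yes z≡a) W? _ = contradiction (≡.sym z≡a) x≢z
    go (yes _) (yes _) (no _) (no _) W? {p} _ = ≤-reflexive (solve 2 (λ w p →
      :0 :* (:1 :* (:1 :* (w :* (:1 :* p)))) := (:1 :- :1 :- :0 :- :0) :* (:1 :* p)) refl ⟦ ¬? W? ⟧ p)
    go (yes (x≢y , x≢z , y≢z)) (no _) (yes ≡.refl) (yes z≡a) W? _ = contradiction (≡.sym z≡a) y≢z
    go (yes _) (no _) (yes _) (no _) W? {p} _ = ≤-reflexive (solve 2 (λ w p →
      :1 :* (:0 :* (:1 :* (w :* (:1 :* p)))) := (:1 :- :0 :- :1 :- :0) :* (:1 :* p)) refl ⟦ ¬? W? ⟧ p)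
    go (yes _) (no _) (no _) (yes _) W? {p} _ = ≤-reflexive (solve 2 (λ w p →
      :1 :* (:1 :* (:0 :* (w :* (:1 :* p)))) := (:1 :- :0 :- :0 :- :1) :* (:1 :* p)) refl ⟦ ¬? W? ⟧ p)
    go (yes _) (no _) (no _) (no _) W? {p} 0≤p = begin
      1# * (1# * (1# * (⟦ ¬? W? ⟧ * (1# * p))))
        ≈⟨ solve 2 (λ w p → :1 :* (:1 :* (:1 :* (w :* (:1 :* p)))) := w :* p) refl ⟦ ¬? W? ⟧ p ⟩
      ⟦ ¬? W? ⟧ * p
        ≤⟨ *-monoʳ-≤ 0≤p (⟦⟧-≤1 (¬? W?)) ⟩
      1# * p
        ≈⟨ solve 1 (λ p → :1 :* p := (:1 :- :0 :- :0 :- :0) :* (:1 :* p)) refl p ⟩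
      (1# - 0# - 0# - 0#) * (1# * p) ∎

  ∑-properEnergy-∖ : ∀ (E : Subset d) →
    ∑ (members E) (λ a → properEnergy (E ∖ a)) ≤ (ι ∣ E ∣ - ι 3) * properEnergy E
  ∑-properEnergy-∖ E = begin
    ∑ (members E) (λ a → properEnergy (E ∖ a))
      ≤⟨ ∑-mono (members E) (λ a → ≤-respˡ-≈ (sym (quadSum-∖ E a proper))
           (quadSum-mono E (λ {x} {y} {z} {w} _ _ _ _ → proper-∖ x y z w a))) ⟩
    ∑ (members E) (λ a → quadSum E (λ x y z w → (1# - ⟦ x ≟ᵖ a ⟧ - ⟦ y ≟ᵖ a ⟧ - ⟦ z ≟ᵖ a ⟧) * proper x y z w))
      ≈⟨ ∑-quadSum (members E) E _ ⟩
    quadSum E (λ x y z w → ∑ (members E) (λ a → (1# - ⟦ x ≟ᵖ a ⟧ - ⟦ y ≟ᵖ a ⟧ - ⟦ z ≟ᵖ a ⟧) * proper x y z w))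
      ≤⟨ quadSum-mono E (λ x∈ y∈ z∈ _ → ≤-reflexive (trans (sym (∑-* (members E) _ _)) (*-congʳ (remaining x∈ y∈ z∈)))) ⟩
    quadSum E (λ x y z w → (ι ∣ E ∣ - ι 3) * proper x y z w)
      ≈⟨ *-quadSum E _ proper ⟨
    (ι ∣ E ∣ - ι 3) * properEnergy E ∎
    where
    one : ∀ {x} → x ∈ members E → ∑ (members E) (λ a → ⟦ x ≟ᵖ a ⟧) ≈ 1#
    one {x} x∈ = trans (∑-cong (members E) (λ a → trans (⟦⟧-cong (x ≟ᵖ a) (a ≟ᵖ x) ≡.sym ≡.sym) (sym (*-identityʳ _))))
      (Kronecker.∑-δ _≟ᵖ_ (members-unique E) x∈ (const 1#))
    remaining : ∀ {x y z} → x ∈ members E → y ∈ members E → z ∈ members E →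
      ∑ (members E) (λ a → 1# - ⟦ x ≟ᵖ a ⟧ - ⟦ y ≟ᵖ a ⟧ - ⟦ z ≟ᵖ a ⟧) ≈ ι ∣ E ∣ - ι 3
    remaining x∈ y∈ z∈ = trans (∑-- (members E) _ _) (trans (+-congʳ (trans (∑-- (members E) _ _) (+-congʳ (∑-- (members E) _ _))))
      (trans (+-cong (+-cong (+-cong (sym (∣∣≈∑ E)) (-‿cong (one x∈))) (-‿cong (one y∈))) (-‿cong (one z∈)))
      (solve 1 (λ n → n :- :1 :- :1 :- :1 := n :- :3) refl (ι ∣ E ∣))))

  properEnergy-nonneg : ∀ (E : Subset d) → 0# ≤ properEnergy E
  properEnergy-nonneg E = ∑-nonneg (members E) λ x → ∑-nonneg (members E) λ y → ∑-nonneg (members E) λ z →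
    ∑-nonneg (members E) (proper-nonneg x y z)

  -- Averaging gives a point whose removal leaves at most the share (n - 3)/n of the proper
  -- solutions, where n = k + 1. The inequality n² (n - 3) ≤ (n - 1)³, with difference 3k + 2,
  -- weakens this share to (k/n)³, a form that telescopes.
  remove-point : ∀ {E : Subset d} {k} → ∣ E ∣ ≡ suc k →
    ∃ λ a → a ∈ members E × properEnergy (E ∖ a) * ι (suc k) ^ⁿ 3 ≤ properEnergy E * ι k ^ⁿ 3
  remove-point {E = E} {k} ∣E∣≡ = a , proj₁ (proj₂ choice) , (begin
    properEnergy (E ∖ a) * (n * (n * (n * 1#)))
      ≈⟨ solve 2 (λ Q n → Q :* (n :* (n :* (n :* :1))) := n :* n :* (n :* Q)) refl (properEnergy (E ∖ a)) n ⟩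
    n * n * (n * properEnergy (E ∖ a))
      ≤⟨ *-monoˡ-≤ (0≤x² n) (proj₂ (proj₂ choice)) ⟩
    n * n * ((n - ι 3) * Q)
      ≤⟨ ≤-by-difference (Q * (ι 3 * ι k + ι 2))
           (*-nonneg (properEnergy-nonneg E) (+-nonneg (*-nonneg (ι-nonneg 3) (ι-nonneg k)) (ι-nonneg 2)))
           (solve 2 (λ Q k → Q :* (k :* (k :* (k :* :1))) :- (:1 :+ k) :* (:1 :+ k) :* ((:1 :+ k :- :3) :* Q) :=
             Q :* (:3 :* k :+ :2)) refl Q (ι k)) ⟩
    Q * ι k ^ⁿ 3 ∎)
    where
    n = ι (suc k)
    Q = properEnergy E
    nonempty : ∀ (xs : List (Point _)) {k} → length xs ≡ suc k → ∃ λ x → x ∈ xs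
    nonempty (x ∷ xs) _ = x , here ≡.refl
    average : ∑ (members E) (λ a → n * properEnergy (E ∖ a)) ≤ ∑ (members E) (λ _ → (n - ι 3) * Q)
    average = begin
      ∑ (members E) (λ a → n * properEnergy (E ∖ a))    ≈⟨ *-∑ (members E) _ _ ⟨
      n * ∑ (members E) (λ a → properEnergy (E ∖ a))    ≤⟨ *-monoˡ-≤ (ι-nonneg (suc k)) (∑-properEnergy-∖ E) ⟩
      n * ((ι ∣ E ∣ - ι 3) * Q)                         ≈⟨ *-cong (reflexive (≡.cong ι (≡.sym ∣E∣≡))) (*-congʳ (+-congʳ (reflexive (≡.cong ι ∣E∣≡)))) ⟩
      ι ∣ E ∣ * ((n - ι 3) * Q)                         ≈⟨ ∑-const (members E) _ ⟨
      ∑ (members E) (λ _ → (n - ι 3) * Q)               ∎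
    choice : ∃ λ a → a ∈ members E × n * properEnergy (E ∖ a) ≤ (n - ι 3) * Q
    choice = ∑-pigeonhole (members E) {λ a → n * properEnergy (E ∖ a)} {λ _ → (n - ι 3) * Q} (nonempty (members E) ∣E∣≡) average
    a = proj₁ choice

  -- The quotient of the proper energy by the cube of the size never increases, as for a random
  -- subset. Denominators are cleared; `1 ≤ k` keeps the intermediate sizes positive, so that their
  -- cubes cancel.
  shrink : ∀ (E : Subset d) j {k} → 1 ℕ.≤ k → ∣ E ∣ ≡ j ℕ.+ k →
    ∃ λ E′ → (∀ {x} → x ∈ᴱ E′ → x ∈ᴱ E) × ∣ E′ ∣ ≡ k ×
      properEnergy E′ * ι ∣ E ∣ ^ⁿ 3 ≤ properEnergy E * ι k ^ⁿ 3
  shrink E zero    {k} 1≤k ∣E∣≡ = E , (λ x∈ → x∈) , ∣E∣≡ , ≤-reflexive (reflexive (≡.cong (λ n → properEnergy E * ι n ^ⁿ 3) ∣E∣≡))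
  shrink E (suc j) {k} 1≤k ∣E∣≡ = E′ , ∖-⊆ {E = E} ∘ E′⊆ , ∣E′∣≡ , *-cancelˡ-≤ 0<n₁³ (begin
    n₁³ * (properEnergy E′ * n³)          ≈⟨ solve 3 (λ a b c → a :* (b :* c) := b :* a :* c) refl n₁³ (properEnergy E′) n³ ⟩
    properEnergy E′ * n₁³ * n³            ≤⟨ *-monoʳ-≤ (^ⁿ-nonneg 3 (ι-nonneg ∣ E ∣)) E′≤ ⟩
    properEnergy (E ∖ a) * k³ * n³        ≈⟨ solve 3 (λ a b c → a :* b :* c := b :* (a :* c)) refl (properEnergy (E ∖ a)) k³ n³ ⟩
    k³ * (properEnergy (E ∖ a) * n³)      ≤⟨ *-monoˡ-≤ (^ⁿ-nonneg 3 (ι-nonneg k)) step ⟩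
    k³ * (properEnergy E * n₁³)           ≈⟨ solve 3 (λ a b c → a :* (b :* c) := c :* (b :* a)) refl k³ (properEnergy E) n₁³ ⟩
    n₁³ * (properEnergy E * k³)           ∎)
    where
    removal = remove-point {E = E} {j ℕ.+ k} ∣E∣≡
    a = proj₁ removal
    ∣E∖a∣≡ : ∣ E ∖ a ∣ ≡ j ℕ.+ k
    ∣E∖a∣≡ = ℕ.suc-injective (≡.trans (∣∖∣ {E = E} (proj₁ (proj₂ removal))) ∣E∣≡)
    rest = shrink (E ∖ a) j 1≤k ∣E∖a∣≡
    E′ = proj₁ rest
    E′⊆ = proj₁ (proj₂ rest)
    ∣E′∣≡ = proj₁ (proj₂ (proj₂ rest))
    E′≤ = proj₂ (proj₂ (proj₂ rest))
    n³ = ι ∣ E ∣ ^ⁿ 3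
    n₁³ = ι ∣ E ∖ a ∣ ^ⁿ 3
    k³ = ι k ^ⁿ 3
    0<n₁³ : 0# < n₁³
    0<n₁³ = ^ⁿ-pos 3 (ι-pos {∣ E ∖ a ∣} (≡.subst (1 ℕ.≤_) (≡.sym ∣E∖a∣≡) (ℕ.≤-trans 1≤k (ℕ.m≤n+m k j))))
    step : properEnergy (E ∖ a) * n³ ≤ properEnergy E * n₁³
    step = ≡.subst₂ (λ n n₁ → properEnergy (E ∖ a) * ι n ^ⁿ 3 ≤ properEnergy E * ι n₁ ^ⁿ 3)
      (≡.sym ∣E∣≡) (≡.sym ∣E∖a∣≡) (proj₂ (proj₂ removal))

  -- A solution that is not proper satisfies x = y, x = z or y = z. In each case two of the points
  -- are free and the others are determined, which gives three times the square of the size.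
  Λ₄≤ : ∀ (E : Subset d) → ι (Λ₄ E) ≤ properEnergy E + ι 3 * (ι ∣ E ∣ * ι ∣ E ∣)
  Λ₄≤ E = begin
    ι (Λ₄ E)
      ≈⟨ Λ₄≈ E ⟩
    quadSum E solution
      ≤⟨ quadSum-mono E (λ {x} {y} {z} {w} _ _ _ _ → split x y z w) ⟩
    quadSum E (λ x y z w → proper x y z w + (f₁ x y z w + (f₂ x y z w + f₃ x y z w)))
      ≈⟨ trans (quadSum-+ E proper _) (+-congˡ (trans (quadSum-+ E f₁ _) (+-congˡ (quadSum-+ E f₂ f₃)))) ⟩
    properEnergy E + (quadSum E f₁ + (quadSum E f₂ + quadSum E f₃))
      ≤⟨ +-monoʳ-≤ _ (+-mono-≤ f₁≤ (+-mono-≤ f₂≤ f₃≤)) ⟩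
    properEnergy E + (N * N + (N * N + N * N))
      ≈⟨ solve 2 (λ Q n → Q :+ (n :+ (n :+ n)) := Q :+ :3 :* n) refl (properEnergy E) (N * N) ⟩
    properEnergy E + ι 3 * (N * N) ∎
    where
    N = ι ∣ E ∣
    ms = members E
    solution f₁ f₂ f₃ : Point _ → Point _ → Point _ → Point _ → ℝ
    solution x y z w = ⟦ x +ᵖ y ≟ᵖ z +ᵖ w ⟧
    f₁ x y z w = ⟦ x ≟ᵖ y ⟧ * solution x y z w
    f₂ x y z w = ⟦ x ≟ᵖ z ⟧ * solution x y z w
    f₃ x y z w = ⟦ y ≟ᵖ z ⟧ * solution x y z w
    split : ∀ x y z w → solution x y z w ≤ proper x y z w + (f₁ x y z w + (f₂ x y z w + f₃ x y z w))
    split x y z w = go (x ≟ᵖ y) (x ≟ᵖ z) (y ≟ᵖ z) (⟦⟧-nonneg (x +ᵖ y ≟ᵖ z +ᵖ w))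
      where
      1·p≤ : ∀ {p r} → 0# ≤ r → p ≤ 1# * p + r
      1·p≤ {p} {r} 0≤r = ≤-respʳ-≈ (+-congʳ (sym (*-identityˡ p))) (x≤x+y 0≤r)
      go : ∀ {P₁ P₂ P₃ : Set} (X? : Dec P₁) (Y? : Dec P₂) (Z? : Dec P₃) {p} → 0# ≤ p →
        p ≤ ⟦ ¬? X? ×-dec ¬? Y? ×-dec ¬? Z? ⟧ * p + (⟦ X? ⟧ * p + (⟦ Y? ⟧ * p + ⟦ Z? ⟧ * p))
      go (no _) (no _) (no _) {p} 0≤p = 1·p≤ (+-nonneg (*-nonneg ≤-refl 0≤p) (+-nonneg (*-nonneg ≤-refl 0≤p) (*-nonneg ≤-refl 0≤p)))
      go (yes _) Y? Z? {p} 0≤p = ≤-respʳ-≈ (sym (trans (+-congʳ (zeroˡ p)) (+-identityˡ _)))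
        (1·p≤ (+-nonneg (*-nonneg (⟦⟧-nonneg Y?) 0≤p) (*-nonneg (⟦⟧-nonneg Z?) 0≤p)))
      go (no _) (yes _) Z? {p} 0≤p = ≤-respʳ-≈ (sym (trans (+-congʳ (zeroˡ p)) (trans (+-identityˡ _) (trans (+-congʳ (zeroˡ p)) (+-identityˡ _)))))
        (1·p≤ (*-nonneg (⟦⟧-nonneg Z?) 0≤p))
      go (no _) (no _) (yes _) {p} 0≤p = ≤-reflexive (solve 1 (λ p → p := :0 :* p :+ (:0 :* p :+ (:0 :* p :+ :1 :* p))) refl p)
    ∑-solution : ∀ x y z → ∑ ms (solution x y z) ≤ 1#
    ∑-solution x y z = ∑-atMostOne (λ w → x +ᵖ y ≟ᵖ z +ᵖ w) (members-unique E)
      (λ {w} {w′} _ _ p r → ≡.trans (+ᵖ≡+ᵖ⇒≡ z w x y (≡.sym p)) (≡.sym (+ᵖ≡+ᵖ⇒≡ z w′ x y (≡.sym r))))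
    ∑-weighted : ∀ x y z {P : Set} (P? : Dec P) → ∑ ms (λ w → ⟦ P? ⟧ * solution x y z w) ≤ ⟦ P? ⟧
    ∑-weighted x y z P? = ≤-respˡ-≈ (*-∑ ms _ _) (≤-respʳ-≈ (*-identityʳ _) (*-monoˡ-≤ (⟦⟧-nonneg P?) (∑-solution x y z)))
    ∑∑1 : ∑ ms (λ _ → ∑ ms (const 1#)) ≈ N * N
    ∑∑1 = trans (∑-const ms _) (*-congˡ (sym (∣∣≈∑ E)))
    ∑-equal : ∀ x → ∑ ms (λ y → ⟦ x ≟ᵖ y ⟧) ≤ 1#
    ∑-equal x = ∑-atMostOne (λ y → x ≟ᵖ y) (members-unique E) (λ _ _ p r → ≡.trans (≡.sym p) r)
    f₁≤ : quadSum E f₁ ≤ N * N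
    f₁≤ = begin
      quadSum E f₁
        ≤⟨ ∑-mono ms (λ x → ∑-mono ms λ y → ∑-mono ms λ z → ∑-weighted x y z (x ≟ᵖ y)) ⟩
      ∑ ms (λ x → ∑ ms λ y → ∑ ms λ z → ⟦ x ≟ᵖ y ⟧)
        ≈⟨ ∑-cong ms (λ x → ∑-swap ms ms _) ⟩
      ∑ ms (λ x → ∑ ms λ z → ∑ ms λ y → ⟦ x ≟ᵖ y ⟧)
        ≤⟨ ∑-mono ms (λ x → ∑-mono ms λ z → ∑-equal x) ⟩
      ∑ ms (λ _ → ∑ ms (const 1#))
        ≈⟨ ∑∑1 ⟩
      N * N ∎
    f₂≤ : quadSum E f₂ ≤ N * N
    f₂≤ = ≤-respʳ-≈ ∑∑1 (∑-mono ms λ x → ∑-mono ms λ y →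
      ≤-trans (∑-mono ms λ z → ∑-weighted x y z (x ≟ᵖ z)) (∑-equal x))
    f₃≤ : quadSum E f₃ ≤ N * N
    f₃≤ = ≤-respʳ-≈ ∑∑1 (∑-mono ms λ x → ∑-mono ms λ y →
      ≤-trans (∑-mono ms λ z → ∑-weighted x y z (y ≟ᵖ z)) (∑-equal y))

  properEnergy≤Λ₄ : ∀ (E : Subset d) → properEnergy E ≤ ι (Λ₄ E)
  properEnergy≤Λ₄ E = ≤-respʳ-≈ (sym (Λ₄≈ E)) (quadSum-mono E (λ {x} {y} {z} {w} _ _ _ _ →
    ≤-respʳ-≈ (*-identityˡ _) (*-monoʳ-≤ (⟦⟧-nonneg (x +ᵖ y ≟ᵖ z +ᵖ w)) (⟦⟧-≤1 (distinct? x y z)))))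

-- From energy bounds to the Salem condition and the conjectured exponent.

module Salem (R : Reals) (character : ∀ F → NontrivialAdditiveCharacter R F) where

  open Reals R
  open RealProperties R
  open ComplexProperties R using (norm²; norm²-•; abs^4; module ℂ-Sums)
  open Complex R
  open Distance R character
  open import Data.Nat.Divisibility using (_∣_)
  open ≤-Reasoning

  /-≤-/ : ∀ {x y z w} → 0# < y → 0# < w → x * w ≤ z * y → x / y ≤ z / w
  /-≤-/ {x} {y} {z} {w} 0<y 0<w xw≤zy = *-cancelˡ-≤ (*-pos 0<y 0<w) (begin
    y * w * (x / y)    ≈⟨ solve 3 (λ y w u → y :* w :* u := w :* (y :* u)) refl y w (x / y) ⟩
    w * (y * (x / y))  ≈⟨ trans (*-congˡ (/-cancel (<⇒≉ 0<y))) (*-comm w x) ⟩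
    x * w              ≤⟨ xw≤zy ⟩
    z * y              ≈⟨ trans (*-comm z y) (*-congˡ (sym (/-cancel (<⇒≉ 0<w)))) ⟩
    y * (w * (z / w))  ≈⟨ *-assoc _ _ _ ⟨
    y * w * (z / w)    ∎)

  module FourierNorm (F : FiniteField) {d : ℕ} (E : Geometry.Subset F d) where

    open Geometry F
    open Fourier F E
    open Energy R F (character F) using (0<q; ∑-norm⁴)
    open ComplexCharacter R F (character F) using (q)
    open Subsets R F using (Λ₄≈)
    private
      module 𝔽 = FiniteField F
      module χ = NontrivialAdditiveCharacter (character F)

    0<q^-d : 0# < q^-d
    0<q^-d = ^-pos _ 0<q

    q^d*q^-d : q ^ⁿ d * q^-d ≈ 1#
    q^d*q^-d = trans (*-congʳ (sym (^-ι d 0<q))) (^-neg (ι d) 0<q)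

    S⁻ : Point d → ℂ
    S⁻ x = ℂ-Sums.∑ (members E) (λ y → χ.χ (𝔽.- (x · y)))

    abs^4-Ê : ∀ x → abs (Ê x) ^ⁿ 4 ≈ q^-d ^ⁿ 4 * (norm² (S⁻ x) * norm² (S⁻ x))
    abs^4-Ê x = begin-equality
      abs (Ê x) ^ⁿ 4               ≈⟨ abs^4 (Ê x) ⟩
      norm² (Ê x) * norm² (Ê x)    ≈⟨ *-cong (norm²-• q^-d (S⁻ x)) (norm²-• q^-d (S⁻ x)) ⟩
      q^-d * q^-d * norm² (S⁻ x) * (q^-d * q^-d * norm² (S⁻ x))
        ≈⟨ solve 2 (λ p s → p :* p :* s :* (p :* p :* s) := p :* (p :* (p :* (p :* :1))) :* (s :* s)) refl q^-d (norm² (S⁻ x)) ⟩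
      q^-d ^ⁿ 4 * (norm² (S⁻ x) * norm² (S⁻ x)) ∎

    ∥Ê∥₄⁴ : ℝ
    ∥Ê∥₄⁴ = q^-d * ∑ (filter (λ x → ¬? (x ≟ᵖ 0ᵖ)) (points d)) (λ x → abs (Ê x) ^ⁿ 4)

    -- Admitting the frequency 0 only enlarges the sum and makes the full fourth moment available,
    -- whose factor q^d cancels the normalisation of the norm.
    ∥Ê∥₄⁴≤ : ∥Ê∥₄⁴ ≤ q^-d ^ⁿ 4 * ι (Λ₄ E)
    ∥Ê∥₄⁴≤ = begin
      ∥Ê∥₄⁴
        ≈⟨ *-congˡ (∑-filter (λ x → ¬? (x ≟ᵖ 0ᵖ)) (points d) _) ⟩
      q^-d * ∑ (points d) (λ x → ⟦ ¬? (x ≟ᵖ 0ᵖ) ⟧ * abs (Ê x) ^ⁿ 4)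
        ≤⟨ *-monoˡ-≤ (<⇒≤ 0<q^-d) (∑-mono (points d) (λ x → ≤-respʳ-≈ (*-identityˡ _)
             (*-monoʳ-≤ (0≤abs^4 x) (⟦⟧-≤1 (¬? (x ≟ᵖ 0ᵖ)))))) ⟩
      q^-d * ∑ (points d) (λ x → abs (Ê x) ^ⁿ 4)
        ≈⟨ *-congˡ (trans (∑-cong (points d) abs^4-Ê) (sym (*-∑ (points d) _ _))) ⟩
      q^-d * (q^-d ^ⁿ 4 * ∑ (points d) (λ x → norm² (S⁻ x) * norm² (S⁻ x)))
        ≈⟨ *-congˡ (*-congˡ (trans (∑-norm⁴ (members E)) (*-congˡ (sym (Λ₄≈ E))))) ⟩
      q^-d * (q^-d ^ⁿ 4 * (q ^ⁿ d * ι (Λ₄ E)))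
        ≈⟨ solve 4 (λ p r Q L → p :* (r :* (Q :* L)) := Q :* p :* (r :* L)) refl q^-d (q^-d ^ⁿ 4) (q ^ⁿ d) (ι (Λ₄ E)) ⟩
      q ^ⁿ d * q^-d * (q^-d ^ⁿ 4 * ι (Λ₄ E))
        ≈⟨ trans (*-congʳ q^d*q^-d) (*-identityˡ _) ⟩
      q^-d ^ⁿ 4 * ι (Λ₄ E) ∎
      where
      0≤abs^4 : ∀ x → 0# ≤ abs (Ê x) ^ⁿ 4
      0≤abs^4 x = ≤-respʳ-≈ (sym (abs^4 (Ê x))) (0≤x² (norm² (Ê x)))

    0≤∥Ê∥₄⁴ : 0# ≤ ∥Ê∥₄⁴
    0≤∥Ê∥₄⁴ = *-nonneg (<⇒≤ 0<q^-d) (∑-nonneg (filter (λ x → ¬? (x ≟ᵖ 0ᵖ)) (points d))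
      (λ x → ≤-respʳ-≈ (sym (abs^4 (Ê x))) (0≤x² (norm² (Ê x)))))

    energy⇒Salem : ∀ {s C} → 0# < C → 0# < ι ∣ E ∣ → ι (Λ₄ E) ≤ (C * ι ∣ E ∣ ^ (ι 1 - s)) ^ⁿ 4 → Salem s C
    energy⇒Salem {s} {C} 0<C 0<∣E∣ Λ₄≤ = ≤-respʳ-≈ (^ⁿ-root 3 0<bound)
      (^-monoˡ-≤′ (1/-pos 3) 0≤∥Ê∥₄⁴ (^ⁿ-pos 4 0<bound) (≤-trans ∥Ê∥₄⁴≤ (begin
        q^-d ^ⁿ 4 * ι (Λ₄ E)                    ≤⟨ *-monoˡ-≤ (^ⁿ-nonneg 4 (<⇒≤ 0<q^-d)) Λ₄≤ ⟩
        q^-d ^ⁿ 4 * (C * K) ^ⁿ 4                ≈⟨ *-^ⁿ q^-d (C * K) 4 ⟨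
        (q^-d * (C * K)) ^ⁿ 4                   ≈⟨ ^ⁿ-congˡ 4 (solve 3 (λ p C K → p :* (C :* K) := C :* (p :* K)) refl q^-d C K) ⟩
        (C * (q^-d * K)) ^ⁿ 4                   ∎)))
      where
      K = ι ∣ E ∣ ^ (ι 1 - s)
      0<bound : 0# < C * (q^-d * K)
      0<bound = *-pos 0<C (*-pos 0<q^-d (^-pos _ 0<∣E∣))

  module QuarterPowers (F : FiniteField) where

    open Energy R F (character F) using (0<q; 1≤q)
    open ComplexCharacter R F (character F) using (q)

    -- All exponents of the argument are multiples of 1/4. In terms of this fourth root the powers
    -- of q become natural powers, and the final estimates become polynomial inequalities.
    h : ℝ
    h = q ^ (ι 1 / ι 4)

    0<h : 0# < h
    0<h = ^-pos _ 0<q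

    1≤h : 1# ≤ h
    1≤h = 1≤^ 1≤q (<⇒≤ (1/-pos 3))

    h⁴≈q : h ^ⁿ 4 ≈ q
    h⁴≈q = root-^ⁿ 3 (<⇒≤ 0<q)

    q^≈h^ : ∀ {e} k → ι 4 * e ≈ ι k → q ^ e ≈ h ^ⁿ k
    q^≈h^ {e} k 4e≈k = begin-equality
      q ^ e                      ≈⟨ ^-cong refl (begin-equality
        e                          ≈⟨ *-identityˡ e ⟨
        1# * e                     ≈⟨ *-congʳ (*-1/ 3) ⟨
        ι 4 * (ι 1 / ι 4) * e      ≈⟨ solve 3 (λ a b e → a :* b :* e := b :* (a :* e)) refl (ι 4) (ι 1 / ι 4) e ⟩
        (ι 1 / ι 4) * (ι 4 * e)    ≈⟨ *-congˡ 4e≈k ⟩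
        (ι 1 / ι 4) * ι k          ∎) ⟩
      q ^ ((ι 1 / ι 4) * ι k)    ≈⟨ ^-*-assoc _ _ 0<q ⟨
      h ^ ι k                    ≈⟨ ^-ι k 0<h ⟩
      h ^ⁿ k                     ∎

    qⁿ≈h⁴ⁿ : ∀ k → q ^ⁿ k ≈ h ^ⁿ (4 ℕ.* k)
    qⁿ≈h⁴ⁿ k = trans (^ⁿ-congˡ k (sym h⁴≈q)) (^ⁿ-assocʳ h 4 k)

  -- With s = (m + 1) / b the conjectured exponent is α(d,4,s) = b / 4, and sets of
  -- size q^(b/4) are (4,s)-Salem once their energy is at most of order h^e.
  module Threshold {d m b e : ℕ} (d≡ : d ≡ suc (m ℕ.+ m)) (1≤b : 1 ℕ.≤ b)
    (2[m+1]≤b : 2 ℕ.* suc m ℕ.≤ b) (b≤4[m+1] : b ℕ.≤ 4 ℕ.* suc m) (e+4[m+1]≡4b : e ℕ.+ 4 ℕ.* suc m ≡ 4 ℕ.* b)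
    (conjecture : Conjecture d) (3≤d : 3 ℕ.≤ d) (d-odd : ¬ (2 ∣ d)) where

    s ρ : ℝ
    s = ι (suc m) / ι b
    ρ = ι 1 - s

    private
      0<b : 0# < ι b
      0<b = ι-pos {b} 1≤b

      1/4≤s : ι 1 / ι 4 ≤ s
      1/4≤s = /-≤-/ (0<ι 3) 0<b (begin
        ι 1 * ι b          ≈⟨ trans (*-congʳ ι1≈1) (*-identityˡ _) ⟩
        ι b                ≤⟨ ι-mono {b} {4 ℕ.* suc m} b≤4[m+1] ⟩
        ι (4 ℕ.* suc m)    ≈⟨ trans (ι-* 4 (suc m)) (*-comm _ _) ⟩
        ι (suc m) * ι 4    ∎)

      s≤1/2 : s ≤ ι 1 / ι 2
      s≤1/2 = /-≤-/ 0<b (0<ι 1) (begin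
        ι (suc m) * ι 2    ≈⟨ trans (*-comm _ _) (sym (ι-* 2 (suc m))) ⟩
        ι (2 ℕ.* suc m)    ≤⟨ ι-mono {2 ℕ.* suc m} {b} 2[m+1]≤b ⟩
        ι b                ≈⟨ trans (*-congʳ ι1≈1) (*-identityˡ _) ⟨
        ι 1 * ι b          ∎)

      bs≈ : ι b * s ≈ ι (suc m)
      bs≈ = /-cancel (<⇒≉ 0<b)

      0<s : 0# < s
      0<s = <-≤-trans (1/-pos 3) 1/4≤s

      0≤ρ : 0# ≤ ρ
      0≤ρ = x≤y⇒0≤y-x (≤-trans s≤1/2 (≤-respʳ-≈ (trans (*-1/ 1) (sym ι1≈1)) (begin
        ι 1 / ι 2            ≤⟨ x≤x+y (<⇒≤ (1/-pos 1)) ⟩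
        ι 1 / ι 2 + ι 1 / ι 2 ≈⟨ solve 1 (λ x → x :+ x := :2 :* x) refl (ι 1 / ι 2) ⟩
        ι 2 * (ι 1 / ι 2)    ∎)))

      -- The Salem bound at size h^b admits an energy of order h^(4bρ) = h^(4b - 4bs), and b s = m +
      -- 1; this is the origin of the relation between `e`, `b` and `m`.
      4bρ≈e : ι b * ρ * ι 4 ≈ ι e
      4bρ≈e = begin-equality
        ι b * (ι 1 - s) * ι 4         ≈⟨ solve 2 (λ b s → b :* (:1 :+ :0 :- s) :* :4 := :4 :* b :- :4 :* (b :* s)) refl (ι b) s ⟩
        ι 4 * ι b - ι 4 * (ι b * s)   ≈⟨ +-cong (sym (trans (sym (ι-+ e (4 ℕ.* suc m))) (trans (reflexive (≡.cong ι e+4[m+1]≡4b)) (ι-* 4 b))))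
                                           (-‿cong (trans (*-congˡ bs≈) (sym (ι-* 4 (suc m))))) ⟩
        ι e + ι (4 ℕ.* suc m) - ι (4 ℕ.* suc m) ≈⟨ solve 2 (λ e k → e :+ k :- k := e) refl (ι e) (ι (4 ℕ.* suc m)) ⟩
        ι e                           ∎

      4α≈b : ι 4 * ((ι d + ι 1) / (ι 8 * s)) ≈ ι b
      4α≈b = *-cancelˡ-≈ (<⇒≉ 0<8s) (begin-equality
        ι 8 * s * (ι 4 * α)    ≈⟨ solve 2 (λ x α → x :* (:4 :* α) := :4 :* (x :* α)) refl (ι 8 * s) α ⟩
        ι 4 * (ι 8 * s * α)    ≈⟨ *-congˡ (trans (/-cancel (<⇒≉ 0<8s)) (+-congʳ (trans (reflexive (≡.cong ι d≡)) (+-congˡ (ι-+ m m))))) ⟩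
        ι 4 * (1# + (ι m + ι m) + ι 1) ≈⟨ solve 1 (λ m → :4 :* (:1 :+ (m :+ m) :+ (:1 :+ :0)) := :8 :* (:1 :+ m)) refl (ι m) ⟩
        ι 8 * ι (suc m)        ≈⟨ *-congˡ bs≈ ⟨
        ι 8 * (ι b * s)        ≈⟨ solve 3 (λ a b s → a :* (b :* s) := a :* s :* b) refl (ι 8) (ι b) s ⟩
        ι 8 * s * ι b          ∎)
        where
        α = (ι d + ι 1) / (ι 8 * s)
        0<8s : 0# < ι 8 * s
        0<8s = *-pos (0<ι 7) 0<s

    threshold : ∀ {c A} → 0# < c → 0# < A → ∃ λ c′ → 0# < c′ ×
      (∀ F → let open Geometry F in (E : Subset d) →
       c * QuarterPowers.h F ^ⁿ b ≤ ι ∣ E ∣ → ι (Λ₄ E) ≤ A * QuarterPowers.h F ^ⁿ e → c′ * ι (FiniteField.order F) ≤ ι ∣Δ E ∣)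
    threshold {c} {A} 0<c 0<A = c′ , proj₁ (proj₂ conjectured) , forced
      where
      -- Solves C⁴ (c^ρ)⁴ = A, so that the lower bound c h^b for the size turns A h^e into the
      -- required fourth power. It is chosen before the field, hence the constant taken from the
      -- conjecture is uniform.
      C = (A / (c ^ ρ) ^ⁿ 4) ^ (ι 1 / ι 4)
      0<A/c⁴ : 0# < A / (c ^ ρ) ^ⁿ 4
      0<A/c⁴ = *-pos 0<A (⁻¹-pos (^ⁿ-pos 4 (^-pos ρ 0<c)))
      0<C : 0# < C
      0<C = ^-pos _ 0<A/c⁴
      conjectured = proj₁ (Conjecture.odd conjecture 3≤d d-odd s (1/4≤s , s≤1/2)) C c 0<C 0<c
      c′ = proj₁ conjectured
      forced : ∀ F → let open Geometry F in (E : Subset d) →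
        c * QuarterPowers.h F ^ⁿ b ≤ ι ∣ E ∣ → ι (Λ₄ E) ≤ A * QuarterPowers.h F ^ⁿ e → c′ * ι (FiniteField.order F) ≤ ι ∣Δ E ∣
      forced F E chᵇ≤∣E∣ Λ₄≤ = proj₂ (proj₂ conjectured) F E (energy⇒Salem {s} {C} 0<C 0<∣E∣ (≤-trans Λ₄≤ bound))
        (≤-respˡ-≈ (*-congˡ (sym (q^≈h^ b 4α≈b))) chᵇ≤∣E∣)
        where
        open Geometry F
        open QuarterPowers F
        open FourierNorm F E
        0<chᵇ : 0# < c * h ^ⁿ b
        0<chᵇ = *-pos 0<c (^ⁿ-pos b 0<h)
        0<∣E∣ : 0# < ι ∣ E ∣
        0<∣E∣ = <-≤-trans 0<chᵇ chᵇ≤∣E∣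
        hᵇ^ρ^4 : ((h ^ⁿ b) ^ ρ) ^ⁿ 4 ≈ h ^ⁿ e
        hᵇ^ρ^4 = begin-equality
          ((h ^ⁿ b) ^ ρ) ^ⁿ 4     ≈⟨ ^ⁿ-congˡ 4 (trans (^-cong (sym (^-ι b 0<h)) refl) (^-*-assoc (ι b) ρ 0<h)) ⟩
          (h ^ (ι b * ρ)) ^ⁿ 4    ≈⟨ ^-ι 4 (^-pos _ 0<h) ⟨
          (h ^ (ι b * ρ)) ^ ι 4   ≈⟨ ^-*-assoc _ _ 0<h ⟩
          h ^ (ι b * ρ * ι 4)     ≈⟨ ^-cong refl 4bρ≈e ⟩
          h ^ ι e                 ≈⟨ ^-ι e 0<h ⟩
          h ^ⁿ e                  ∎
        bound : A * h ^ⁿ e ≤ (C * ι ∣ E ∣ ^ ρ) ^ⁿ 4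
        bound = begin
          A * h ^ⁿ e
            ≈⟨ *-cong (trans (sym (/-cancel (<⇒≉ (^ⁿ-pos 4 (^-pos ρ 0<c))))) (*-congˡ (sym (root-^ⁿ 3 (<⇒≤ 0<A/c⁴))))) (sym hᵇ^ρ^4) ⟩
          (c ^ ρ) ^ⁿ 4 * C ^ⁿ 4 * ((h ^ⁿ b) ^ ρ) ^ⁿ 4
            ≈⟨ solve 3 (λ x y z → x :* y :* z := y :* (x :* z)) refl ((c ^ ρ) ^ⁿ 4) (C ^ⁿ 4) (((h ^ⁿ b) ^ ρ) ^ⁿ 4) ⟩
          C ^ⁿ 4 * ((c ^ ρ) ^ⁿ 4 * ((h ^ⁿ b) ^ ρ) ^ⁿ 4)
            ≈⟨ *-congˡ (trans (sym (*-^ⁿ (c ^ ρ) ((h ^ⁿ b) ^ ρ) 4)) (^ⁿ-congˡ 4 (sym (^-distribʳ-* ρ 0<c (^ⁿ-pos b 0<h))))) ⟩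
          C ^ⁿ 4 * ((c * h ^ⁿ b) ^ ρ) ^ⁿ 4
            ≤⟨ *-monoˡ-≤ (^ⁿ-nonneg 4 (<⇒≤ 0<C)) (^ⁿ-monoˡ-≤ 4 (<⇒≤ (^-pos ρ 0<chᵇ)) (^-monoˡ-≤ 0≤ρ 0<chᵇ chᵇ≤∣E∣)) ⟩
          C ^ⁿ 4 * (ι ∣ E ∣ ^ ρ) ^ⁿ 4
            ≈⟨ *-^ⁿ C (ι ∣ E ∣ ^ ρ) 4 ⟨
          (C * ι ∣ E ∣ ^ ρ) ^ⁿ 4 ∎

-- Arithmetic of the admissible dimensions.

module Dimension where

  open import Data.Nat.Divisibility using (_∣_; divides; ∣m+n∣m⇒∣n; ∣1⇒≡1)
  open import Data.Nat.Solver using (module +-*-Solver)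
  open +-*-Solver

  2∤1+2n : ∀ n → ¬ 2 ∣ suc (n ℕ.+ n)
  2∤1+2n n 2∣ with () ← ∣1⇒≡1 (∣m+n∣m⇒∣n (≡.subst (2 ∣_) (ℕ.+-comm 1 (n ℕ.+ n)) 2∣)
    (divides n (solve 1 (λ n → n :+ n := n :* con 2) ≡.refl n)))

  4k-1≡ : ∀ k → 4 ℕ.* suc k ℕ.∸ 1 ≡ suc (suc (k ℕ.+ k) ℕ.+ suc (k ℕ.+ k))
  4k-1≡ k = ≡.trans (≡.cong (ℕ._∸ 1) (ℕ.*-suc 4 k))
    (solve 1 (λ k → con 3 :+ con 4 :* k := con 1 :+ (con 1 :+ (k :+ k) :+ (con 1 :+ (k :+ k)))) ≡.refl k)

  4k+1≡ : ∀ k → 4 ℕ.* k ℕ.+ 1 ≡ suc ((k ℕ.+ k) ℕ.+ (k ℕ.+ k))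
  4k+1≡ k = solve 1 (λ k → con 4 :* k :+ con 1 := con 1 :+ (k :+ k :+ (k :+ k))) ≡.refl k

  -- Written as 2m + 1, the dimension 4k - 1 has the odd m = 2k - 1, whence the congruence condition
  -- on q, and 4k + 1 has the even m = 2k.
  admissible⇒ : ∀ {d q} → AdmissibleDimension d q →
    ∃ λ m → d ≡ suc (m ℕ.+ m) × 1 ℕ.≤ m × (q % 4 ≡ 1 ⊎ ∃ λ k → m ≡ k ℕ.+ k)
  admissible⇒ (inj₁ (suc k , _ , ≡.refl , q%4≡1)) = suc (k ℕ.+ k) , 4k-1≡ k , ℕ.s≤s ℕ.z≤n , inj₁ q%4≡1
  admissible⇒ (inj₂ (suc k , _ , ≡.refl))         = suc k ℕ.+ suc k , 4k+1≡ (suc k) , ℕ.s≤s ℕ.z≤n , inj₂ (suc k , ≡.refl)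

  2[m+2]≤4[m+1] : ∀ m → 2 ℕ.* suc (suc m) ℕ.≤ 4 ℕ.* suc m
  2[m+2]≤4[m+1] m = ≡.subst (2 ℕ.* suc (suc m) ℕ.≤_)
    (solve 1 (λ m → con 2 :* (con 2 :+ m) :+ con 2 :* m := con 4 :* (con 1 :+ m)) ≡.refl m)
    (ℕ.m≤m+n (2 ℕ.* suc (suc m)) (2 ℕ.* m))

  2[m+2]≤4[m+1]+1 : ∀ m → 2 ℕ.* suc (suc m) ℕ.≤ 4 ℕ.* suc m ℕ.+ 1
  2[m+2]≤4[m+1]+1 m = ℕ.≤-trans (2[m+2]≤4[m+1] m) (ℕ.m≤m+n (4 ℕ.* suc m) 1)

  4m+1≤4[m+1] : ∀ m → 4 ℕ.* m ℕ.+ 1 ℕ.≤ 4 ℕ.* suc m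
  4m+1≤4[m+1] m = ≡.subst (4 ℕ.* m ℕ.+ 1 ℕ.≤_)
    (solve 1 (λ m → con 4 :* m :+ con 1 :+ con 3 := con 4 :* (con 1 :+ m)) ≡.refl m)
    (ℕ.m≤m+n (4 ℕ.* m ℕ.+ 1) 3)

  e₁+4[m+1]≡4b₁ : ∀ m → 4 ℕ.* m ℕ.+ (4 ℕ.* m ℕ.+ 4 ℕ.* m) ℕ.+ 4 ℕ.* suc m ≡ 4 ℕ.* (4 ℕ.* m ℕ.+ 1)
  e₁+4[m+1]≡4b₁ = solve 1 (λ m → con 4 :* m :+ (con 4 :* m :+ con 4 :* m) :+ con 4 :* (con 1 :+ m) :=
    con 4 :* (con 4 :* m :+ con 1)) ≡.refl

  e₂+4[m+2]≡4b₂ : ∀ m → 4 ℕ.* m ℕ.+ (4 ℕ.* suc m ℕ.+ 4 ℕ.* suc m) ℕ.+ 4 ℕ.* suc (suc m) ≡ 4 ℕ.* (4 ℕ.* suc m)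
  e₂+4[m+2]≡4b₂ = solve 1 (λ m → con 4 :* m :+ (con 4 :* (con 1 :+ m) :+ con 4 :* (con 1 :+ m)) :+ con 4 :* (con 2 :+ m) :=
    con 4 :* (con 4 :* (con 1 :+ m))) ≡.refl

  halve-injective : ∀ {m n} → m ℕ.+ m ≡ n ℕ.+ n → m ≡ n
  halve-injective {m} {n} eq = ℕ.*-cancelˡ-≡ m n 2
    (≡.trans (≡.cong (m ℕ.+_) (ℕ.+-identityʳ m)) (≡.trans eq (≡.cong (n ℕ.+_) (≡.sym (ℕ.+-identityʳ n)))))

  admissible⇒good : ∀ {m q} → AdmissibleDimension (suc (m ℕ.+ m)) q → q % 4 ≡ 1 ⊎ ∃ λ k → m ≡ k ℕ.+ k
  admissible⇒good {m} {q} admissible with admissible⇒ {suc (m ℕ.+ m)} {q} admissible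
  ... | m₁ , d≡ , _ , good = ≡.subst (λ m → q % 4 ≡ 1 ⊎ ∃ λ k → m ≡ k ℕ.+ k)
    (≡.sym (halve-injective (ℕ.suc-injective d≡))) good

  -- The split concerns `d` alone and excludes all q at once, because the constants of the
  -- conclusion have to be fixed before the field is known.
  decide : ∀ d → (∃ λ m → d ≡ suc (suc m ℕ.+ suc m)) ⊎ (∀ q → ¬ AdmissibleDimension d q)
  decide d with parity d
    where
    parity : ∀ d → (∃ λ m → d ≡ suc (suc m ℕ.+ suc m)) ⊎ (∀ m → 1 ℕ.≤ m → d ≢ suc (m ℕ.+ m))
    parity 0 = inj₂ λ _ _ ()
    parity 1 = inj₂ λ { (suc m) _ () }
    parity 2 = inj₂ λ { (suc m) _ eq → ℕ.1+n≢0 (≡.sym (ℕ.suc-injective (ℕ.suc-injective (≡.trans eq (≡.cong (λ n → suc (suc n)) (ℕ.+-suc m m)))))) }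
    parity 3 = inj₁ (0 , ≡.refl)
    parity (suc (suc d@(suc (suc _)))) with parity d
    ... | inj₁ (m , eq) = inj₁ (suc m , ≡.cong suc (≡.cong suc (≡.trans eq (≡.sym (ℕ.+-suc (suc m) (suc m))))))
    ... | inj₂ d≢ = inj₂ λ
      { 1 _ ()
      ; (suc (suc m)) _ eq → d≢ (suc m) (ℕ.s≤s ℕ.z≤n) (ℕ.suc-injective (≡.trans (ℕ.suc-injective eq) (≡.cong suc (ℕ.+-suc (suc m) (suc m))))) }
  ... | inj₁ m = inj₁ m
  ... | inj₂ d≢ = inj₂ λ q admissible → let m , d≡ , 1≤m , _ = admissible⇒ {d} {q} admissible in d≢ m 1≤m d≡

-- Subsets of prescribed size and the resulting numerical bound.

module Cutting (R : Reals) where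

  open Reals R
  open RealProperties R
  open ≤-Reasoning

  ceiling : ∀ {x} n → 0# < x → x ≤ ι n → ∃ λ k → 1 ℕ.≤ k × k ℕ.≤ n × x ≤ ι k × ι k ≤ x + 1#
  ceiling zero    0<x x≤0 = contradiction (antisym (<⇒≤ 0<x) x≤0) (proj₂ 0<x)
  ceiling {x} (suc n) 0<x x≤n+1 with x ≤? ι n
  ... | no x≰n  = suc n , ℕ.s≤s ℕ.z≤n , ℕ.≤-refl , x≤n+1 , ≤-respˡ-≈ (+-comm _ _) (+-monoˡ-≤ 1# (≰⇒≥ x≰n))
  ... | yes x≤n with ceiling n 0<x x≤n
  ...   | k , 1≤k , k≤n , x≤k , k≤x+1 = k , 1≤k , ℕ.m≤n⇒m≤1+n k≤n , x≤k , k≤x+1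

  4*[x/2] : ∀ x → ι 4 * (x / ι 2) ≈ ι 2 * x
  4*[x/2] x = trans (solve 1 (λ y → :4 :* y := :2 :* (:2 :* y)) refl (x / ι 2))
    (*-congˡ (/-cancel (ι≉0 1)))

  module _ (F : FiniteField) {d : ℕ} (E : Geometry.Subset F d) where

    open Geometry F using (∣_∣; Λ₄; _∈_)
    open Subsets R F using (properEnergy; shrink)

    -- The new size is cX rounded up, the excess being absorbed by `1# ≤ X`. The lower bound serves
    -- the size condition of the conjecture, the upper bound serves the energy estimate.
    cut : ∀ {X} → 0# < X → 1# ≤ X → ∀ {c} → 0# < c → c * X ≤ ι ∣ E ∣ →
      ∃ λ (E′ : Geometry.Subset F d) → (∀ {x} → x ∈ E′ → x ∈ E) × c * X ≤ ι ∣ E′ ∣ ×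
        ι ∣ E′ ∣ ≤ (c + 1#) * X × ι ∣ E′ ∣ ≤ ι ∣ E ∣ × properEnergy E′ * ι ∣ E ∣ ^ⁿ 3 ≤ properEnergy E * ι ∣ E′ ∣ ^ⁿ 3
    cut {X} 0<X 1≤X {c} 0<c cX≤∣E∣ = E′ , proj₁ (proj₂ shrunk) ,
      ≡.subst (λ n → c * X ≤ ι n) (≡.sym ∣E′∣≡k) (proj₁ (proj₂ (proj₂ (proj₂ size)))) ,
      ≡.subst (λ n → ι n ≤ (c + 1#) * X) (≡.sym ∣E′∣≡k) (≤-trans (proj₂ (proj₂ (proj₂ (proj₂ size)))) (begin
        c * X + 1#         ≤⟨ +-monoʳ-≤ (c * X) 1≤X ⟩
        c * X + X          ≈⟨ solve 2 (λ c X → c :* X :+ X := (c :+ :1) :* X) refl c X ⟩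
        (c + 1#) * X       ∎)) ,
      ≡.subst (λ n → ι n ≤ ι ∣ E ∣) (≡.sym ∣E′∣≡k) (ι-mono {k} {∣ E ∣} k≤∣E∣) ,
      ≡.subst (λ n → properEnergy E′ * ι ∣ E ∣ ^ⁿ 3 ≤ properEnergy E * ι n ^ⁿ 3) (≡.sym ∣E′∣≡k) (proj₂ (proj₂ (proj₂ shrunk)))
      where
      size = ceiling ∣ E ∣ (*-pos 0<c 0<X) cX≤∣E∣
      k = proj₁ size
      k≤∣E∣ : k ℕ.≤ ∣ E ∣
      k≤∣E∣ = proj₁ (proj₂ (proj₂ size))
      shrunk = shrink E (∣ E ∣ ℕ.∸ k) {k} (proj₁ (proj₂ size)) (≡.sym (ℕ.m∸n+n≡m k≤∣E∣))
      E′ = proj₁ shrunk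
      ∣E′∣≡k : ∣ E′ ∣ ≡ k
      ∣E′∣≡k = proj₁ (proj₂ (proj₂ shrunk))

  -- To be read with y = q^m and h = q^(1/4). For N of order y h the four terms on the left have
  -- orders y³h³, y³h⁴, y³h⁴ and y³h³; those of lower order are raised by `1# ≤ h`.
  cubic-bound : ∀ {N K y h} → 1# ≤ h → 0# ≤ y → 0# ≤ K → 0# ≤ N → N ≤ K * (y * h) →
    N * (N * N) + y * (h * h) * (N * N + (N * N + ι 2 * (y * N))) ≤
    (K * K * K + ι 2 * (K * K) + ι 2 * K) * (y * (y * y)) * (h * (h * (h * (h * 1#))))
  cubic-bound {N} {K} {y} {h} 1≤h 0≤y 0≤K 0≤N N≤M = begin
    N * (N * N) + y * (h * h) * (N * N + (N * N + ι 2 * (y * N)))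
      ≤⟨ +-mono-≤ (*-mono-≤ 0≤N N≤M (0≤x² N) N²≤M²)
           (*-monoˡ-≤ (*-nonneg 0≤y (0≤x² h)) (+-mono-≤ N²≤M² (+-mono-≤ N²≤M²
             (*-monoˡ-≤ (ι-nonneg 2) (*-monoˡ-≤ 0≤y N≤M))))) ⟩
    M * (M * M) + y * (h * h) * (M * M + (M * M + ι 2 * (y * M)))
      ≤⟨ ≤-by-difference ((K * K * K + ι 2 * K) * (y * (y * y)) * (h * (h * h)) * (h - 1#))
           (*-nonneg (*-nonneg (*-nonneg (+-nonneg (*-nonneg (*-nonneg 0≤K 0≤K) 0≤K) (*-nonneg (ι-nonneg 2) 0≤K))
             (*-nonneg 0≤y (0≤x² y))) (*-nonneg 0≤h (0≤x² h))) (x≤y⇒0≤y-x 1≤h))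
           (solve 3 (λ K y h → let M = K :* (y :* h); 2′ = :2 in
             (K :* K :* K :+ 2′ :* (K :* K) :+ 2′ :* K) :* (y :* (y :* y)) :* (h :* (h :* (h :* (h :* :1)))) :-
             (M :* (M :* M) :+ y :* (h :* h) :* (M :* M :+ (M :* M :+ 2′ :* (y :* M)))) :=
             (K :* K :* K :+ 2′ :* K) :* (y :* (y :* y)) :* (h :* (h :* h)) :* (h :- :1)) refl K y h) ⟩
    (K * K * K + ι 2 * (K * K) + ι 2 * K) * (y * (y * y)) * (h * (h * (h * (h * 1#)))) ∎
    where
    M = K * (y * h)
    0≤h : 0# ≤ h
    0≤h = ≤-trans 0≤1 1≤h
    N²≤M² : N * N ≤ M * M
    N²≤M² = *-mono-≤ 0≤N N≤M 0≤N N≤M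

-- The two estimates in dimension 2m + 1 with m at least 1.

module OddDimension (R : Reals) (character : ∀ F → NontrivialAdditiveCharacter R F) (m′ : ℕ)
  (conjecture : Distance.Conjecture R character (suc (suc m′ ℕ.+ suc m′))) where

  open Reals R
  open RealProperties R
  open Cutting R
  open Salem R character
  open Dimension
  open import Data.List.Membership.Propositional using () renaming (_∈_ to _∈ˡ_)
  open ≤-Reasoning

  private
    m = suc m′
    d = suc (m ℕ.+ m)

    3≤d : 3 ℕ.≤ d
    3≤d = ℕ.s≤s (ℕ.s≤s (≡.subst (1 ℕ.≤_) (≡.sym (ℕ.+-suc m′ m′)) (ℕ.s≤s ℕ.z≤n)))

  -- The energy exponent is 12m in powers of h, that is q^(3m): the size of the dominating term
  -- q^(d/2 - 1) n² at n = q^(m + 1/4).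
  module Threshold₁ = Threshold {d} {m} {4 ℕ.* m ℕ.+ 1} {4 ℕ.* m ℕ.+ (4 ℕ.* m ℕ.+ 4 ℕ.* m)} ≡.refl
    (ℕ.s≤s ℕ.z≤n) (2[m+2]≤4[m+1]+1 m′) (4m+1≤4[m+1] m) (e₁+4[m+1]≡4b₁ m) conjecture 3≤d (2∤1+2n m)
  -- Here it is 12m - 4, that is q^(3m - 1): at n = q^m both terms n³/q and q^((d-3)/2) n² have this
  -- size. Writing m = m′ + 1 avoids truncated subtraction.
  module Threshold₂ = Threshold {d} {m} {4 ℕ.* m} {4 ℕ.* m′ ℕ.+ (4 ℕ.* m ℕ.+ 4 ℕ.* m)} ≡.refl
    (ℕ.s≤s ℕ.z≤n) (2[m+2]≤4[m+1] m′) (ℕ.*-monoʳ-≤ 4 (ℕ.n≤1+n m)) (e₂+4[m+2]≡4b₂ m′) conjecture 3≤d (2∤1+2n m)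

  2d≈ : ι 2 * ι d ≈ ι 4 * ι m + ι 2
  2d≈ = trans (*-congˡ (+-congˡ (ι-+ m m))) (solve 1 (λ m → :2 :* (:1 :+ (m :+ m)) := :4 :* m :+ :2) refl (ι m))

  exponent₁ : ι 4 * (ι d / ι 2 - ι 1 / ι 4) ≈ ι (4 ℕ.* m ℕ.+ 1)
  exponent₁ = begin-equality
    ι 4 * (ι d / ι 2 - ι 1 / ι 4)          ≈⟨ solve 2 (λ x y → :4 :* (x :- y) := :4 :* x :- :4 :* y) refl (ι d / ι 2) (ι 1 / ι 4) ⟩
    ι 4 * (ι d / ι 2) - ι 4 * (ι 1 / ι 4)  ≈⟨ +-cong (trans (4*[x/2] (ι d)) 2d≈) (-‿cong (*-1/ 3)) ⟩
    ι 4 * ι m + ι 2 - 1#                   ≈⟨ solve 1 (λ m → :4 :* m :+ :2 :- :1 := :4 :* m :+ (:1 :+ :0)) refl (ι m) ⟩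
    ι 4 * ι m + ι 1                        ≈⟨ trans (ι-+ (4 ℕ.* m) 1) (+-congʳ (ι-* 4 m)) ⟨
    ι (4 ℕ.* m ℕ.+ 1)                      ∎

  exponent₂ : ι 4 * (ι d / ι 2 - ι 1 / ι 2) ≈ ι (4 ℕ.* m)
  exponent₂ = begin-equality
    ι 4 * (ι d / ι 2 - ι 1 / ι 2)          ≈⟨ solve 2 (λ x y → :4 :* (x :- y) := :4 :* x :- :4 :* y) refl (ι d / ι 2) (ι 1 / ι 2) ⟩
    ι 4 * (ι d / ι 2) - ι 4 * (ι 1 / ι 2)  ≈⟨ +-cong (trans (4*[x/2] (ι d)) 2d≈) (-‿cong (4*[x/2] (ι 1))) ⟩
    ι 4 * ι m + ι 2 - ι 2 * ι 1            ≈⟨ solve 1 (λ m → :4 :* m :+ :2 :- :2 :* (:1 :+ :0) := :4 :* m) refl (ι m) ⟩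
    ι 4 * ι m                              ≈⟨ ι-* 4 m ⟨
    ι (4 ℕ.* m)                            ∎

  exponent₃ : ι 4 * ((ι d - ι 3) / ι 2) ≈ ι (4 ℕ.* m′)
  exponent₃ = begin-equality
    ι 4 * ((ι d - ι 3) / ι 2)              ≈⟨ 4*[x/2] (ι d - ι 3) ⟩
    ι 2 * (ι d - ι 3)                      ≈⟨ solve 1 (λ x → :2 :* (x :- :3) := :2 :* x :- :6) refl (ι d) ⟩
    ι 2 * ι d - ι 6                        ≈⟨ +-congʳ 2d≈ ⟩
    ι 4 * (1# + ι m′) + ι 2 - ι 6          ≈⟨ solve 1 (λ m → :4 :* (:1 :+ m) :+ :2 :- :6 := :4 :* m) refl (ι m′) ⟩
    ι 4 * ι m′                             ≈⟨ ι-* 4 m′ ⟨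
    ι (4 ℕ.* m′)                           ∎

  module OnSphere (F : FiniteField) {g : FiniteField.Carrier F} (g-primitive : Primitive F g)
    (good : FiniteField.order F % 4 ≡ 1 ⊎ ∃ λ k → m ≡ k ℕ.+ k) where

    open Geometry F
    open GeometryProperties F using (members-unique; members-∈)
    open Subsets R F using (∣∣≈∑; Λ₄≈; Δ-mono; properEnergy; properEnergy≤Λ₄; Λ₄≤)
    open Energy R F (character F) using (0<q; module Sphere-Energy; module NullPairs-Bound)
    open ComplexCharacter R F (character F) using (q)
    open QuarterPowers F

    y : ℝ
    y = h ^ⁿ (4 ℕ.* m)

    0<y : 0# < y
    0<y = ^ⁿ-pos (4 ℕ.* m) 0<h

    h⁴ᵐ⁺¹≈yh : h ^ⁿ (4 ℕ.* m ℕ.+ 1) ≈ y * h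
    h⁴ᵐ⁺¹≈yh = trans (^ⁿ-homo-* h (4 ℕ.* m) 1) (*-congˡ (*-identityʳ h))

    y³≈ : y * (y * y) ≈ h ^ⁿ (4 ℕ.* m ℕ.+ (4 ℕ.* m ℕ.+ 4 ℕ.* m))
    y³≈ = sym (trans (^ⁿ-homo-* h (4 ℕ.* m) (4 ℕ.* m ℕ.+ 4 ℕ.* m)) (*-congˡ (^ⁿ-homo-* h (4 ℕ.* m) (4 ℕ.* m))))

    qᵐ≈y : q ^ⁿ m ≈ y
    qᵐ≈y = qⁿ≈h⁴ⁿ m

    module _ (E : Subset d) (E⊆S : E ⊆ Sphere g) where

      private
        N = ι ∣ E ∣
        H = y * (h * h)

        0<H : 0# < H
        0<H = *-pos 0<y (*-pos 0<h 0<h)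

        H²≈q^d : H * H ≈ q ^ⁿ d
        H²≈q^d = begin-equality
          y * (h * h) * (y * (h * h))
            ≈⟨ solve 2 (λ y h → y :* (h :* h) :* (y :* (h :* h)) := h :* (h :* (h :* (h :* :1))) :* (y :* y)) refl y h ⟩
          h ^ⁿ 4 * (y * y)
            ≈⟨ *-cong h⁴≈q (trans (*-cong (sym qᵐ≈y) (sym qᵐ≈y)) (sym (^ⁿ-homo-* q m m))) ⟩
          q ^ⁿ d ∎

        onSphere : ∀ {x} → x ∈ˡ members E → ∥ x ∥ ≡ g
        onSphere x∈ = E⊆S _ (members-∈ {E = E} x∈)

        module S = Sphere-Energy (proj₁ g-primitive) (members E) (members-unique E) onSphere H 0<H H²≈q^d
        module B = NullPairs-Bound g-primitive {m} good (members E) (members-unique E) onSphere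

      qΛ₄≤ : q * ι (Λ₄ E) ≤ N * (N * N) + H * (N * N + (N * N + ι 2 * (y * N)))
      qΛ₄≤ = begin
        q * ι (Λ₄ E)
          ≈⟨ *-congˡ (Λ₄≈ E) ⟩
        q * S.energy
          ≤⟨ S.energy≤ ⟩
        S.n * (S.n * S.n) + H * (S.n * S.n + q * S.nullPairs)
          ≤⟨ +-monoʳ-≤ _ (*-monoˡ-≤ (<⇒≤ 0<H) (+-monoʳ-≤ _ B.nullPairs-bound)) ⟩
        S.n * (S.n * S.n) + H * (S.n * S.n + (S.n * S.n + ι 2 * (q ^ⁿ m * S.n)))
          ≈⟨ +-cong (*-cong n≈ (*-cong n≈ n≈)) (*-congˡ (+-cong (*-cong n≈ n≈) (+-cong (*-cong n≈ n≈) (*-congˡ (*-cong qᵐ≈y n≈))))) ⟩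
        N * (N * N) + H * (N * N + (N * N + ι 2 * (y * N))) ∎
        where
        n≈ : S.n ≈ N
        n≈ = sym (∣∣≈∑ E)

      Λ₄≤y³ : ∀ {K} → 0# < K → N ≤ K * (y * h) → ι (Λ₄ E) ≤ (K * K * K + ι 2 * (K * K) + ι 2 * K) * (y * (y * y))
      Λ₄≤y³ {K} 0<K N≤ = *-cancelˡ-≤ 0<q (begin
        q * ι (Λ₄ E)                     ≤⟨ qΛ₄≤ ⟩
        N * (N * N) + H * (N * N + (N * N + ι 2 * (y * N))) ≤⟨ cubic-bound 1≤h (<⇒≤ 0<y) (<⇒≤ 0<K) (ι-nonneg ∣ E ∣) N≤ ⟩
        A * (y * (y * y)) * h ^ⁿ 4       ≈⟨ trans (*-comm _ _) (*-congʳ h⁴≈q) ⟩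
        q * (A * (y * (y * y)))          ∎)
        where
        A = K * K * K + ι 2 * (K * K) + ι 2 * K

  module LargeSets {c : ℝ} (0<c : 0# < c) where

    K A : ℝ
    K = c + 1#
    A = K * K * K + ι 2 * (K * K) + ι 2 * K

    0<K : 0# < K
    0<K = +-pos (<⇒≤ 0<c) 0<1

    0<A : 0# < A
    0<A = +-pos (+-nonneg (*-nonneg (*-nonneg (<⇒≤ 0<K) (<⇒≤ 0<K)) (<⇒≤ 0<K)) (*-nonneg (ι-nonneg 2) (0≤x² K)))
      (*-pos (0<ι 1) 0<K)

    threshold = Threshold₁.threshold 0<c 0<A

    c′ : ℝ
    c′ = proj₁ threshold

    bound : ∀ F → let open Geometry F; q = ι (FiniteField.order F) in ∀ g (E : Subset d) →
      (FiniteField.order F % 4 ≡ 1 ⊎ ∃ λ k → m ≡ k ℕ.+ k) → Primitive F g → E ⊆ Sphere g →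
      c * q ^ (ι d / ι 2 - ι 1 / ι 4) ≤ ι ∣ E ∣ → c′ * q ≤ ι ∣Δ E ∣
    bound F g E good g-primitive E⊆S cq^≤∣E∣ = ≤-trans
      -- The energy estimate holds for every subset of the sphere, so it is applied to `E′`
      -- directly.
      (proj₂ (proj₂ threshold) F E′ cX≤∣E′∣ (≤-respʳ-≈ (*-congˡ (OnSphere.y³≈ F g-primitive good))
        (OnSphere.Λ₄≤y³ F g-primitive good E′ (λ x x∈ → E⊆S x (E′⊆E x∈)) 0<K
          (≤-respʳ-≈ (*-congˡ (OnSphere.h⁴ᵐ⁺¹≈yh F g-primitive good)) ∣E′∣≤))))
      (Subsets.Δ-mono R F {E = E} {E′} E′⊆E)
      where
      open Geometry F
      open QuarterPowers F
      X = h ^ⁿ (4 ℕ.* m ℕ.+ 1)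
      smaller = cut F E (^ⁿ-pos (4 ℕ.* m ℕ.+ 1) 0<h) (1≤^ⁿ (4 ℕ.* m ℕ.+ 1) 1≤h) 0<c
        (≤-respˡ-≈ (*-congˡ (q^≈h^ (4 ℕ.* m ℕ.+ 1) exponent₁)) cq^≤∣E∣)
      E′ = proj₁ smaller
      E′⊆E : ∀ {x} → x ∈ E′ → x ∈ E
      E′⊆E = proj₁ (proj₂ smaller)
      cX≤∣E′∣ : c * X ≤ ι ∣ E′ ∣
      cX≤∣E′∣ = proj₁ (proj₂ (proj₂ smaller))
      ∣E′∣≤ : ι ∣ E′ ∣ ≤ K * X
      ∣E′∣≤ = proj₁ (proj₂ (proj₂ (proj₂ smaller)))

  module SmallEnergy {C c : ℝ} (0<C : 0# < C) (0<c : 0# < c) where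

    K A : ℝ
    K = c + 1#
    -- The first summand collects the two terms of the assumed estimate at size K y, the second the
    -- solutions that are not proper.
    A = C * (K * K * K + K * K) + ι 3 * (K * K)

    0<K : 0# < K
    0<K = +-pos (<⇒≤ 0<c) 0<1

    0<A : 0# < A
    0<A = +-pos (*-nonneg (<⇒≤ 0<C) (+-nonneg (*-nonneg (0≤x² K) (<⇒≤ 0<K)) (0≤x² K))) (*-pos (0<ι 2) (*-pos 0<K 0<K))

    threshold = Threshold₂.threshold 0<c 0<A

    c′ : ℝ
    c′ = proj₁ threshold

    bound : ∀ F → let open Geometry F; q = ι (FiniteField.order F) in ∀ (E : Subset d) →
      ι (Λ₄ E) ≤ C * (ι ∣ E ∣ ^ⁿ 3 / q + q ^ ((ι d - ι 3) / ι 2) * ι ∣ E ∣ ^ⁿ 2) →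
      c * q ^ (ι d / ι 2 - ι 1 / ι 2) ≤ ι ∣ E ∣ → c′ * q ≤ ι ∣Δ E ∣
    bound F E Λ₄E≤ cq^≤∣E∣ = ≤-trans
      (proj₂ (proj₂ threshold) F E′ cy≤N (≤-respʳ-≈ (*-congˡ zy²≈) Λ₄E′≤))
      (Subsets.Δ-mono R F {E = E} {E′} E′⊆E)
      where
      open Geometry F
      open QuarterPowers F
      open Subsets R F using (properEnergy; properEnergy≤Λ₄; Λ₄≤)
      open Energy R F (character F) using (0<q)
      q y z n N : ℝ
      q = ι (FiniteField.order F)
      y = h ^ⁿ (4 ℕ.* m)
      z = h ^ⁿ (4 ℕ.* m′)
      n = ι ∣ E ∣
      0<y : 0# < y
      0<y = ^ⁿ-pos (4 ℕ.* m) 0<h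
      0<z : 0# < z
      0<z = ^ⁿ-pos (4 ℕ.* m′) 0<h
      1≤z : 1# ≤ z
      1≤z = 1≤^ⁿ (4 ℕ.* m′) 1≤h
      zy²≈ : z * (y * y) ≈ h ^ⁿ (4 ℕ.* m′ ℕ.+ (4 ℕ.* m ℕ.+ 4 ℕ.* m))
      zy²≈ = sym (trans (^ⁿ-homo-* h (4 ℕ.* m′) (4 ℕ.* m ℕ.+ 4 ℕ.* m)) (*-congˡ (^ⁿ-homo-* h (4 ℕ.* m) (4 ℕ.* m))))
      y/q≈z : y / q ≈ z
      y/q≈z = /-unique (<⇒≉ 0<q) (trans (*-congˡ (sym (qⁿ≈h⁴ⁿ m′))) (qⁿ≈h⁴ⁿ m))
      cy≤n : c * y ≤ n
      cy≤n = ≤-respˡ-≈ (*-congˡ (q^≈h^ (4 ℕ.* m) exponent₂)) cq^≤∣E∣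
      smaller = cut F E 0<y (1≤^ⁿ (4 ℕ.* m) 1≤h) 0<c cy≤n
      E′ = proj₁ smaller
      N = ι ∣ E′ ∣
      E′⊆E : ∀ {x} → x ∈ E′ → x ∈ E
      E′⊆E = proj₁ (proj₂ smaller)
      cy≤N : c * y ≤ N
      cy≤N = proj₁ (proj₂ (proj₂ smaller))
      N≤Ky : N ≤ K * y
      N≤Ky = proj₁ (proj₂ (proj₂ (proj₂ smaller)))
      N≤n : N ≤ n
      N≤n = proj₁ (proj₂ (proj₂ (proj₂ (proj₂ smaller))))
      rarer : properEnergy E′ * n ^ⁿ 3 ≤ properEnergy E * N ^ⁿ 3
      rarer = proj₂ (proj₂ (proj₂ (proj₂ (proj₂ smaller))))
      0<n : 0# < n
      0<n = <-≤-trans (*-pos 0<c 0<y) cy≤n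
      0≤N : 0# ≤ N
      0≤N = ι-nonneg ∣ E′ ∣
      N²≤ : N * N ≤ K * y * (K * y)
      N²≤ = *-mono-≤ 0≤N N≤Ky 0≤N N≤Ky
      -- Multiplication by (N/n)³ turns n³/q into N³/q exactly and z n² into z N³/n, which is at
      -- most z N² because N ≤ n. So `E′` satisfies the assumed estimate with the same constant, as
      -- far as proper solutions are concerned.
      proper≤ : properEnergy E′ ≤ C * (N * (N * N) * q ⁻¹ + z * (N * N))
      proper≤ = *-cancelˡ-≤ (^ⁿ-pos 3 0<n) (begin
        n ^ⁿ 3 * properEnergy E′
          ≈⟨ *-comm _ _ ⟩
        properEnergy E′ * n ^ⁿ 3
          ≤⟨ rarer ⟩
        properEnergy E * N ^ⁿ 3
          ≤⟨ *-monoʳ-≤ (^ⁿ-nonneg 3 0≤N) (≤-trans (properEnergy≤Λ₄ E) Λ₄E≤) ⟩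
        C * (n ^ⁿ 3 / q + q ^ ((ι d - ι 3) / ι 2) * n ^ⁿ 2) * N ^ⁿ 3
          ≈⟨ *-congʳ (*-congˡ (+-congˡ (*-congʳ (q^≈h^ (4 ℕ.* m′) exponent₃)))) ⟩
        C * (n ^ⁿ 3 * q ⁻¹ + z * n ^ⁿ 2) * N ^ⁿ 3
          ≤⟨ ≤-by-difference (C * (z * (n * n * (N * N) * (n - N))))
               (*-nonneg (<⇒≤ 0<C) (*-nonneg (<⇒≤ 0<z) (*-nonneg (*-nonneg (0≤x² n) (0≤x² N)) (x≤y⇒0≤y-x N≤n))))
               (solve 5 (λ C z i n N →
                 n :* (n :* (n :* :1)) :* (C :* (N :* (N :* N) :* i :+ z :* (N :* N))) :-
                 C :* (n :* (n :* (n :* :1)) :* i :+ z :* (n :* (n :* :1))) :* (N :* (N :* (N :* :1))) :=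
                 C :* (z :* (n :* n :* (N :* N) :* (n :- N)))) refl C z (q ⁻¹) n N) ⟩
        n ^ⁿ 3 * (C * (N * (N * N) * q ⁻¹ + z * (N * N))) ∎)
      Λ₄E′≤ : ι (Λ₄ E′) ≤ A * (z * (y * y))
      Λ₄E′≤ = begin
        ι (Λ₄ E′)
          ≤⟨ Λ₄≤ E′ ⟩
        properEnergy E′ + ι 3 * (N * N)
          ≤⟨ +-monoˡ-≤ _ proper≤ ⟩
        C * (N * (N * N) * q ⁻¹ + z * (N * N)) + ι 3 * (N * N)
          ≤⟨ +-mono-≤ (*-monoˡ-≤ (<⇒≤ 0<C) (+-mono-≤
               (*-monoʳ-≤ (<⇒≤ (⁻¹-pos 0<q)) (*-mono-≤ 0≤N N≤Ky (0≤x² N) N²≤)) (*-monoˡ-≤ (<⇒≤ 0<z) N²≤)))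
               (*-monoˡ-≤ (ι-nonneg 3) N²≤) ⟩
        C * (K * y * (K * y * (K * y)) * q ⁻¹ + z * (K * y * (K * y))) + ι 3 * (K * y * (K * y))
          ≈⟨ solve 5 (λ C K y z i → C :* (K :* y :* (K :* y :* (K :* y)) :* i :+ z :* (K :* y :* (K :* y))) :+ :3 :* (K :* y :* (K :* y)) :=
               C :* (K :* K :* K :* (y :* y) :* (y :* i) :+ K :* K :* z :* (y :* y)) :+ :3 :* (K :* K) :* (y :* y)) refl C K y z (q ⁻¹) ⟩
        C * (K * K * K * (y * y) * (y / q) + K * K * z * (y * y)) + ι 3 * (K * K) * (y * y)
          ≈⟨ +-congʳ (*-congˡ (+-congʳ (*-congˡ y/q≈z))) ⟩
        C * (K * K * K * (y * y) * z + K * K * z * (y * y)) + ι 3 * (K * K) * (y * y)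
          -- The contribution of order y² from the solutions that are not proper is absorbed by z
          -- y², as z = q^(m - 1) is at least 1.
          ≤⟨ ≤-by-difference (ι 3 * (K * K) * (y * y) * (z - 1#))
               (*-nonneg (*-nonneg (*-nonneg (ι-nonneg 3) (0≤x² K)) (0≤x² y)) (x≤y⇒0≤y-x 1≤z))
               (solve 4 (λ C K y z →
                 (C :* (K :* K :* K :+ K :* K) :+ :3 :* (K :* K)) :* (z :* (y :* y)) :-
                 (C :* (K :* K :* K :* (y :* y) :* z :+ K :* K :* z :* (y :* y)) :+ :3 :* (K :* K) :* (y :* y)) :=
                 :3 :* (K :* K) :* (y :* y) :* (z :- :1)) refl C K y z) ⟩
        A * (z * (y * y)) ∎

theorem5 : (R : Reals) (character : ∀ F → NontrivialAdditiveCharacter R F) (d : ℕ) →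
    Distance.Conjecture R character d →
    let open Reals R in
    (∀ c → 0# < c → ∃ λ c′ → 0# < c′ ×
    (∀ F →
    let open Geometry F
        q = ι (FiniteField.order F)
    in
    ∀ g (E : Subset d) →
    AdmissibleDimension d (FiniteField.order F) → Primitive F g → E ⊆ Sphere g →
    c * q ^ (ι d / ι 2 - ι 1 / ι 4) ≤ ι ∣ E ∣ →
    c′ * q ≤ ι ∣Δ E ∣))
    ×
    (∀ C c → 0# < C → 0# < c → ∃ λ c′ → 0# < c′ ×
    (∀ F →
    let open Geometry F
        q = ι (FiniteField.order F)
    in
    ∀ g (E : Subset d) →
    AdmissibleDimension d (FiniteField.order F) → Primitive F g → E ⊆ Sphere g →
    ι (Λ₄ E) ≤ C * (ι ∣ E ∣ ^ⁿ 3 / q + q ^ ((ι d - ι 3) / ι 2) * ι ∣ E ∣ ^ⁿ 2) →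
    c * q ^ (ι d / ι 2 - ι 1 / ι 2) ≤ ι ∣ E ∣ →
    c′ * q ≤ ι ∣Δ E ∣))
theorem5 R character d conjecture with Dimension.decide d
-- Both parts are vacuous over every field, and the constant 1 is an arbitrary positive value.
... | inj₂ inadmissible =
  (λ c _ → 1# , 0<1 , λ F g E admissible → ⊥-elim (inadmissible (FiniteField.order F) admissible)) ,
  (λ C c _ _ → 1# , 0<1 , λ F g E admissible → ⊥-elim (inadmissible (FiniteField.order F) admissible))
  where
  open Reals R
  open RealProperties R using (0<1)
... | inj₁ (m′ , ≡.refl) =
  (λ c 0<c → let open OddDimension.LargeSets R character m′ conjecture 0<c in
    c′ , proj₁ (proj₂ threshold) ,
    λ F g E admissible → bound F g E (Dimension.admissible⇒good {suc m′} {FiniteField.order F} admissible)) ,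
  (λ C c 0<C 0<c → let open OddDimension.SmallEnergy R character m′ conjecture 0<C 0<c in
    c′ , proj₁ (proj₂ threshold) , λ F g E _ _ _ → bound F E)
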